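{- Let $F$ be the free pro-$p$-group on $x_1,\ldots,x_d$. (i) Let $1\neq r\in F_{(2)}$ such that for some $\tau=(\tau_1,\ldots,\tau_d)$ the initial form $\rho$ of $r$ in $\mathrm{gr}^\tau F$ is a Lie polynomial, i.e. $\rho\in L(X)\subset L_{res}(X)\cong\mathrm{gr}^\tau F$, $X=\{X_1,\ldots,X_d\}$. Then $G=F/(r)$ is mild with respect to the Zassenhaus $(x,\tau)$-filtration. (ii) Let $r\in F_{(2)}$ such that for some $\tau=(\tau_1,\ldots,\tau_d)$ and some $n\in\mathbb{N}$ with $(n,p)=1$ we have $r\in F_{(\tau,n)}\setminus F_{(\tau,n+1)}$. Then $G=F/(r)$ is mild with respect to the Zassenhaus $(x,\tau)$-filtration.
   Context: Let $p$ be a prime. Identify the complete group algebra of $F$ over $\mathbb{F}_p$ with the algebra $\mathbb{F}_p\langle\langle X_1,\ldots,X_d\rangle\rangle$ of formal power series in non-commuting indeterminates via $x_i\mapsto1+X_i$. For integers $\tau_i>0$, the Zassenhaus $(x,\tau)$-filtration is $F_{(\tau,n)}=\{f\in F\mid f-1$ has only monomials $X_{i_1}\cdots X_{i_k}$ with $\tau_{i_1}+\ldots+\tau_{i_k}\ge n\}$; $F_{(2)}$ is the second step of the usual Zassenhaus filtration ($\tau=(1,\ldots,1)$). The graded restricted Lie algebra $\mathrm{gr}^\tau F=\bigoplus F_{(\tau,n)}/F_{(\tau,n+1)}$ identifies with the free restricted Lie algebra $L_{res}(X)$ inside $\mathbb{F}_p\langle X_1,\ldots,X_d\rangle$ (graded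 by $\deg X_i=\tau_i$), which contains the free Lie algebra $L(X)$ generated by $X$. A one-relator quotient $G=F/(r)$ is mild with respect to the $(x,\tau)$-filtration if the initial form $\rho$ of $r$ is strongly free, i.e. $\mathbb{F}_p\langle X\rangle/(\rho)$ has Poincaré series $1/(1-(t^{\tau_1}+\ldots+t^{\tau_d})+t^{\deg\rho})$; mild groups have cohomological dimension 2. -}

module Defs where

open import Data.Nat as ℕ using (ℕ; zero; suc; _≤_; _<_; _≡ᵇ_; _≤ᵇ_)
open import Data.Integer as ℤ using (ℤ; +_; _-_; _*_; 0ℤ; 1ℤ)
open import Data.Integer.Divisibility using (_∣_)
open import Data.Fin using (Fin; _≟_)
open import Data.List using (List; []; _∷_; map; foldr; length)
open import Data.List.Relation.Unary.All using (All)
open import Data.Bool using (Bool; true; false; if_then_else_; _∧_)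
open import Data.Product using (Σ; _×_; _,_; ∃)
open import Relation.Nullary using (¬_)
open import Relation.Nullary.Decidable using (⌊_⌋)
open import Relation.Binary.PropositionalEquality using (_≡_; _≢_)

-- Coefficients: integers read modulo p (i.e. elements of F_p).

_≡[_]_ : ℤ → ℕ → ℤ → Set
a ≡[ p ] b = (+ p) ∣ (a - b)

sumℤ : List ℤ → ℤ
sumℤ = foldr ℤ._+_ 0ℤ

-- Noncommutative formal power series F_p⟨⟨X_1..X_d⟩⟩:
-- a monomial X_{i1}⋯X_{ik} is the word (i1 ∷ … ∷ ik); a series is its
-- coefficient function (coefficients taken mod p, see _≈S_).

Word : ℕ → Set
Word d = List (Fin d)

Series : ℕ → Set
Series d = Word d → ℤ

module _ {d : ℕ} where

  _≈S[_]_ : Series d → ℕ → Series d → Set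
  f ≈S[ p ] g = ∀ w → f w ≡[ p ] g w

  zeroS : Series d
  zeroS _ = 0ℤ

  oneS : Series d
  oneS []      = 1ℤ
  oneS (_ ∷ _) = 0ℤ

  X : Fin d → Series d
  X i (j ∷ []) = if ⌊ i ≟ j ⌋ then 1ℤ else 0ℤ
  X i _        = 0ℤ

  _+S_ : Series d → Series d → Series d
  (f +S g) w = f w ℤ.+ g w

  _-S_ : Series d → Series d → Series d
  (f -S g) w = f w - g w

  _·S_ : ℤ → Series d → Series d
  (a ·S f) w = a * f w

  splits : Word d → List (Word d × Word d)
  splits []       = ([] , []) ∷ []
  splits (x ∷ xs) = ([] , x ∷ xs) ∷ map (λ { (u , v) → (x ∷ u , v) }) (splits xs)

  _*S_ : Series d → Series d → Series d
  (f *S g) w = sumℤ (map (λ { (u , v) → f u * g v }) (splits w))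

  sumS : List (Series d) → Series d
  sumS = foldr _+S_ zeroS

  -- Magnus embedding of the free pro-p group F on x_1..x_d:
  -- x_i ↦ 1 + X_i,   x_i⁻¹ ↦ Σ_k (-X_i)^k.

  allEq : Fin d → Word d → Bool
  allEq i []       = true
  allEq i (j ∷ w)  = ⌊ i ≟ j ⌋ ∧ allEq i w

  gen : Fin d → Series d
  gen i = oneS +S X i

  genInv : Fin d → Series d
  genInv i w = if allEq i w then (ℤ.- 1ℤ) ℤ.^ length w else 0ℤ

  evalWord : List (Fin d × Bool) → Series d
  evalWord []                = oneS
  evalWord ((i , true)  ∷ ω) = gen i *S evalWord ω
  evalWord ((i , false) ∷ ω) = genInv i *S evalWord ω

  -- f lies in (the image of) the free pro-p group F: the closure, in the
  -- X-adic topology, of the subgroup generated by the 1 + X_i.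
  InF : ℕ → Series d → Set
  InF p f = ∀ N → ∃ λ ω → ∀ w → length w < N → f w ≡[ p ] evalWord ω w

  weight : (Fin d → ℕ) → Word d → ℕ
  weight τ []      = 0
  weight τ (i ∷ w) = τ i ℕ.+ weight τ w

  InFτ : ℕ → (Fin d → ℕ) → ℕ → Series d → Set
  InFτ p τ n f = ∀ w → weight τ w < n → (f -S oneS) w ≡[ p ] 0ℤ

  InF2 : ℕ → Series d → Set
  InF2 p f = InFτ p (λ _ → 1) 2 f

  -- weight-n homogeneous component of f - 1; for f ∈ F_(τ,n) \ F_(τ,n+1)
  -- this is the initial form of f in gr^τ F ⊆ F_p⟨X⟩.
  initForm : (Fin d → ℕ) → ℕ → Series d → Series d
  initForm τ n f w = if weight τ w ≡ᵇ n then (f -S oneS) w else 0ℤ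

  data IsLie (p : ℕ) : Series d → Set where
    lie-zero : ∀ {f} → f ≈S[ p ] zeroS → IsLie p f
    lie-gen  : ∀ {f} i → f ≈S[ p ] X i → IsLie p f
    lie-lin  : ∀ {f} (a b : ℤ) g h → IsLie p g → IsLie p h →
               f ≈S[ p ] ((a ·S g) +S (b ·S h)) → IsLie p f
    lie-br   : ∀ {f} g h → IsLie p g → IsLie p h →
               f ≈S[ p ] ((g *S h) -S (h *S g)) → IsLie p f

  IsPoly : ℕ → Series d → Set
  IsPoly p f = ∃ λ N → ∀ w → N ≤ length w → f w ≡[ p ] 0ℤ

  Homog : ℕ → (Fin d → ℕ) → ℕ → Series d → Set
  Homog p τ m f = ∀ w → weight τ w ≢ m → f w ≡[ p ] 0ℤ

  InIdeal : ℕ → Series d → Series d → Set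
  InIdeal p ρ f =
    Σ (List (Series d × Series d)) λ L →
      All (λ ab → IsPoly p (Data.Product.proj₁ ab) × IsPoly p (Data.Product.proj₂ ab)) L
      × f ≈S[ p ] sumS (map (λ { (a , b) → (a *S ρ) *S b }) L)

  lincomb : (k : ℕ) → (Fin k → ℤ) → (Fin k → Series d) → Series d
  lincomb zero    c b = zeroS
  lincomb (suc k) c b = (c Data.Fin.zero ·S b Data.Fin.zero) +S lincomb k (λ j → c (Data.Fin.suc j)) (λ j → b (Data.Fin.suc j))

  QuotDim : ℕ → (Fin d → ℕ) → Series d → ℕ → ℕ → Set
  QuotDim p τ ρ m k =
    Σ (Fin k → Series d) λ b →
      (∀ j → Homog p τ m (b j))
      × (∀ f → Homog p τ m f → ∃ λ (c : Fin k → ℤ) → InIdeal p ρ (f -S lincomb k c b))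
      × (∀ (c : Fin k → ℤ) → InIdeal p ρ (lincomb k c b) → ∀ j → c j ≡[ p ] 0ℤ)

  sumFin : (n : ℕ) → (Fin n → ℤ) → ℤ
  sumFin zero    g = 0ℤ
  sumFin (suc n) g = g Data.Fin.zero ℤ.+ sumFin n (λ j → g (Data.Fin.suc j))

  -- Σ_m h_m t^m = 1 / (1 - (t^τ1 + … + t^τd) + t^e), written as
  -- (1 - Σ t^τi + t^e) · Σ h_m t^m = 1, coefficient of t^m:
  PoincareEq : (Fin d → ℕ) → ℕ → (ℕ → ℕ) → Set
  PoincareEq τ e h = ∀ m →
    ((+ h m) - sumFin d (λ i → if τ i ≤ᵇ m then + h (m ℕ.∸ τ i) else 0ℤ))
      ℤ.+ (if e ≤ᵇ m then + h (m ℕ.∸ e) else 0ℤ)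
    ≡ (if m ≡ᵇ 0 then 1ℤ else 0ℤ)

  StronglyFree : ℕ → (Fin d → ℕ) → ℕ → Series d → Set
  StronglyFree p τ e ρ =
    Σ (ℕ → ℕ) λ h → (∀ m → QuotDim p τ ρ m (h m)) × PoincareEq τ e h

  Mild : ℕ → (Fin d → ℕ) → Series d → Set
  Mild p τ r = ∀ n → InFτ p τ n r → ¬ InFτ p τ (suc n) r →
               StronglyFree p τ n (initForm τ n r)

{-# OPTIONS --safe #-}
module Submission where

-- Order words lexicographically and let w be the least word in the support of
-- the initial form ρ.  Modulo p, ρ vanishes on all proper shuffle products: in
-- (i) because Lie polynomials are primitive, in (ii) because the coefficients of
-- an element of F multiply by the infiltration product, whose top part is the
-- shuffle product.  Write w = u lᵐ with l the least suffix of w, a Lyndon word,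
-- and m maximal.  If u is nonempty, then w is the greatest word of the shuffle
-- product of u and lᵐ and occurs in it once, which is impossible as ρ vanishes on
-- all smaller words.  If u is empty and m ≥ 2, test ρ on the m-th divided power
-- of l instead, whose greatest word is lᵐ with coefficient 1; ρ vanishes there
-- since its m-fold multiple is a proper shuffle product and m can be cancelled:
-- over ℤ in (i), and modulo p in (ii), since m divides n.  So w is Lyndon, hence
-- unbordered.  The rewriting rule replacing w by the other words of ρ then has no
-- overlaps, so the words avoiding w form a basis of the quotient by (ρ), and
-- counting them gives the Poincaré series.

open import Defs
open import Data.Bool using (Bool; true; false; if_then_else_; T)
open import Data.Empty using (⊥-elim)
open import Data.Fin as Fin using (Fin)
import Data.Fin.Properties as Finₚ
open import Data.Fin.Induction using (>-wellFounded)
open import Data.Integer as ℤ using (ℤ; +_; _+_; _*_; _-_; -_; 0ℤ; 1ℤ; -1ℤ)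
import Data.Integer.Divisibility.Signed as Signed
import Data.Integer.Properties as ℤₚ
open import Data.Integer.Tactic.RingSolver using (solve-∀)
open import Data.List using (List; []; _∷_; _++_; map; concatMap; filter; length; lookup; allFin)
import Data.List.Properties as Listₚ
open import Data.List.Membership.Propositional using (_∈_)
import Data.List.Membership.Propositional.Properties as ∈ₚ
open import Data.List.Relation.Unary.All as All using (All; []; _∷_)
import Data.List.Relation.Unary.All.Properties as Allₚ
import Data.List.Relation.Unary.AllPairs as AllPairs
import Data.List.Relation.Unary.AllPairs.Properties as AllPairsₚ
open import Data.List.Relation.Binary.Disjoint.Propositional using (Disjoint)
open import Data.List.Relation.Unary.Any using (here; there)
import Data.List.Relation.Unary.Any as Any
import Data.List.Relation.Unary.Any.Properties as Anyₚ
open import Data.List.Relation.Unary.Unique.Propositional using (Unique)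
import Data.List.Relation.Unary.Unique.Propositional.Properties as Uniqueₚ
open import Data.Nat as ℕ using (ℕ; zero; suc; _≤_; _<_; z≤n; s≤s; _≡ᵇ_; _≤ᵇ_)
import Data.Nat.Properties as ℕₚ
import Data.Nat.Divisibility as ℕ∣
open import Data.Nat.Coprimality as Coprimality using (Coprime)
open import Data.Nat.GCD using (module Bézout)
open import Data.Nat.Primality using (Prime)
import Data.Nat.Primality as Primality
open import Data.Product using (∃; ∃₂; _×_; _,_; proj₁; proj₂)
open import Data.Sum using (_⊎_; inj₁; inj₂)
open import Function using (_∘_)
open import Induction.WellFounded using (Acc; acc; WellFounded)
open import Relation.Binary.Definitions using (tri<; tri≈; tri>)
open import Relation.Binary.PropositionalEquality
open import Relation.Nullary using (¬_; Dec; yes; no; contradiction)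
open import Relation.Nullary.Decidable using (⌊_⌋; _×-dec_; ¬?)

-- Congruences and finite sums

-- The obstacle is the series `X_1^p`: modulo p it vanishes on every proper shuffle product, like a
-- Lie polynomial, yet its leading word has borders and it is not strongly free. Shuffle relations
-- modulo p are therefore not enough, and the divided powers carry the extra information that
-- excludes proper powers of Lyndon words as leading words. For the same reason coefficients stay
-- integers and are reduced late: in (i) the multiplicity m may be divisible by p, and it is
-- cancelled on an integral lift of the Lie polynomial that satisfies the shuffle relations exactly.
-- The rule rewrites the least word of ρ into larger ones. It terminates since positive weights
-- leave only finitely many words of a given weight. Linear independence of the words avoiding w is
-- shown by duality: for each such word v, the coefficient of v in a normal form is defined by
-- well-founded recursion as a function on words, and unborderedness makes this function vanish on
-- the ideal.

module Congruence (p : ℕ) where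

  infix 4 _≋_

  -- `_≡[ p ]_` unfolds to a divisibility of absolute values, from which the two sides cannot be
  -- inferred. A record keeps them as parameters, and its explicit quotient turns compatibility with
  -- the operations into ring identities.
  record _≋_ (a b : ℤ) : Set where
    constructor modulo
    field
      quotient : ℤ
      equality : a ≡ b + quotient * + p

  ≋-refl : ∀ {a} → a ≋ a
  ≋-refl {a} = modulo 0ℤ (sym (ℤₚ.+-identityʳ a))

  ≋-reflexive : ∀ {a b} → a ≡ b → a ≋ b
  ≋-reflexive refl = ≋-refl

  ≋-sym : ∀ {a b} → a ≋ b → b ≋ a
  ≋-sym {b = b} (modulo k refl) = modulo (- k) (lemma b k (+ p))
    where
    lemma : ∀ b k q → b ≡ (b + k * q) + - k * q
    lemma = solve-∀

  ≋-trans : ∀ {a b c} → a ≋ b → b ≋ c → a ≋ c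
  ≋-trans {c = c} (modulo k refl) (modulo l refl) = modulo (l + k) (lemma c l k (+ p))
    where
    lemma : ∀ c l k q → (c + l * q) + k * q ≡ c + (l + k) * q
    lemma = solve-∀

  +-≋ : ∀ {a b c d} → a ≋ b → c ≋ d → a + c ≋ b + d
  +-≋ {b = b} {d = d} (modulo k refl) (modulo l refl) = modulo (k + l) (lemma b d k l (+ p))
    where
    lemma : ∀ b d k l q → (b + k * q) + (d + l * q) ≡ (b + d) + (k + l) * q
    lemma = solve-∀

  *-≋ : ∀ {a b c d} → a ≋ b → c ≋ d → a * c ≋ b * d
  *-≋ {b = b} {d = d} (modulo k refl) (modulo l refl) =
    modulo (k * d + b * l + k * + p * l) (lemma b d k l (+ p))
    where
    lemma : ∀ b d k l q → (b + k * q) * (d + l * q) ≡ b * d + (k * d + b * l + k * q * l) * q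
    lemma = solve-∀

  *-≋ˡ : ∀ c {a b} → a ≋ b → c * a ≋ c * b
  *-≋ˡ c = *-≋ (≋-refl {c})

  *-≋ʳ : ∀ c {a b} → a ≋ b → a * c ≋ b * c
  *-≋ʳ c a≋b = *-≋ a≋b (≋-refl {c})

  -‿≋ : ∀ {a b c d} → a ≋ b → c ≋ d → a - c ≋ b - d
  -‿≋ {b = b} {d = d} (modulo k refl) (modulo l refl) = modulo (k - l) (lemma b d k l (+ p))
    where
    lemma : ∀ b d k l q → (b + k * q) - (d + l * q) ≡ (b - d) + (k - l) * q
    lemma = solve-∀

  *-zero-≋ : ∀ c {a} → a ≋ 0ℤ → c * a ≋ 0ℤ
  *-zero-≋ c a≋0 = ≋-trans (*-≋ˡ c a≋0) (≋-reflexive (ℤₚ.*-zeroʳ c))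

  from-≡[] : ∀ {a b} → a ≡[ p ] b → a ≋ b
  from-≡[] {a} {b} a≡b with Signed.∣ᵤ⇒∣ {+ p} {a - b} a≡b
  ... | Signed.divides q eq = modulo q (trans (lemma a b) (cong (λ s → b + s) eq))
    where
    lemma : ∀ a b → a ≡ b + (a - b)
    lemma = solve-∀

  to-≡[] : ∀ {a b} → a ≋ b → a ≡[ p ] b
  to-≡[] {a} {b} (modulo k eq) = Signed.∣⇒∣ᵤ {+ p} {a - b} (Signed.divides k (trans (cong (_- b) eq) (lemma b (k * + p))))
    where
    lemma : ∀ b x → (b + x) - b ≡ x
    lemma = solve-∀

  _≡[]?_ : ∀ a b → Dec (a ≋ b)
  a ≡[]? b with (+ p) Signed.∣? (a - b)
  ... | yes d = yes (from-≡[] (Signed.∣⇒∣ᵤ d))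
  ... | no ¬d = no (¬d ∘ Signed.∣ᵤ⇒∣ ∘ to-≡[])

  coprime⇒invertible : ∀ {n} → Coprime n p → ∃ λ u → u * + n ≋ 1ℤ
  coprime⇒invertible {n} n⊥p with Coprimality.coprime-Bézout n⊥p
  ... | Bézout.+- x y eq = + x , modulo (+ y) (begin
          + x * + n         ≡⟨ ℤₚ.pos-* x n ⟨
          + (x ℕ.* n)       ≡⟨ cong +_ (sym eq) ⟩
          + (1 ℕ.+ y ℕ.* p) ≡⟨ cong (λ s → 1ℤ + s) (ℤₚ.pos-* y p) ⟩
          1ℤ + + y * + p    ∎)
    where open ≡-Reasoning
  ... | Bézout.-+ x y eq = - (+ x) , modulo (- (+ y)) (begin
          - (+ x) * + n            ≡⟨ lemma (+ x) (+ n) ⟩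
          1ℤ - (1ℤ + + x * + n)    ≡⟨ cong (λ s → 1ℤ - s) (cong (λ s → 1ℤ + s) (ℤₚ.pos-* x n)) ⟨
          1ℤ - + (1 ℕ.+ x ℕ.* n)   ≡⟨ cong (λ k → 1ℤ - + k) eq ⟩
          1ℤ - + (y ℕ.* p)         ≡⟨ cong (λ s → 1ℤ - s) (ℤₚ.pos-* y p) ⟩
          1ℤ - + y * + p           ≡⟨ cong (λ z → 1ℤ + z) (ℤₚ.neg-distribˡ-* (+ y) (+ p)) ⟩
          1ℤ + - (+ y) * + p       ∎)
    where
    open ≡-Reasoning
    lemma : ∀ x n → - x * n ≡ 1ℤ - (1ℤ + x * n)
    lemma = solve-∀

  invertible⇒nonZeroDivisor : ∀ {u a b} → u * a ≋ 1ℤ → a * b ≋ 0ℤ → b ≋ 0ℤ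
  invertible⇒nonZeroDivisor {u} {a} {b} ua≋1 ab≋0 =
    ≋-trans (≋-reflexive (sym (ℤₚ.*-identityˡ b)))
    (≋-trans (*-≋ʳ b (≋-sym ua≋1))
    (≋-trans (≋-reflexive (ℤₚ.*-assoc u a b)) (*-zero-≋ u ab≋0)))

  prime⇒invertible : Prime p → ∀ a → ¬ a ≋ 0ℤ → ∃ λ u → u * a ≋ 1ℤ
  prime⇒invertible pp a a≢0 with coprime⇒invertible {ℤ.∣ a ∣} coprime
    where
    coprime : Coprime ℤ.∣ a ∣ p
    coprime (d∣a , d∣p) with Primality.prime⇒irreducible pp d∣p
    ... | inj₁ d≡1 = d≡1
    ... | inj₂ refl = contradiction (from-≡[] (subst (λ b → p ℕ∣.∣ ℤ.∣ b ∣) (sym (ℤₚ.+-identityʳ a)) d∣a)) a≢0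
  ... | u , u∣a∣≋1 = fix-sign a u∣a∣≋1
    where
    fix-sign : ∀ a → u * + ℤ.∣ a ∣ ≋ 1ℤ → ∃ λ u → u * a ≋ 1ℤ
    fix-sign (+ n)      eq = u , eq
    fix-sign ℤ.-[1+ n ] eq = - u , subst (_≋ 1ℤ) (lemma u (+ suc n)) eq
      where
      lemma : ∀ u a → u * a ≡ - u * - a
      lemma = solve-∀

∑ : {A : Set} → List A → (A → ℤ) → ℤ
∑ L f = sumℤ (map f L)

module _ {A : Set} where

  ∑-cong-All : ∀ {L} {f g : A → ℤ} → All (λ x → f x ≡ g x) L → ∑ L f ≡ ∑ L g
  ∑-cong-All []         = refl
  ∑-cong-All (eq ∷ eqs) = cong₂ _+_ eq (∑-cong-All eqs)

  ∑-cong : ∀ L {f g : A → ℤ} → (∀ x → f x ≡ g x) → ∑ L f ≡ ∑ L g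
  ∑-cong L eq = ∑-cong-All (All.universal eq L)

  ∑-zero : ∀ (L : List A) → ∑ L (λ _ → 0ℤ) ≡ 0ℤ
  ∑-zero []      = refl
  ∑-zero (_ ∷ L) = trans (ℤₚ.+-identityˡ _) (∑-zero L)

  ∑-zero-All : ∀ {L} {f : A → ℤ} → All (λ x → f x ≡ 0ℤ) L → ∑ L f ≡ 0ℤ
  ∑-zero-All {L} eqs = trans (∑-cong-All eqs) (∑-zero L)

  ∑-zeros : ∀ L {f : A → ℤ} → (∀ x → f x ≡ 0ℤ) → ∑ L f ≡ 0ℤ
  ∑-zeros L eq = ∑-zero-All (All.universal eq L)

  ∑-+ : ∀ L (f g : A → ℤ) → ∑ L (λ x → f x + g x) ≡ ∑ L f + ∑ L g
  ∑-+ []      f g = refl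
  ∑-+ (x ∷ L) f g rewrite ∑-+ L f g = lemma (f x) (g x) (∑ L f) (∑ L g)
    where
    lemma : ∀ a b c d → (a + b) + (c + d) ≡ (a + c) + (b + d)
    lemma = solve-∀

  ∑-*ˡ : ∀ L c (f : A → ℤ) → ∑ L (λ x → c * f x) ≡ c * ∑ L f
  ∑-*ˡ []      c f = sym (ℤₚ.*-zeroʳ c)
  ∑-*ˡ (x ∷ L) c f rewrite ∑-*ˡ L c f = sym (ℤₚ.*-distribˡ-+ c (f x) (∑ L f))

  ∑-*ʳ : ∀ L c (f : A → ℤ) → ∑ L (λ x → f x * c) ≡ ∑ L f * c
  ∑-*ʳ L c f = trans (∑-cong L (λ x → ℤₚ.*-comm (f x) c)) (trans (∑-*ˡ L c f) (ℤₚ.*-comm c (∑ L f)))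

  ∑-neg : ∀ L (f : A → ℤ) → ∑ L (λ x → - f x) ≡ - ∑ L f
  ∑-neg []      f = refl
  ∑-neg (x ∷ L) f rewrite ∑-neg L f = sym (ℤₚ.neg-distrib-+ (f x) (∑ L f))

  ∑-++ : ∀ L M (f : A → ℤ) → ∑ (L ++ M) f ≡ ∑ L f + ∑ M f
  ∑-++ []      M f = sym (ℤₚ.+-identityˡ _)
  ∑-++ (x ∷ L) M f rewrite ∑-++ L M f = sym (ℤₚ.+-assoc (f x) (∑ L f) (∑ M f))

  ∑-map : ∀ {B : Set} L (g : B → A) (f : A → ℤ) → ∑ (map g L) f ≡ ∑ L (f ∘ g)
  ∑-map []      g f = refl
  ∑-map (x ∷ L) g f = cong (λ s → f (g x) + s) (∑-map L g f)

  ∑-concatMap : ∀ {B : Set} L (g : B → List A) (f : A → ℤ) → ∑ (concatMap g L) f ≡ ∑ L (λ x → ∑ (g x) f)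
  ∑-concatMap []      g f = refl
  ∑-concatMap (x ∷ L) g f = trans (∑-++ (g x) _ f) (cong (λ s → ∑ (g x) f + s) (∑-concatMap L g f))

∑-swap : ∀ {A B : Set} (L : List A) (M : List B) (f : A → B → ℤ) →
         ∑ L (λ x → ∑ M (f x)) ≡ ∑ M (λ y → ∑ L (λ x → f x y))
∑-swap []      M f = sym (∑-zero M)
∑-swap (x ∷ L) M f rewrite ∑-swap L M f = sym (∑-+ M (f x) _)

module _ {A : Set} (p : ℕ) where
  open Congruence p

  ∑-≋-All : ∀ {L} {f g : A → ℤ} → All (λ x → f x ≋ g x) L → ∑ L f ≋ ∑ L g
  ∑-≋-All []         = ≋-refl
  ∑-≋-All (eq ∷ eqs) = +-≋ eq (∑-≋-All eqs)

  ∑-≋ : ∀ L {f g : A → ℤ} → (∀ x → f x ≋ g x) → ∑ L f ≋ ∑ L g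
  ∑-≋ L eq = ∑-≋-All (All.universal eq L)

  ∑-≋0 : ∀ L {f : A → ℤ} → (∀ x → f x ≋ 0ℤ) → ∑ L f ≋ 0ℤ
  ∑-≋0 L eq = ≋-trans (∑-≋ L eq) (≋-reflexive (∑-zero L))

sumFin≡∑ : ∀ d (g : Fin d → ℤ) → sumFin {d} d g ≡ ∑ (allFin d) g
sumFin≡∑ d g = go d g
  where
  -- The implicit argument of `sumFin` is the alphabet size of its enclosing module; it must stay
  -- `d` while the bound shrinks.
  go : ∀ k (g : Fin k → ℤ) → sumFin {d} k g ≡ ∑ (allFin k) g
  go zero    g = refl
  go (suc k) g = cong (λ s → g Fin.zero + s) (trans (go k (g ∘ Fin.suc)) (sym (trans (cong (λ L → ∑ L g) (sym (Listₚ.map-tabulate (λ i → i) Fin.suc))) (∑-map (allFin k) Fin.suc g))))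

-- Lexicographic order and greatest shuffles

module _ {d : ℕ} where

  infix 4 _≺_ _≼_

  data _≺_ : Word d → Word d → Set where
    []≺  : ∀ {b v} → [] ≺ b ∷ v
    head : ∀ {a b u v} → a Fin.< b → a ∷ u ≺ b ∷ v
    tail : ∀ {a u v} → u ≺ v → a ∷ u ≺ a ∷ v

  -- Separate from `_≺_` so that the exchange arguments can recurse on it letter by letter, with no
  -- case split on equality.
  data _≼_ : Word d → Word d → Set where
    []≼  : ∀ {v} → [] ≼ v
    head : ∀ {a b u v} → a Fin.< b → a ∷ u ≼ b ∷ v
    tail : ∀ {a u v} → u ≼ v → a ∷ u ≼ a ∷ v

  ≺⇒≼ : ∀ {u v} → u ≺ v → u ≼ v
  ≺⇒≼ []≺        = []≼
  ≺⇒≼ (head a<b) = head a<b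
  ≺⇒≼ (tail u≺v) = tail (≺⇒≼ u≺v)

  ≼⇒≡⊎≺ : ∀ {u v} → u ≼ v → u ≡ v ⊎ u ≺ v
  ≼⇒≡⊎≺ {v = []}    []≼ = inj₁ refl
  ≼⇒≡⊎≺ {v = _ ∷ _} []≼ = inj₂ []≺
  ≼⇒≡⊎≺ (head a<b)      = inj₂ (head a<b)
  ≼⇒≡⊎≺ (tail u≼v) with ≼⇒≡⊎≺ u≼v
  ... | inj₁ refl = inj₁ refl
  ... | inj₂ u≺v  = inj₂ (tail u≺v)

  ≼-refl : ∀ {u} → u ≼ u
  ≼-refl {[]}    = []≼
  ≼-refl {_ ∷ _} = tail ≼-refl

  ≺-irrefl : ∀ {u} → ¬ u ≺ u
  ≺-irrefl (head a<a) = Finₚ.<-irrefl refl a<a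
  ≺-irrefl (tail u≺u) = ≺-irrefl u≺u

  ≺-≼-trans : ∀ {u v w} → u ≺ v → v ≼ w → u ≺ w
  ≺-≼-trans []≺        (head _)   = []≺
  ≺-≼-trans []≺        (tail _)   = []≺
  ≺-≼-trans (head a<b) (head b<c) = head (Finₚ.<-trans a<b b<c)
  ≺-≼-trans (head a<b) (tail _)   = head a<b
  ≺-≼-trans (tail _)   (head b<c) = head b<c
  ≺-≼-trans (tail u≺v) (tail v≼w) = tail (≺-≼-trans u≺v v≼w)

  ≼-≺-trans : ∀ {u v w} → u ≼ v → v ≺ w → u ≺ w
  ≼-≺-trans u≼v v≺w with ≼⇒≡⊎≺ u≼v
  ... | inj₁ refl = v≺w
  ... | inj₂ u≺v  = ≺-≼-trans u≺v (≺⇒≼ v≺w)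

  ≼-trans : ∀ {u v w} → u ≼ v → v ≼ w → u ≼ w
  ≼-trans u≼v v≼w with ≼⇒≡⊎≺ u≼v
  ... | inj₁ refl = v≼w
  ... | inj₂ u≺v  = ≺⇒≼ (≺-≼-trans u≺v v≼w)

  ≼-or-≻ : ∀ u v → u ≼ v ⊎ v ≺ u
  ≼-or-≻ []      v       = inj₁ []≼
  ≼-or-≻ (a ∷ u) []      = inj₂ []≺
  ≼-or-≻ (a ∷ u) (b ∷ v) with Finₚ.<-cmp a b
  ... | tri< a<b _ _ = inj₁ (head a<b)
  ... | tri> _ _ b<a = inj₂ (head b<a)
  ... | tri≈ _ refl _ with ≼-or-≻ u v
  ... | inj₁ u≼v = inj₁ (tail u≼v)
  ... | inj₂ v≺u = inj₂ (tail v≺u)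

  ≺-++ˡ : ∀ x {u v} → u ≺ v → x ++ u ≺ x ++ v
  ≺-++ˡ []      u≺v = u≺v
  ≺-++ˡ (a ∷ x) u≺v = tail (≺-++ˡ x u≺v)

  -- Appending on the right need not preserve `_≺_`. The comparison survives when it was decided by
  -- a differing letter; the only other possibility is a proper prefix.
  ≺-prefix-or-stable : ∀ {u v} → u ≺ v →
    (∃₂ λ b s → v ≡ u ++ b ∷ s) ⊎ (∀ x y → u ++ x ≺ v ++ y)
  ≺-prefix-or-stable {v = b ∷ s} []≺ = inj₁ (b , s , refl)
  ≺-prefix-or-stable (head a<b)      = inj₂ (λ _ _ → head a<b)
  ≺-prefix-or-stable (tail u≺v) with ≺-prefix-or-stable u≺v
  ... | inj₁ (b , s , refl) = inj₁ (b , s , refl)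
  ... | inj₂ stable         = inj₂ (λ x y → tail (stable x y))

  data Shuffle : Word d → Word d → Word d → Set where
    done  : Shuffle [] [] []
    left  : ∀ {a u v z} → Shuffle u v z → Shuffle (a ∷ u) v (a ∷ z)
    right : ∀ {b u v z} → Shuffle u v z → Shuffle u (b ∷ v) (b ∷ z)

  -- The shuffles of u and v other than the concatenation u ++ v; one word may
  -- arise both as the concatenation and in this way.
  data Noncanonical : Word d → Word d → Word d → Set where
    left  : ∀ {a u v z} → Noncanonical u v z → Noncanonical (a ∷ u) v (a ∷ z)
    right : ∀ {a b u v z} → Shuffle (a ∷ u) v z → Noncanonical (a ∷ u) (b ∷ v) (b ∷ z)

  ++-shuffle : ∀ u v → Shuffle u v (u ++ v)
  ++-shuffle []      []      = done
  ++-shuffle []      (_ ∷ v) = right (++-shuffle [] v)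
  ++-shuffle (_ ∷ u) v       = left (++-shuffle u v)

  private
    ∷ʳ-++ : ∀ (q : Word d) b y → q ++ b ∷ y ≡ (q ++ b ∷ []) ++ y
    ∷ʳ-++ q b y = sym (Listₚ.++-assoc q (b ∷ []) y)

  -- Moving a prefix q from in front of the larger of two words to in front of
  -- the smaller one can only enlarge the greatest shuffle.
  exchange : ∀ q {x y v z} → v ≼ y → x ≡ q ++ y → Shuffle x v z →
             ∃ λ z′ → Shuffle y (q ++ v) z′ × z ≼ z′
  exchange []      _   refl sh = _ , sh , ≼-refl
  exchange (c ∷ q) v≼y refl (left sh) with exchange q v≼y refl sh
  ... | _ , sh′ , z≼z′ = _ , right sh′ , tail z≼z′
  exchange (c ∷ q) {y = y} {v = v} (head b<a) refl (right sh) = _ , ++-shuffle y (c ∷ q ++ v) , head b<a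
  exchange (c ∷ q) {y = b ∷ y} {v = b ∷ v} (tail v≼y) refl (right sh)
    with exchange (c ∷ q ++ b ∷ []) v≼y (∷ʳ-++ (c ∷ q) b y) sh
  ... | z′ , sh′ , z≼z′ = _ , left (subst (λ t → Shuffle y t z′) (sym (∷ʳ-++ (c ∷ q) b v)) sh′) , tail z≼z′

  -- Strict form of `exchange` for a nonempty prefix. The gain may be invisible in the word itself,
  -- and then it is recorded as noncanonicity, which is the form in which `noncanonical-≺` can
  -- recurse.
  exchange⁺ : ∀ c q {x y v z} → v ≺ y → x ≡ c ∷ q ++ y → Shuffle x v z →
              ∃ λ z′ → Shuffle y (c ∷ q ++ v) z′ × (z ≺ z′ ⊎ (z ≼ z′ × Noncanonical y (c ∷ q ++ v) z′))
  exchange⁺ c q {y = []} () refl sh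
  exchange⁺ c q {y = a ∷ y} v≺y refl (left sh) with exchange q (≺⇒≼ v≺y) refl sh
  ... | _ , sh′ , z≼z′ = _ , right sh′ , inj₂ (tail z≼z′ , right sh′)
  exchange⁺ c q {y = y} {v = v} (head b<a) refl (right sh) = _ , ++-shuffle y (c ∷ q ++ v) , inj₁ (head b<a)
  -- The `b` emitted from the smaller word is now emitted from `y` instead; the other copy joins the
  -- prefix, and the comparison continues with the tails.
  exchange⁺ c q {y = b ∷ y} {v = b ∷ v} (tail v≺y) refl (right sh)
    with exchange⁺ c (q ++ b ∷ []) v≺y (∷ʳ-++ (c ∷ q) b y) sh
  ... | z′ , sh′ , inj₁ z≺z′ =
        _ , left (subst (λ t → Shuffle y t z′) (sym (∷ʳ-++ (c ∷ q) b v)) sh′) , inj₁ (tail z≺z′)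
  ... | z′ , sh′ , inj₂ (z≼z′ , nc) =
        _ , left (subst (λ t → Shuffle y t z′) (sym (∷ʳ-++ (c ∷ q) b v)) sh′)
          , inj₂ (tail z≼z′ , left (subst (λ t → Noncanonical y t z′) (sym (∷ʳ-++ (c ∷ q) b v)) nc))

  -- The condition under which taking letters from `u` first is optimal at every stage: whatever
  -- remains of `u` is still larger than `v`.
  _≺suffixes_ : Word d → Word d → Set
  v ≺suffixes u = ∀ t a s → u ≡ t ++ a ∷ s → v ≺ a ∷ s

  ≺suffixes-tail : ∀ {v a u} → v ≺suffixes (a ∷ u) → v ≺suffixes u
  ≺suffixes-tail {a = a} v≺ t b s refl = v≺ (a ∷ t) b s refl

  -- If the larger word does not come first, then either its first letter beats that of `v`
  -- outright, or the two letters agree and `exchange` repairs the rest.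
  greedy : ∀ {a u v z} → v ≼ a ∷ u → Shuffle (a ∷ u) v z → ∃ λ z′ → Shuffle u v z′ × z ≼ a ∷ z′
  greedy v≼u                    (left sh)  = _ , sh , ≼-refl
  greedy {u = u} {v} (head b<a) (right sh) = _ , ++-shuffle u v , head b<a
  greedy {a}         (tail v≼u) (right sh) with exchange (a ∷ []) v≼u refl sh
  ... | _ , sh′ , z≼z′ = _ , sh′ , tail z≼z′

  shuffle-≼ : ∀ {u v z} → v ≺suffixes u → Shuffle u v z → z ≼ u ++ v
  shuffle-≼ {[]}    v≺ done       = []≼
  shuffle-≼ {[]}    v≺ (right sh) = tail (shuffle-≼ (λ { [] _ _ () ; (_ ∷ _) _ _ () }) sh)
  shuffle-≼ {a ∷ u} v≺ sh with greedy (≺⇒≼ (v≺ [] a u refl)) sh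
  ... | _ , sh′ , z≼z′ = ≼-trans z≼z′ (tail (shuffle-≼ (≺suffixes-tail v≺) sh′))

  -- Strictness gives the greatest word multiplicity one. When an equal letter is emitted from `v`,
  -- `exchange⁺` either gains strictly or yields a noncanonical shuffle of shorter words, to which
  -- induction applies.
  noncanonical-≺ : ∀ {u v z} → v ≺suffixes u → Noncanonical u v z → z ≺ u ++ v
  noncanonical-≺ v≺ (left nc) = tail (noncanonical-≺ (≺suffixes-tail v≺) nc)
  noncanonical-≺ {a ∷ u} v≺ (right sh) with v≺ [] a u refl
  ... | head b<a = head b<a
  ... | tail v≺u with exchange⁺ a [] v≺u refl sh
  ... | _ , sh′ , inj₁ z≺z′        = tail (≺-≼-trans z≺z′ (shuffle-≼ (≺suffixes-tail v≺) sh′))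
  ... | _ , _   , inj₂ (z≼z′ , nc) = tail (≼-≺-trans z≼z′ (noncanonical-≺ (≺suffixes-tail v≺) nc))

  shuffle-monoʳ : ∀ {u v v′ z} → v ≺ v′ → Shuffle u v z → ∃ λ z′ → Shuffle u v′ z′ × z ≺ z′
  shuffle-monoʳ {v′ = v′} []≺ done     = _ , ++-shuffle [] v′ , []≺
  shuffle-monoʳ v≺v′ (left sh) with shuffle-monoʳ v≺v′ sh
  ... | _ , sh′ , z≺z′ = _ , left sh′ , tail z≺z′
  shuffle-monoʳ {u} {v′ = b ∷ v′} (head a<b) (right sh) = _ , right (++-shuffle u v′) , head a<b
  shuffle-monoʳ (tail v≺v′) (right sh) with shuffle-monoʳ v≺v′ sh
  ... | _ , sh′ , z≺z′ = _ , right sh′ , tail z≺z′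

  -- Sums over shuffles

  shuffles : Word d → Word d → List (Word d)
  shuffles []      v       = v ∷ []
  shuffles (a ∷ u) []      = (a ∷ u) ∷ []
  shuffles (a ∷ u) (b ∷ v) = map (a ∷_) (shuffles u (b ∷ v)) ++ map (b ∷_) (shuffles (a ∷ u) v)

  shuffles-sound : ∀ u v → All (Shuffle u v) (shuffles u v)
  shuffles-sound []      v       = ++-shuffle [] v ∷ []
  shuffles-sound (a ∷ u) []      = subst (Shuffle (a ∷ u) []) (Listₚ.++-identityʳ _) (++-shuffle (a ∷ u) []) ∷ []
  shuffles-sound (a ∷ u) (b ∷ v) = Allₚ.++⁺
    (Allₚ.map⁺ (All.map left (shuffles-sound u (b ∷ v))))
    (Allₚ.map⁺ (All.map right (shuffles-sound (a ∷ u) v)))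

  ∑-shuffles-∷ : ∀ a u b v F → ∑ (shuffles (a ∷ u) (b ∷ v)) F ≡
    ∑ (shuffles u (b ∷ v)) (F ∘ (a ∷_)) + ∑ (shuffles (a ∷ u) v) (F ∘ (b ∷_))
  ∑-shuffles-∷ a u b v F = trans (∑-++ (map (a ∷_) (shuffles u (b ∷ v))) _ F)
    (cong₂ _+_ (∑-map (shuffles u (b ∷ v)) (a ∷_) F) (∑-map (shuffles (a ∷ u) v) (b ∷_) F))

  ∑-shuffles-[] : ∀ u F → ∑ (shuffles u []) F ≡ F u
  ∑-shuffles-[] []      F = ℤₚ.+-identityʳ _
  ∑-shuffles-[] (_ ∷ _) F = ℤₚ.+-identityʳ _

  -- Commutativity and associativity of the shuffle product in one symmetric statement, so that a
  -- single induction proves both; an empty `y` gives commutativity. Splitting by the word that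
  -- supplies the first letter leaves three smaller instances.
  ∑-shuffles-leftComm : ∀ u v y F → ∑ (shuffles v y) (λ z → ∑ (shuffles u z) F) ≡
                                    ∑ (shuffles u y) (λ z → ∑ (shuffles v z) F)
  ∑-shuffles-leftComm [] v y F = trans (∑-cong (shuffles v y) (λ z → ℤₚ.+-identityʳ (F z))) (sym (ℤₚ.+-identityʳ _))
  ∑-shuffles-leftComm (a ∷ u) [] y F = trans (ℤₚ.+-identityʳ _) (∑-cong (shuffles (a ∷ u) y) (λ z → sym (ℤₚ.+-identityʳ (F z))))
  ∑-shuffles-leftComm (a ∷ u) (b ∷ v) [] F = begin
    ∑ (shuffles (a ∷ u) (b ∷ v)) F + 0ℤ ≡⟨ ℤₚ.+-identityʳ _ ⟩
    ∑ (shuffles (a ∷ u) (b ∷ v)) F      ≡⟨ ∑-shuffles-∷ a u b v F ⟩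
    ∑ (shuffles u (b ∷ v)) (F ∘ (a ∷_)) + ∑ (shuffles (a ∷ u) v) (F ∘ (b ∷_))
      ≡⟨ cong₂ _+_ (commuted u (b ∷ v) (F ∘ (a ∷_))) (commuted (a ∷ u) v (F ∘ (b ∷_))) ⟩
    ∑ (shuffles (b ∷ v) u) (F ∘ (a ∷_)) + ∑ (shuffles v (a ∷ u)) (F ∘ (b ∷_))
      ≡⟨ ℤₚ.+-comm (∑ (shuffles (b ∷ v) u) (F ∘ (a ∷_))) _ ⟩
    ∑ (shuffles v (a ∷ u)) (F ∘ (b ∷_)) + ∑ (shuffles (b ∷ v) u) (F ∘ (a ∷_))
      ≡⟨ ∑-shuffles-∷ b v a u F ⟨
    ∑ (shuffles (b ∷ v) (a ∷ u)) F      ≡⟨ ℤₚ.+-identityʳ _ ⟨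
    ∑ (shuffles (b ∷ v) (a ∷ u)) F + 0ℤ ∎
    where
    open ≡-Reasoning
    commuted : ∀ u v F → ∑ (shuffles u v) F ≡ ∑ (shuffles v u) F
    commuted u v F = begin
      ∑ (shuffles u v) F                             ≡⟨ ∑-shuffles-[] v (λ z → ∑ (shuffles u z) F) ⟨
      ∑ (shuffles v []) (λ z → ∑ (shuffles u z) F)   ≡⟨ ∑-shuffles-leftComm u v [] F ⟩
      ∑ (shuffles u []) (λ z → ∑ (shuffles v z) F)   ≡⟨ ∑-shuffles-[] u (λ z → ∑ (shuffles v z) F) ⟩
      ∑ (shuffles v u) F                             ∎
  ∑-shuffles-leftComm (a ∷ u) (b ∷ v) (c ∷ y) F = begin
    ∑ (shuffles (b ∷ v) (c ∷ y)) (λ z → ∑ (shuffles (a ∷ u) z) F)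
      ≡⟨ expand a u b v c y ⟩
    (A + ∑ (shuffles v (c ∷ y)) (λ z → ∑ (shuffles (a ∷ u) z) (F ∘ (b ∷_)))) + ∑ (shuffles (b ∷ v) y) (λ z → ∑ (shuffles (a ∷ u) z) (F ∘ (c ∷_)))
      ≡⟨ cong₂ _+_ (cong₂ _+_ (∑-shuffles-leftComm u (b ∷ v) (c ∷ y) (F ∘ (a ∷_)))
                              (∑-shuffles-leftComm (a ∷ u) v (c ∷ y) (F ∘ (b ∷_))))
                   (∑-shuffles-leftComm (a ∷ u) (b ∷ v) y (F ∘ (c ∷_))) ⟩
    (A′ + B′) + C′
      ≡⟨ cong (_+ C′) (ℤₚ.+-comm A′ B′) ⟩
    (B′ + A′) + C′
      ≡⟨ expand b v a u c y ⟨
    ∑ (shuffles (a ∷ u) (c ∷ y)) (λ z → ∑ (shuffles (b ∷ v) z) F) ∎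
    where
    open ≡-Reasoning
    A A′ B′ C′ : ℤ
    A  = ∑ (shuffles (b ∷ v) (c ∷ y)) (λ z → ∑ (shuffles u z) (F ∘ (a ∷_)))
    A′ = ∑ (shuffles u (c ∷ y)) (λ z → ∑ (shuffles (b ∷ v) z) (F ∘ (a ∷_)))
    B′ = ∑ (shuffles (a ∷ u) (c ∷ y)) (λ z → ∑ (shuffles v z) (F ∘ (b ∷_)))
    C′ = ∑ (shuffles (a ∷ u) y) (λ z → ∑ (shuffles (b ∷ v) z) (F ∘ (c ∷_)))
    expand : ∀ a u b v c y → ∑ (shuffles (b ∷ v) (c ∷ y)) (λ z → ∑ (shuffles (a ∷ u) z) F) ≡
      (∑ (shuffles (b ∷ v) (c ∷ y)) (λ z → ∑ (shuffles u z) (F ∘ (a ∷_)))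
       + ∑ (shuffles v (c ∷ y)) (λ z → ∑ (shuffles (a ∷ u) z) (F ∘ (b ∷_))))
       + ∑ (shuffles (b ∷ v) y) (λ z → ∑ (shuffles (a ∷ u) z) (F ∘ (c ∷_)))
    expand a u b v c y = begin
      ∑ (shuffles (b ∷ v) (c ∷ y)) (λ z → ∑ (shuffles (a ∷ u) z) F)
        ≡⟨ ∑-shuffles-∷ b v c y _ ⟩
      ∑ Lb (λ z → ∑ (shuffles (a ∷ u) (b ∷ z)) F) + ∑ Lc (λ z → ∑ (shuffles (a ∷ u) (c ∷ z)) F)
        ≡⟨ cong₂ _+_
             (trans (∑-cong Lb (λ z → ∑-shuffles-∷ a u b z F)) (∑-+ Lb _ _))
             (trans (∑-cong Lc (λ z → ∑-shuffles-∷ a u c z F)) (∑-+ Lc _ _)) ⟩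
      (Pb + Q) + (Pc + R) ≡⟨ rearrange Pb Q Pc R ⟩
      ((Pb + Pc) + Q) + R ≡⟨ cong (λ s → (s + Q) + R) (∑-shuffles-∷ b v c y _) ⟨
      (∑ (shuffles (b ∷ v) (c ∷ y)) (λ z → ∑ (shuffles u z) (F ∘ (a ∷_))) + Q) + R ∎
      where
      Lb Lc : List (Word d)
      Lb = shuffles v (c ∷ y)
      Lc = shuffles (b ∷ v) y
      Pb Pc Q R : ℤ
      Pb = ∑ Lb (λ z → ∑ (shuffles u (b ∷ z)) (F ∘ (a ∷_)))
      Pc = ∑ Lc (λ z → ∑ (shuffles u (c ∷ z)) (F ∘ (a ∷_)))
      Q  = ∑ Lb (λ z → ∑ (shuffles (a ∷ u) z) (F ∘ (b ∷_)))
      R  = ∑ Lc (λ z → ∑ (shuffles (a ∷ u) z) (F ∘ (c ∷_)))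
      rearrange : ∀ a b c d → (a + b) + (c + d) ≡ ((a + c) + b) + d
      rearrange = solve-∀

  module _ (p : ℕ) where
    open Congruence p

    ∑-shuffles-canonical : ∀ u v {f} → (∀ z → Noncanonical u v z → f z ≋ 0ℤ) → ∑ (shuffles u v) f ≋ f (u ++ v)
    ∑-shuffles-canonical []      v       _    = ≋-reflexive (ℤₚ.+-identityʳ _)
    ∑-shuffles-canonical (a ∷ u) []  {f} _    = ≋-reflexive
      (trans (ℤₚ.+-identityʳ _) (cong f (sym (Listₚ.++-identityʳ (a ∷ u)))))
    ∑-shuffles-canonical (a ∷ u) (b ∷ v) {f} f≋0 =
      ≋-trans (≋-reflexive (∑-shuffles-∷ a u b v f))
      (≋-trans (+-≋ (∑-shuffles-canonical u (b ∷ v) (λ z nc → f≋0 (a ∷ z) (left nc)))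
                    (≋-trans (∑-≋-All p (All.map (λ sh → f≋0 (b ∷ _) (right sh)) (shuffles-sound (a ∷ u) v)))
                             (≋-reflexive (∑-zero (shuffles (a ∷ u) v)))))
               (≋-reflexive (ℤₚ.+-identityʳ _)))

-- Divided powers and Lyndon words

module _ {d : ℕ} where

  power : Word d → ℕ → Word d
  power l zero    = []
  power l (suc m) = l ++ power l m

  -- The words of the m-th divided power of x ∷ l in the shuffle algebra, listed
  -- so that the copies of x ∷ l appear in the order of their first letters.
  dividedPower : Fin d → Word d → ℕ → List (Word d)
  dividedPower x l zero    = [] ∷ []
  dividedPower x l (suc m) = concatMap (λ y → map (x ∷_) (shuffles l y)) (dividedPower x l m)

  ∑-dividedPower-suc : ∀ x l m F → ∑ (dividedPower x l (suc m)) F ≡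
    ∑ (dividedPower x l m) (λ y → ∑ (shuffles l y) (F ∘ (x ∷_)))
  ∑-dividedPower-suc x l m F = trans
    (∑-concatMap (dividedPower x l m) (λ y → map (x ∷_) (shuffles l y)) F)
    (∑-cong (dividedPower x l m) (λ y → ∑-map (shuffles l y) (x ∷_) F))

  -- The divided power relation `L · L^(m) = (m + 1) L^(m+1)`. The leading `x` comes from either
  -- factor: one half is `L^(m+1)` by construction, and `∑-shuffles-leftComm` brings the other into
  -- the form of the induction hypothesis.
  ∑-shuffles-dividedPower : ∀ x l m F →
    ∑ (dividedPower x l m) (λ y → ∑ (shuffles (x ∷ l) y) F) ≡ + suc m * ∑ (dividedPower x l (suc m)) F
  ∑-shuffles-dividedPower x l zero F = begin
    (F (x ∷ l) + 0ℤ) + 0ℤ                       ≡⟨ ℤₚ.+-identityʳ (F (x ∷ l) + 0ℤ) ⟩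
    F (x ∷ l) + 0ℤ                              ≡⟨ cong (_+ 0ℤ) (∑-shuffles-[] l (F ∘ (x ∷_))) ⟨
    ∑ (shuffles l []) (F ∘ (x ∷_)) + 0ℤ         ≡⟨ ∑-dividedPower-suc x l 0 F ⟨
    ∑ (dividedPower x l 1) F                    ≡⟨ ℤₚ.*-identityˡ _ ⟨
    1ℤ * ∑ (dividedPower x l 1) F               ∎
    where open ≡-Reasoning
  ∑-shuffles-dividedPower x l (suc m) F = begin
    ∑ (dividedPower x l (suc m)) (λ y → ∑ (shuffles (x ∷ l) y) F)
      ≡⟨ ∑-dividedPower-suc x l m _ ⟩
    ∑ D (λ y → ∑ (shuffles l y) (λ z → ∑ (shuffles (x ∷ l) (x ∷ z)) F))
      ≡⟨ ∑-cong D (λ y → trans (∑-cong (shuffles l y) (λ z → ∑-shuffles-∷ x l x z F)) (∑-+ (shuffles l y) _ _)) ⟩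
    ∑ D (λ y → ∑ (shuffles l y) (λ z → ∑ (shuffles l (x ∷ z)) Fx) + ∑ (shuffles l y) (λ z → ∑ (shuffles (x ∷ l) z) Fx))
      ≡⟨ ∑-+ D _ _ ⟩
    ∑ D (λ y → ∑ (shuffles l y) (λ z → ∑ (shuffles l (x ∷ z)) Fx)) + ∑ D (λ y → ∑ (shuffles l y) (λ z → ∑ (shuffles (x ∷ l) z) Fx))
      ≡⟨ cong₂ _+_ (sym (∑-dividedPower-suc x l m G)) (∑-cong D (λ y → ∑-shuffles-leftComm (x ∷ l) l y Fx)) ⟩
    ∑ (dividedPower x l (suc m)) G + ∑ D (λ y → ∑ (shuffles (x ∷ l) y) G)
      ≡⟨ cong (λ s → ∑ (dividedPower x l (suc m)) G + s) (∑-shuffles-dividedPower x l m G) ⟩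
    ∑ (dividedPower x l (suc m)) G + + suc m * ∑ (dividedPower x l (suc m)) G
      ≡⟨ ℤₚ.suc-* (+ suc m) _ ⟨
    + suc (suc m) * ∑ (dividedPower x l (suc m)) G
      ≡⟨ cong (λ s → + suc (suc m) * s) (sym (∑-dividedPower-suc x l (suc m) F)) ⟩
    + suc (suc m) * ∑ (dividedPower x l (suc (suc m))) F ∎
    where
    open ≡-Reasoning
    D : List (Word d)
    D = dividedPower x l m
    Fx G : Word d → ℤ
    Fx = F ∘ (x ∷_)
    G z = ∑ (shuffles l z) Fx

  dividedPower-nonempty : ∀ x l m → All (λ y → ∃₂ λ b v → y ≡ b ∷ v) (dividedPower x l (suc m))
  dividedPower-nonempty x l m = Allₚ.concat⁺ (Allₚ.map⁺ (All.universal
    (λ y → Allₚ.map⁺ (All.universal (λ z → x , z , refl) (shuffles l y))) (dividedPower x l m)))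

  module _ (p : ℕ) where
    open Congruence p

    -- The m-fold shuffle power would have m! as its leading coefficient; here it is 1. The tail `l`
    -- shuffled with the greatest word of the previous divided power contributes its concatenation
    -- once, and smaller words contribute only smaller shuffles by `shuffle-monoʳ`.
    ∑-dividedPower-leading : ∀ x l → (∀ m → power (x ∷ l) m ≺suffixes l) → ∀ m {f} →
      (∀ z → z ≺ power (x ∷ l) m → f z ≋ 0ℤ) → ∑ (dividedPower x l m) f ≋ f (power (x ∷ l) m)
    ∑-dividedPower-leading x l l^≺ zero    f≋0 = ≋-reflexive (ℤₚ.+-identityʳ _)
    ∑-dividedPower-leading x l l^≺ (suc m) {f} f≋0 =
      ≋-trans (≋-reflexive (∑-dividedPower-suc x l m f))
      (≋-trans (∑-dividedPower-leading x l l^≺ m smaller)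
               (∑-shuffles-canonical p l (power (x ∷ l) m) (λ z nc → f≋0 (x ∷ z) (tail (noncanonical-≺ (l^≺ m) nc)))))
      where
      smaller : ∀ y → y ≺ power (x ∷ l) m → ∑ (shuffles l y) (f ∘ (x ∷_)) ≋ 0ℤ
      smaller y y≺ = ≋-trans (∑-≋-All p (All.map f≋0′ (shuffles-sound l y))) (≋-reflexive (∑-zero (shuffles l y)))
        where
        f≋0′ : ∀ {z} → Shuffle l y z → f (x ∷ z) ≋ 0ℤ
        f≋0′ sh with shuffle-monoʳ y≺ sh
        ... | _ , sh′ , z≺z′ = f≋0 _ (tail (≺-≼-trans z≺z′ (shuffle-≼ (l^≺ m) sh′)))

  -- Lyndon words and least suffixes

  Lyndon : Word d → Set
  Lyndon l = ∀ c t b s → l ≡ c ∷ t ++ b ∷ s → l ≺ b ∷ s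

  record LeastSuffix (w : Word d) : Set where
    field
      initial  : Word d
      first    : Fin d
      rest     : Word d
      equality : w ≡ initial ++ first ∷ rest
      least    : ∀ t b s → w ≡ t ++ b ∷ s → first ∷ rest ≼ b ∷ s

  leastSuffix : ∀ a w → LeastSuffix (a ∷ w)
  leastSuffix a [] = record
    { initial = [] ; first = a ; rest = [] ; equality = refl ; least = single }
    where
    single : ∀ t b s → a ∷ [] ≡ t ++ b ∷ s → a ∷ [] ≼ b ∷ s
    single []          b s refl = ≼-refl
    single (_ ∷ [])    b s ()
    single (_ ∷ _ ∷ _) b s ()
  leastSuffix a (b ∷ w) with leastSuffix b w
  ... | ls with ≼-or-≻ (a ∷ b ∷ w) (LeastSuffix.first ls ∷ LeastSuffix.rest ls)
  ... | inj₁ w≼ls = record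
    { initial = [] ; first = a ; rest = b ∷ w ; equality = refl ; least = least′ }
    where
    least′ : ∀ t c s → a ∷ b ∷ w ≡ t ++ c ∷ s → a ∷ b ∷ w ≼ c ∷ s
    least′ []      c s refl = ≼-refl
    least′ (_ ∷ t) c s eq   = ≼-trans w≼ls (LeastSuffix.least ls t c s (Listₚ.∷-injectiveʳ eq))
  ... | inj₂ ls≺w = record
    { initial = a ∷ initial ; first = first ; rest = rest ; equality = cong (a ∷_) equality ; least = least′ }
    where
    open LeastSuffix ls
    least′ : ∀ t c s → a ∷ b ∷ w ≡ t ++ c ∷ s → first ∷ rest ≼ c ∷ s
    least′ []      c s refl = ≺⇒≼ ls≺w
    least′ (_ ∷ t) c s eq   = least t c s (Listₚ.∷-injectiveʳ eq)

  ++-self : ∀ {c : Fin d} t {u} → ¬ u ≡ c ∷ t ++ u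
  ++-self {c} t {u} eq = ℕₚ.<-irrefl (cong length eq)
    (subst (length u <_) (sym (Listₚ.length-++ (c ∷ t))) (ℕₚ.m<n+m (length u) (s≤s z≤n)))

  leastSuffix-Lyndon : ∀ {w} (ls : LeastSuffix w) → Lyndon (LeastSuffix.first ls ∷ LeastSuffix.rest ls)
  leastSuffix-Lyndon {w} ls c t b s eq with ≼⇒≡⊎≺ (least (initial ++ c ∷ t) b s w≡)
    where
    open LeastSuffix ls
    w≡ : w ≡ (initial ++ c ∷ t) ++ b ∷ s
    w≡ = trans equality (trans (cong (initial ++_) eq) (sym (Listₚ.++-assoc initial (c ∷ t) (b ∷ s))))
  ... | inj₁ refl = ⊥-elim (++-self t eq)
  ... | inj₂ l≺s  = l≺s

  _EndsWith_ : Word d → Word d → Set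
  u EndsWith l = ∃ λ t → u ≡ t ++ l

  -- Makes the exponent of the final power maximal. Recursion from the left suffices: a letter put
  -- in front of a word not ending with `x ∷ l` can change this only by completing the whole word to
  -- `x ∷ l`.
  splitPower : ∀ x l u → ∃₂ λ u₁ m → u ≡ u₁ ++ power (x ∷ l) m × ¬ u₁ EndsWith (x ∷ l)
  splitPower x l [] = [] , 0 , refl , λ { ([] , ()) ; (_ ∷ _ , ()) }
  splitPower x l (a ∷ u) with splitPower x l u
  ... | u₁ , m , refl , ¬end with Listₚ.≡-dec Finₚ._≟_ (a ∷ u₁) (x ∷ l)
  ... | yes refl = [] , suc m , refl , λ { ([] , ()) ; (_ ∷ _ , ()) }
  ... | no  neq  = a ∷ u₁ , m , refl , λ
        { ([] , eq)    → neq eq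
        ; (_ ∷ t , eq) → ¬end (t , Listₚ.∷-injectiveʳ eq) }

  power-comm : ∀ l m → power l m ++ l ≡ l ++ power l m
  power-comm l zero    = sym (Listₚ.++-identityʳ l)
  power-comm l (suc m) = trans (Listₚ.++-assoc l (power l m) l) (cong (l ++_) (power-comm l m))

  leastSuffix-decomposition : ∀ {w} (ls : LeastSuffix w) →
    let l = LeastSuffix.first ls ∷ LeastSuffix.rest ls in
    ∃₂ λ u m → w ≡ u ++ power l (suc m) × ¬ u EndsWith l
  leastSuffix-decomposition ls with splitPower (LeastSuffix.first ls) (LeastSuffix.rest ls) (LeastSuffix.initial ls)
  ... | u , m , eq , ¬end = u , m , trans equality (trans (cong (_++ l) eq) (trans (Listₚ.++-assoc u (power l m) l)
                                                          (cong (u ++_) (power-comm l m)))) , ¬end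
    where
    open LeastSuffix ls
    l : Word d
    l = first ∷ rest

  -- Minimality of `l` concerns suffixes of the whole word, whereas the shuffle argument needs
  -- suffixes of `u` alone. If `b ∷ s` were smaller than `l`, it would have to be a proper prefix of
  -- `l`; the remainder of `l` is then a proper suffix, larger than `l` by the Lyndon property but
  -- too short to stay below `l ++ y`.
  Lyndon-cancel : ∀ {l y b s} → Lyndon l → l ≼ (b ∷ s) ++ l ++ y → l ≼ b ∷ s
  Lyndon-cancel {l} {y} {b} {s} lyn l≼ with ≼-or-≻ l (b ∷ s)
  ... | inj₁ l≼s = l≼s
  ... | inj₂ s≺l with ≺-prefix-or-stable s≺l
  ... | inj₂ stable = ⊥-elim (≺-irrefl (≼-≺-trans l≼ (subst ((b ∷ s) ++ l ++ y ≺_) (Listₚ.++-identityʳ l) (stable (l ++ y) []))))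
  ... | inj₁ (c , t , refl) = ⊥-elim (contra (≺-prefix-or-stable l≺t))
    where
    l≺t : l ≺ c ∷ t
    l≺t = lyn b s c t refl
    cancel : ∀ x {u v} → x ++ u ≼ x ++ v → u ≼ v
    cancel []      u≼v        = u≼v
    cancel (_ ∷ x) (head a<a) = ⊥-elim (Finₚ.<-irrefl refl a<a)
    cancel (_ ∷ x) (tail u≼v) = cancel x u≼v
    t≼ly : c ∷ t ≼ l ++ y
    t≼ly = cancel (b ∷ s) l≼
    contra : ¬ ((∃₂ λ e r → c ∷ t ≡ l ++ e ∷ r) ⊎ (∀ x z → l ++ x ≺ (c ∷ t) ++ z))
    contra (inj₁ (e , r , eq)) = ℕₚ.<-irrefl (cong length eq) (begin-strict
      length (c ∷ t)                        ≤⟨ ℕₚ.m≤n+m (length (c ∷ t)) (length (b ∷ s)) ⟩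
      length (b ∷ s) ℕ.+ length (c ∷ t)     ≡⟨ Listₚ.length-++ (b ∷ s) ⟨
      length l                              <⟨ ℕₚ.m<m+n (length l) (s≤s z≤n) ⟩
      length l ℕ.+ length (e ∷ r)           ≡⟨ Listₚ.length-++ l ⟨
      length (l ++ e ∷ r)                   ∎)
      where open ℕₚ.≤-Reasoning
    contra (inj₂ stable) = ≺-irrefl (≼-≺-trans t≼ly (subst (l ++ y ≺_) (Listₚ.++-identityʳ (c ∷ t)) (stable y [])))

  -- If a suffix of `u` extends `l`, what follows that copy of `l` is again a nonempty suffix of
  -- `u`, so induction on the exponent applies. Otherwise the comparison with `l` is stable under
  -- appending.
  power-≺suffixes : ∀ {l u} → l ≺suffixes u → ∀ m → power l m ≺suffixes u
  power-≺suffixes l≺ zero    t a s eq = []≺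
  power-≺suffixes {l} l≺ (suc m) t a s eq with ≺-prefix-or-stable (l≺ t a s eq)
  ... | inj₁ (b , r , s≡) = subst (l ++ power l m ≺_) (sym s≡)
          (≺-++ˡ l (power-≺suffixes l≺ m (t ++ l) b r (trans eq (trans (cong (t ++_) s≡) (sym (Listₚ.++-assoc t l (b ∷ r)))))))
  ... | inj₂ stable = subst (l ++ power l m ≺_) (Listₚ.++-identityʳ (a ∷ s)) (stable (power l m) [])

  Unbordered : Word d → Set
  Unbordered w = ∀ b s e t → w ≡ (b ∷ s) ++ e → w ≡ t ++ b ∷ s → e ≡ []

  -- A proper border would be below `l` as a prefix and above `l` as a proper suffix.
  Lyndon⇒Unbordered : ∀ {l} → Lyndon l → Unbordered l
  Lyndon⇒Unbordered lyn b s e [] eq₁ refl = Listₚ.++-identityʳ-unique (b ∷ s) eq₁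
  Lyndon⇒Unbordered lyn b s [] (c ∷ t) eq₁ eq₂ = refl
  Lyndon⇒Unbordered {l} lyn b s (f ∷ e) (c ∷ t) eq₁ eq₂ =
    ⊥-elim (≺-irrefl (≺-≼-trans (lyn c t b s eq₂) (subst (b ∷ s ≼_) (sym eq₁) (prefix-≼ (b ∷ s)))))
    where
    prefix-≼ : ∀ x {y} → x ≼ x ++ y
    prefix-≼ []      = []≼
    prefix-≼ (_ ∷ x) = tail (prefix-≼ x)

  module _ (p : ℕ) where
    open Congruence p

    -- The divided power relation is requested only when the power is the leading word itself,
    -- because in (ii) cancelling the exponent relies on its dividing the weight of that word.
    leadingWord-Unbordered : ∀ (ρ : Series d) a w →
      (∀ a u b v → ∑ (shuffles (a ∷ u) (b ∷ v)) ρ ≋ 0ℤ) →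
      (∀ x l m → power (x ∷ l) (2 ℕ.+ m) ≡ a ∷ w → ∑ (dividedPower x l (2 ℕ.+ m)) ρ ≋ 0ℤ) →
      (∀ z → z ≺ a ∷ w → ρ z ≋ 0ℤ) → ¬ ρ (a ∷ w) ≋ 0ℤ → Unbordered (a ∷ w)
    leadingWord-Unbordered ρ a w ρ-shuffle ρ-divided ρ-below ρw≢0
      with leastSuffix a w
    ... | ls with leastSuffix-decomposition ls
    ... | u , m , w≡ , ¬end = go u m w≡ ¬end
      where
      open LeastSuffix ls using (least) renaming (first to x; rest to l)
      lyn : Lyndon (x ∷ l)
      lyn = leastSuffix-Lyndon ls
      -- Strict, since equality would make `u` end with the Lyndon word, against the maximality of
      -- the exponent.
      l≺u : ∀ {u m} → a ∷ w ≡ u ++ power (x ∷ l) (suc m) → ¬ u EndsWith (x ∷ l) → (x ∷ l) ≺suffixes u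
      l≺u {m = m} eq ¬end t b s refl with ≼⇒≡⊎≺ (Lyndon-cancel {y = power (x ∷ l) m} lyn
          (least t b (s ++ power (x ∷ l) (suc m)) (trans eq (Listₚ.++-assoc t (b ∷ s) _))))
      ... | inj₁ refl = ⊥-elim (¬end (t , refl))
      ... | inj₂ l≺s  = l≺s
      l≺l : (x ∷ l) ≺suffixes l
      l≺l t b s refl = lyn x t b s refl
      go : ∀ u m → a ∷ w ≡ u ++ power (x ∷ l) (suc m) → ¬ u EndsWith (x ∷ l) → Unbordered (a ∷ w)
      go [] zero eq _ = subst Unbordered (sym (trans eq (Listₚ.++-identityʳ (x ∷ l)))) (Lyndon⇒Unbordered lyn)
      go [] (suc m) eq _ = ⊥-elim (ρw≢0 (subst (λ z → ρ z ≋ 0ℤ) (sym eq) (≋-trans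
        (≋-sym (∑-dividedPower-leading p x l (power-≺suffixes l≺l) (2 ℕ.+ m) (λ z z≺ → ρ-below z (subst (z ≺_) (sym eq) z≺))))
        (ρ-divided x l m (sym eq)))))
      go (b ∷ u) m eq ¬end = ⊥-elim (ρw≢0 (subst (λ z → ρ z ≋ 0ℤ) (sym eq) (≋-trans
        (≋-sym (∑-shuffles-canonical p (b ∷ u) (power (x ∷ l) (suc m)) (λ z nc →
          ρ-below z (subst (z ≺_) (sym eq) (noncanonical-≺ (power-≺suffixes (l≺u {b ∷ u} {m} eq ¬end) (suc m)) nc)))))
        (ρ-shuffle b u x (l ++ power (x ∷ l) m)))))

-- Primitive series and Lie polynomials

module _ {d : ℕ} where

  *S-∷ : ∀ (f g : Series d) a w → (f *S g) (a ∷ w) ≡ f [] * g (a ∷ w) + ((f ∘ (a ∷_)) *S g) w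
  *S-∷ f g a w = cong (λ s → f [] * g (a ∷ w) + s) (trans (∑-map (splits w) _ _) (∑-cong (splits w) λ { (_ , _) → refl }))

  *S-congˡ : ∀ {f f′ : Series d} (g : Series d) → (∀ z → f z ≡ f′ z) → ∀ w → (f *S g) w ≡ (f′ *S g) w
  *S-congˡ g eq w = ∑-cong (splits w) λ { (u , v) → cong (_* g v) (eq u) }

  *S-zeroˡ : ∀ {f : Series d} (g : Series d) → (∀ z → f z ≡ 0ℤ) → ∀ w → (f *S g) w ≡ 0ℤ
  *S-zeroˡ g eq w = ∑-zeros (splits w) λ { (u , v) → cong (_* g v) (eq u) }

  *S-+ˡ : ∀ (f f′ g : Series d) w → ((f +S f′) *S g) w ≡ (f *S g) w + (f′ *S g) w
  *S-+ˡ f f′ g w = trans (∑-cong (splits w) λ { (u , v) → ℤₚ.*-distribʳ-+ (g v) (f u) (f′ u) })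
    (trans (∑-+ (splits w) _ _) (cong₂ _+_ (∑-cong (splits w) λ { (_ , _) → refl }) (∑-cong (splits w) λ { (_ , _) → refl })))

  *S-·ˡ : ∀ c (f g : Series d) w → ((c ·S f) *S g) w ≡ c * (f *S g) w
  *S-·ˡ c f g w = trans (∑-cong (splits w) λ { (u , v) → ℤₚ.*-assoc c (f u) (g v) })
    (trans (∑-*ˡ (splits w) c (λ uv → f (proj₁ uv) * g (proj₂ uv))) (cong (c *_) (∑-cong (splits w) λ { (_ , _) → refl })))

  *S-constantˡ : ∀ (k g : Series d) → (∀ a z → k (a ∷ z) ≡ 0ℤ) → ∀ w → (k *S g) w ≡ k [] * g w
  *S-constantˡ k g eq []      = ℤₚ.+-identityʳ _
  *S-constantˡ k g eq (a ∷ w) = trans (*S-∷ k g a w)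
    (trans (cong (λ s → k [] * g (a ∷ w) + s) (*S-zeroˡ g (eq a) w)) (ℤₚ.+-identityʳ _))

  -- The coefficient of `u ⊗ v` in the image of `f` under the coproduct for which every `Xᵢ` is
  -- primitive, read off through its dual, the shuffle product.
  Δ : Series d → Word d → Series d
  Δ f u v = ∑ (shuffles u v) f

  -- Equalities in ℤ and not congruences: a multiplicity divisible by p has to be cancelled later.
  record Primitive (f : Series d) : Set where
    field
      constant-zero : f [] ≡ 0ℤ
      shuffle-zero  : ∀ a u b v → Δ f (a ∷ u) (b ∷ v) ≡ 0ℤ

  -- Multiplicativity of the coproduct, `Δ(f h) = Δ(f) (h ⊗ 1 + 1 ⊗ h)`. With the second factor
  -- primitive, the induction strips first letters off `f` and leaves `h` alone.
  Δ-*S : ∀ (f h : Series d) → Primitive h → ∀ u v →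
         Δ (f *S h) u v ≡ (Δ f u *S h) v + ((λ t → Δ f t v) *S h) u
  Δ-*S f h prim [] v = cong₂ _+_ (sym (*S-congˡ h (λ z → ℤₚ.+-identityʳ (f z)) v))
    (sym (trans (ℤₚ.+-identityʳ _) (trans (cong (Δ f [] v *_) (Primitive.constant-zero prim)) (ℤₚ.*-zeroʳ (Δ f [] v)))))
  Δ-*S f h prim (a ∷ u) [] = begin
    (f *S h) (a ∷ u) + 0ℤ ≡⟨ ℤₚ.+-comm ((f *S h) (a ∷ u)) 0ℤ ⟩
    0ℤ + (f *S h) (a ∷ u)
      ≡⟨ cong₂ _+_ (trans (ℤₚ.+-identityʳ _) (trans (cong (Δ f (a ∷ u) [] *_) (Primitive.constant-zero prim)) (ℤₚ.*-zeroʳ (Δ f (a ∷ u) []))))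
                   (*S-congˡ h (λ z → ∑-shuffles-[] z f) (a ∷ u)) ⟨
    (Δ f (a ∷ u) *S h) [] + ((λ t → Δ f t []) *S h) (a ∷ u) ∎
    where open ≡-Reasoning
  Δ-*S f h prim (a ∷ u) (b ∷ v) = begin
    Δ (f *S h) (a ∷ u) (b ∷ v)
      ≡⟨ ∑-shuffles-∷ a u b v (f *S h) ⟩
    ∑ L (λ z → (f *S h) (a ∷ z)) + ∑ R (λ z → (f *S h) (b ∷ z))
      ≡⟨ cong₂ _+_ (trans (∑-cong L (*S-∷ f h a)) (trans (∑-+ L _ _) (cong (_+ Δ (fa *S h) u (b ∷ v)) (∑-*ˡ L (f []) _))))
                   (trans (∑-cong R (*S-∷ f h b)) (trans (∑-+ R _ _) (cong (_+ Δ (fb *S h) (a ∷ u) v) (∑-*ˡ R (f []) _)))) ⟩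
    (f [] * ∑ L (λ z → h (a ∷ z)) + Δ (fa *S h) u (b ∷ v)) + (f [] * ∑ R (λ z → h (b ∷ z)) + Δ (fb *S h) (a ∷ u) v)
      -- The terms with the constant coefficient of `f` add up to `f []` times a proper shuffle sum
      -- of `h`, which is zero.
      ≡⟨ collect (f []) (∑ L (λ z → h (a ∷ z))) (∑ R (λ z → h (b ∷ z))) (Δ (fa *S h) u (b ∷ v)) (Δ (fb *S h) (a ∷ u) v)
           (trans (sym (∑-shuffles-∷ a u b v h)) (Primitive.shuffle-zero prim a u b v)) ⟩
    Δ (fa *S h) u (b ∷ v) + Δ (fb *S h) (a ∷ u) v
      ≡⟨ cong₂ _+_ (Δ-*S fa h prim u (b ∷ v)) (Δ-*S fb h prim (a ∷ u) v) ⟩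
    ((Δ fa u *S h) (b ∷ v) + ((λ t → Δ fa t (b ∷ v)) *S h) u) + ((Δ fb (a ∷ u) *S h) v + ((λ t → Δ fb t v) *S h) (a ∷ u))
      ≡⟨ cong₂ _+_ (cong (_+ ((λ t → Δ fa t (b ∷ v)) *S h) u) (*S-∷ (Δ fa u) h b v))
                   (cong (λ s → (Δ fb (a ∷ u) *S h) v + s) (*S-∷ (λ t → Δ fb t v) h a u)) ⟩
    ((Δ fa u [] * h (b ∷ v) + ((λ t → Δ fa u (b ∷ t)) *S h) v) + ((λ t → Δ fa t (b ∷ v)) *S h) u)
      + ((Δ fb (a ∷ u) *S h) v + (Δ fb [] v * h (a ∷ u) + ((λ t → Δ fb (a ∷ t) v) *S h) u))
      ≡⟨ regroup (Δ fa u [] * h (b ∷ v)) (((λ t → Δ fa u (b ∷ t)) *S h) v) (((λ t → Δ fa t (b ∷ v)) *S h) u)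
                 ((Δ fb (a ∷ u) *S h) v) (Δ fb [] v * h (a ∷ u)) (((λ t → Δ fb (a ∷ t) v) *S h) u) ⟩
    (Δ fa u [] * h (b ∷ v) + (((λ t → Δ fa u (b ∷ t)) *S h) v + (Δ fb (a ∷ u) *S h) v))
      + (Δ fb [] v * h (a ∷ u) + (((λ t → Δ fa t (b ∷ v)) *S h) u + ((λ t → Δ fb (a ∷ t) v) *S h) u))
      ≡⟨ cong₂ _+_
           (cong₂ _+_ (cong (_* h (b ∷ v)) (trans (∑-shuffles-[] u fa) (sym (ℤₚ.+-identityʳ _))))
                      (trans (sym (*S-+ˡ (λ t → Δ fa u (b ∷ t)) (Δ fb (a ∷ u)) h v)) (*S-congˡ h (λ t → sym (∑-shuffles-∷ a u b t f)) v)))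
           (cong (λ s → Δ fb [] v * h (a ∷ u) + s)
                      (trans (sym (*S-+ˡ (λ t → Δ fa t (b ∷ v)) (λ t → Δ fb (a ∷ t) v) h u)) (*S-congˡ h (λ t → sym (∑-shuffles-∷ a t b v f)) u))) ⟩
    (Δ f (a ∷ u) [] * h (b ∷ v) + ((λ t → Δ f (a ∷ u) (b ∷ t)) *S h) v)
      + (Δ f [] (b ∷ v) * h (a ∷ u) + ((λ t → Δ f (a ∷ t) (b ∷ v)) *S h) u)
      ≡⟨ cong₂ _+_ (*S-∷ (Δ f (a ∷ u)) h b v) (*S-∷ (λ t → Δ f t (b ∷ v)) h a u) ⟨
    (Δ f (a ∷ u) *S h) (b ∷ v) + ((λ t → Δ f t (b ∷ v)) *S h) (a ∷ u) ∎
    where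
    open ≡-Reasoning
    L R : List (Word d)
    L = shuffles u (b ∷ v)
    R = shuffles (a ∷ u) v
    fa fb : Series d
    fa = f ∘ (a ∷_)
    fb = f ∘ (b ∷_)
    collect : ∀ c s t x y → s + t ≡ 0ℤ → (c * s + x) + (c * t + y) ≡ x + y
    collect c s t x y s+t≡0 = trans (factor c s t x y) (trans (cong (λ q → c * q + (x + y)) s+t≡0)
      (trans (cong (_+ (x + y)) (ℤₚ.*-zeroʳ c)) (ℤₚ.+-identityˡ _)))
      where
      factor : ∀ c s t x y → (c * s + x) + (c * t + y) ≡ c * (s + t) + (x + y)
      factor = solve-∀
    regroup : ∀ x₁ x₂ x₃ x₄ x₅ x₆ → ((x₁ + x₂) + x₃) + (x₄ + (x₅ + x₆)) ≡ (x₁ + (x₂ + x₄)) + (x₅ + (x₃ + x₆))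
    regroup = solve-∀

  -- The cross terms `g ⊗ h + h ⊗ g` are symmetric in the two factors and hence cancel in a
  -- commutator.
  Δ-*S-primitive : ∀ {g h : Series d} → Primitive g → Primitive h → ∀ a u b v →
                   Δ (g *S h) (a ∷ u) (b ∷ v) ≡ g (a ∷ u) * h (b ∷ v) + g (b ∷ v) * h (a ∷ u)
  Δ-*S-primitive {g} {h} prim-g prim-h a u b v = begin
    Δ (g *S h) (a ∷ u) (b ∷ v)
      ≡⟨ Δ-*S g h prim-h (a ∷ u) (b ∷ v) ⟩
    (Δ g (a ∷ u) *S h) (b ∷ v) + ((λ t → Δ g t (b ∷ v)) *S h) (a ∷ u)
      ≡⟨ cong₂ _+_ (*S-∷ (Δ g (a ∷ u)) h b v) (*S-∷ (λ t → Δ g t (b ∷ v)) h a u) ⟩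
    (Δ g (a ∷ u) [] * h (b ∷ v) + ((λ t → Δ g (a ∷ u) (b ∷ t)) *S h) v)
      + (Δ g [] (b ∷ v) * h (a ∷ u) + ((λ t → Δ g (a ∷ t) (b ∷ v)) *S h) u)
      ≡⟨ cong₂ _+_ (cong₂ _+_ (cong (_* h (b ∷ v)) (ℤₚ.+-identityʳ (g (a ∷ u)))) (*S-zeroˡ h (Primitive.shuffle-zero prim-g a u b) v))
                   (cong₂ _+_ (cong (_* h (a ∷ u)) (ℤₚ.+-identityʳ (g (b ∷ v)))) (*S-zeroˡ h (λ t → Primitive.shuffle-zero prim-g a t b v) u)) ⟩
    (g (a ∷ u) * h (b ∷ v) + 0ℤ) + (g (b ∷ v) * h (a ∷ u) + 0ℤ)
      ≡⟨ cong₂ _+_ (ℤₚ.+-identityʳ (g (a ∷ u) * h (b ∷ v))) (ℤₚ.+-identityʳ (g (b ∷ v) * h (a ∷ u))) ⟩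
    g (a ∷ u) * h (b ∷ v) + g (b ∷ v) * h (a ∷ u) ∎
    where open ≡-Reasoning

  zeroS-primitive : Primitive zeroS
  zeroS-primitive = record { constant-zero = refl ; shuffle-zero = λ a u b v → ∑-zero (shuffles (a ∷ u) (b ∷ v)) }

  X-primitive : ∀ i → Primitive (X i)
  X-primitive i = record { constant-zero = refl ; shuffle-zero = λ a u b v →
    ∑-zero-All (All.map (long a u b v) (shuffles-sound (a ∷ u) (b ∷ v))) }
    where
    long : ∀ a u b v {z} → Shuffle (a ∷ u) (b ∷ v) z → X i z ≡ 0ℤ
    long a u b v (left (left _))   = refl
    long a u b v (left (right _))  = refl
    long a u b v (right (left _))  = refl
    long a u b v (right (right _)) = refl

  linear-primitive : ∀ a b {g h : Series d} → Primitive g → Primitive h → Primitive ((a ·S g) +S (b ·S h))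
  linear-primitive a b {g} {h} prim-g prim-h = record
    { constant-zero = zero-combination (Primitive.constant-zero prim-g) (Primitive.constant-zero prim-h)
    ; shuffle-zero  = λ x u y v → let L = shuffles (x ∷ u) (y ∷ v) in
        trans (∑-+ L _ _) (trans (cong₂ _+_ (∑-*ˡ L a g) (∑-*ˡ L b h))
        (zero-combination (Primitive.shuffle-zero prim-g x u y v) (Primitive.shuffle-zero prim-h x u y v))) }
    where
    zero-combination : ∀ {x y} → x ≡ 0ℤ → y ≡ 0ℤ → a * x + b * y ≡ 0ℤ
    zero-combination refl refl = cong₂ _+_ (ℤₚ.*-zeroʳ a) (ℤₚ.*-zeroʳ b)

  bracket-primitive : ∀ {g h : Series d} → Primitive g → Primitive h → Primitive ((g *S h) -S (h *S g))
  bracket-primitive {g} {h} prim-g prim-h = record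
    { constant-zero = constant (g []) (h [])
    ; shuffle-zero  = λ x u y v → let L = shuffles (x ∷ u) (y ∷ v) in
        trans (∑-+ L _ _) (trans (cong (λ s → ∑ L (g *S h) + s) (∑-neg L (h *S g)))
        (trans (cong₂ _-_ (Δ-*S-primitive prim-g prim-h x u y v) (Δ-*S-primitive prim-h prim-g x u y v))
               (commutes (g (x ∷ u)) (h (y ∷ v)) (g (y ∷ v)) (h (x ∷ u))))) }
    where
    constant : ∀ x y → (x * y + 0ℤ) - (y * x + 0ℤ) ≡ 0ℤ
    constant = solve-∀
    commutes : ∀ x y z t → (x * y + z * t) - (t * z + y * x) ≡ 0ℤ
    commutes = solve-∀

  module _ (p : ℕ) where
    open Congruence p

    *S-≋ : ∀ {f f′ g g′ : Series d} → (∀ w → f w ≋ f′ w) → (∀ w → g w ≋ g′ w) → ∀ w → (f *S g) w ≋ (f′ *S g′) w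
    *S-≋ f≋ g≋ w = ∑-≋ p (splits w) λ { (u , v) → *-≋ (f≋ u) (g≋ v) }

    -- `IsLie` allows a change of representative modulo p at every node. Rebuilding the same
    -- expression without these changes gives an integral series that is primitive on the nose.
    Lie⇒primitive : ∀ {f : Series d} → IsLie p f → ∃ λ g → Primitive g × (∀ w → f w ≋ g w)
    Lie⇒primitive (lie-zero f≈0)  = zeroS , zeroS-primitive , λ w → from-≡[] (f≈0 w)
    Lie⇒primitive (lie-gen i f≈X) = X i , X-primitive i , λ w → from-≡[] (f≈X w)
    Lie⇒primitive (lie-lin a b _ _ lie-g lie-h f≈) with Lie⇒primitive lie-g | Lie⇒primitive lie-h
    ... | g′ , prim-g , g≋ | h′ , prim-h , h≋ = _ , linear-primitive a b prim-g prim-h ,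
          λ w → ≋-trans (from-≡[] (f≈ w)) (+-≋ (*-≋ˡ a (g≋ w)) (*-≋ˡ b (h≋ w)))
    Lie⇒primitive (lie-br _ _ lie-g lie-h f≈) with Lie⇒primitive lie-g | Lie⇒primitive lie-h
    ... | g′ , prim-g , g≋ | h′ , prim-h , h≋ = _ , bracket-primitive prim-g prim-h ,
          λ w → ≋-trans (from-≡[] (f≈ w)) (-‿≋ (*S-≋ g≋ h≋ w) (*S-≋ h≋ g≋ w))

-- Grouplike series

𝟙 : ∀ {P : Set} → Dec P → ℤ
𝟙 P? = if ⌊ P? ⌋ then 1ℤ else 0ℤ

module _ {d : ℕ} where

  -- The infiltration product, dual to ΔXᵢ = Xᵢ ⊗ 1 + 1 ⊗ Xᵢ + Xᵢ ⊗ Xᵢ, for which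
  -- 1 + Xᵢ is grouplike.
  infiltration : Series d → Word d → Word d → ℤ
  infiltration f []      v       = f v
  infiltration f (a ∷ u) []      = f (a ∷ u)
  infiltration f (a ∷ u) (b ∷ v) =
    (infiltration (f ∘ (a ∷_)) u (b ∷ v) + infiltration (f ∘ (b ∷_)) (a ∷ u) v)
      + 𝟙 (a Finₚ.≟ b) * infiltration (f ∘ (a ∷_)) u v

  infiltration-linear : ∀ c (f g : Series d) u v →
    infiltration (λ z → f z + c * g z) u v ≡ infiltration f u v + c * infiltration g u v
  infiltration-linear c f g []      v       = refl
  infiltration-linear c f g (a ∷ u) []      = refl
  infiltration-linear c f g (a ∷ u) (b ∷ v)
    rewrite infiltration-linear c (f ∘ (a ∷_)) (g ∘ (a ∷_)) u (b ∷ v)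
          | infiltration-linear c (f ∘ (b ∷_)) (g ∘ (b ∷_)) (a ∷ u) v
          | infiltration-linear c (f ∘ (a ∷_)) (g ∘ (a ∷_)) u v
    = regroup c (𝟙 (a Finₚ.≟ b))
        (infiltration (f ∘ (a ∷_)) u (b ∷ v)) (infiltration (g ∘ (a ∷_)) u (b ∷ v))
        (infiltration (f ∘ (b ∷_)) (a ∷ u) v) (infiltration (g ∘ (b ∷_)) (a ∷ u) v)
        (infiltration (f ∘ (a ∷_)) u v) (infiltration (g ∘ (a ∷_)) u v)
    where
    regroup : ∀ c e x x′ y y′ z z′ → ((x + c * x′) + (y + c * y′)) + e * (z + c * z′)
                                   ≡ ((x + y) + e * z) + c * ((x′ + y′) + e * z′)
    regroup = solve-∀

  infiltration-cong : ∀ {f g : Series d} → (∀ z → f z ≡ g z) → ∀ u v → infiltration f u v ≡ infiltration g u v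
  infiltration-cong eq []      v       = eq v
  infiltration-cong eq (a ∷ u) []      = eq (a ∷ u)
  infiltration-cong eq (a ∷ u) (b ∷ v) = cong₂ _+_
    (cong₂ _+_ (infiltration-cong (eq ∘ (a ∷_)) u (b ∷ v)) (infiltration-cong (eq ∘ (b ∷_)) (a ∷ u) v))
    (cong (𝟙 (a Finₚ.≟ b) *_) (infiltration-cong (eq ∘ (a ∷_)) u v))

  Grouplike : Series d → Set
  Grouplike f = f [] ≡ 1ℤ × ∀ u v → f u * f v ≡ infiltration f u v

  -- g = (1 + Xᵢ) f, coefficientwise.
  record IsGenMultiple (i : Fin d) (f g : Series d) : Set where
    field
      at-[] : g [] ≡ f []
      at-∷  : ∀ a w → g (a ∷ w) ≡ f (a ∷ w) + 𝟙 (i Finₚ.≟ a) * f w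

  module _ {i : Fin d} {f g : Series d} (f→g : IsGenMultiple i f g) where
    open IsGenMultiple f→g

    private
      ε : Fin d → ℤ
      ε a = 𝟙 (i Finₚ.≟ a)

      -- Both sides test `i = a = b`. This is how the diagonal term of the infiltration product
      -- accounts for `Xᵢ ⊗ Xᵢ`.
      ε-idem : ∀ a b → 𝟙 (a Finₚ.≟ b) * ε a ≡ ε a * ε b
      ε-idem a b with a Finₚ.≟ b | i Finₚ.≟ a | i Finₚ.≟ b
      ... | yes refl | yes _    | yes _    = refl
      ... | yes refl | no _     | no _     = refl
      ... | yes refl | yes p    | no ¬p    = contradiction p ¬p
      ... | yes refl | no ¬p    | yes p    = contradiction p ¬p
      ... | no a≢b   | yes refl | yes refl = contradiction refl a≢b
      ... | no _     | yes _    | no _     = refl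
      ... | no _     | no _     | yes _    = refl
      ... | no _     | no _     | no _     = refl

    -- The effect of multiplying by `(1 + Xᵢ) ⊗ (1 + Xᵢ)`. The correction terms have the same shape
    -- as in `product-genMultiple`, so grouplikeness can be transferred in either direction.
    infiltration-genMultiple : ∀ a u b v → infiltration g (a ∷ u) (b ∷ v) ≡
      infiltration f (a ∷ u) (b ∷ v) + ((ε a * infiltration f u (b ∷ v) + ε b * infiltration f (a ∷ u) v)
        + ε a * ε b * infiltration f u v)
    infiltration-genMultiple a u b v = begin
      (infiltration (g ∘ (a ∷_)) u (b ∷ v) + infiltration (g ∘ (b ∷_)) (a ∷ u) v) + e * infiltration (g ∘ (a ∷_)) u v
        ≡⟨ cong₂ _+_ (cong₂ _+_ (shift a u (b ∷ v)) (shift b (a ∷ u) v)) (cong (e *_) (shift a u v)) ⟩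
      ((x + ε a * x′) + (y + ε b * y′)) + e * (z + ε a * z′)
        ≡⟨ regroup e (ε a) (ε b) x x′ y y′ z z′ ⟩
      ((x + y) + e * z) + ((ε a * x′ + ε b * y′) + e * ε a * z′)
        ≡⟨ cong (λ s → ((x + y) + e * z) + ((ε a * x′ + ε b * y′) + s * z′)) (ε-idem a b) ⟩
      ((x + y) + e * z) + ((ε a * x′ + ε b * y′) + ε a * ε b * z′) ∎
      where
      open ≡-Reasoning
      e x x′ y y′ z z′ : ℤ
      e  = 𝟙 (a Finₚ.≟ b)
      x  = infiltration (f ∘ (a ∷_)) u (b ∷ v)
      x′ = infiltration f u (b ∷ v)
      y  = infiltration (f ∘ (b ∷_)) (a ∷ u) v
      y′ = infiltration f (a ∷ u) v
      z  = infiltration (f ∘ (a ∷_)) u v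
      z′ = infiltration f u v
      shift : ∀ a u v → infiltration (g ∘ (a ∷_)) u v ≡ infiltration (f ∘ (a ∷_)) u v + ε a * infiltration f u v
      shift a u v = trans (infiltration-cong (at-∷ a) u v) (infiltration-linear (ε a) (f ∘ (a ∷_)) f u v)
      regroup : ∀ e a b x x′ y y′ z z′ → ((x + a * x′) + (y + b * y′)) + e * (z + a * z′)
                                       ≡ ((x + y) + e * z) + ((a * x′ + b * y′) + e * a * z′)
      regroup = solve-∀

    product-genMultiple : ∀ a u b v → g (a ∷ u) * g (b ∷ v) ≡
      f (a ∷ u) * f (b ∷ v) + ((ε a * (f u * f (b ∷ v)) + ε b * (f (a ∷ u) * f v)) + ε a * ε b * (f u * f v))
    product-genMultiple a u b v rewrite at-∷ a u | at-∷ b v = expand (ε a) (ε b) (f (a ∷ u)) (f u) (f (b ∷ v)) (f v)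
      where
      expand : ∀ a b x x′ y y′ → (x + a * x′) * (y + b * y′) ≡ x * y + ((a * (x′ * y) + b * (x * y′)) + a * b * (x′ * y′))
      expand = solve-∀

    genMultiple-Grouplike : Grouplike f → Grouplike g
    genMultiple-Grouplike (f[]≡1 , mult) = trans at-[] f[]≡1 , mult′
      where
      mult′ : ∀ u v → g u * g v ≡ infiltration g u v
      mult′ []      v       = trans (cong (_* g v) (trans at-[] f[]≡1)) (ℤₚ.*-identityˡ (g v))
      mult′ (a ∷ u) []      = trans (cong (g (a ∷ u) *_) (trans at-[] f[]≡1)) (ℤₚ.*-identityʳ (g (a ∷ u)))
      mult′ (a ∷ u) (b ∷ v) = trans (product-genMultiple a u b v) (trans
        (cong₂ _+_ (mult (a ∷ u) (b ∷ v)) (cong₂ _+_ (cong₂ _+_ (cong (ε a *_) (mult u (b ∷ v))) (cong (ε b *_) (mult (a ∷ u) v)))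
                                                     (cong (ε a * ε b *_) (mult u v))))
        (sym (infiltration-genMultiple a u b v)))

    -- Handles inverse generators without expanding the geometric series: the correction terms
    -- involve shorter words only, so induction subtracts them.
    genMultiple-Grouplike⁻ : Grouplike g → Grouplike f
    genMultiple-Grouplike⁻ (g[]≡1 , mult) = f[]≡1 , mult′
      where
      f[]≡1 : f [] ≡ 1ℤ
      f[]≡1 = trans (sym at-[]) g[]≡1
      +-cancelʳ : ∀ {x y} z → x + z ≡ y + z → x ≡ y
      +-cancelʳ {x} {y} z eq = trans (lemma x z) (trans (cong (_- z) eq) (sym (lemma y z)))
        where
        lemma : ∀ x z → x ≡ (x + z) - z
        lemma = solve-∀
      mult′ : ∀ u v → f u * f v ≡ infiltration f u v
      mult′ []      v       = trans (cong (_* f v) f[]≡1) (ℤₚ.*-identityˡ (f v))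
      mult′ (a ∷ u) []      = trans (cong (f (a ∷ u) *_) f[]≡1) (ℤₚ.*-identityʳ (f (a ∷ u)))
      mult′ (a ∷ u) (b ∷ v) = +-cancelʳ _ (trans (cong (λ s → f (a ∷ u) * f (b ∷ v) + s) (sym
        (cong₂ _+_ (cong₂ _+_ (cong (ε a *_) (mult′ u (b ∷ v))) (cong (ε b *_) (mult′ (a ∷ u) v)))
                   (cong (ε a * ε b *_) (mult′ u v)))))
        (trans (sym (product-genMultiple a u b v)) (trans (mult (a ∷ u) (b ∷ v)) (infiltration-genMultiple a u b v))))

  gen-genMultiple : ∀ i (f : Series d) → IsGenMultiple i f (gen i *S f)
  gen-genMultiple i f = record { at-[] = trans (ℤₚ.+-identityʳ _) (ℤₚ.*-identityˡ (f [])) ; at-∷ = at-∷ }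
    where
    at-∷ : ∀ a w → (gen i *S f) (a ∷ w) ≡ f (a ∷ w) + 𝟙 (i Finₚ.≟ a) * f w
    at-∷ a w = trans (*S-∷ (gen i) f a w) (cong₂ _+_ (ℤₚ.*-identityˡ (f (a ∷ w)))
      (trans (*S-constantˡ (gen i ∘ (a ∷_)) f (λ _ _ → refl) w) (cong (_* f w) (ℤₚ.+-identityˡ (𝟙 (i Finₚ.≟ a))))))

  genInv-genMultiple : ∀ i (f : Series d) → IsGenMultiple i (genInv i *S f) f
  genInv-genMultiple i f = record
    { at-[] = sym (trans (ℤₚ.+-identityʳ _) (ℤₚ.*-identityˡ (f []))) ; at-∷ = λ a w → sym (at-∷ a w) }
    where
    derivative : ∀ a z → genInv i (a ∷ z) ≡ - 𝟙 (i Finₚ.≟ a) * genInv i z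
    derivative a z with i Finₚ.≟ a | allEq i z
    ... | yes _ | true  = refl
    ... | yes _ | false = refl
    ... | no _  | true  = refl
    ... | no _  | false = refl
    at-∷ : ∀ a w → (genInv i *S f) (a ∷ w) + 𝟙 (i Finₚ.≟ a) * (genInv i *S f) w ≡ f (a ∷ w)
    at-∷ a w = trans (cong (_+ ε * h) (trans (*S-∷ (genInv i) f a w) (cong₂ _+_ (ℤₚ.*-identityˡ (f (a ∷ w)))
        (trans (*S-congˡ f (derivative a) w) (*S-·ˡ (- ε) (genInv i) f w)))))
      (cancel (f (a ∷ w)) ε h)
      where
      ε h : ℤ
      ε = 𝟙 (i Finₚ.≟ a)
      h = (genInv i *S f) w
      cancel : ∀ x e h → (x + - e * h) + e * h ≡ x
      cancel = solve-∀

  oneS-Grouplike : Grouplike oneS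
  oneS-Grouplike = refl , mult
    where
    zero-infiltration : ∀ (f : Series d) → (∀ z → f z ≡ 0ℤ) → ∀ u v → infiltration f u v ≡ 0ℤ
    zero-infiltration f eq []      v  = eq v
    zero-infiltration f eq (a ∷ u) [] = eq (a ∷ u)
    zero-infiltration f eq (a ∷ u) (b ∷ v) = cong₂ _+_
      (cong₂ _+_ (zero-infiltration _ (eq ∘ (a ∷_)) u (b ∷ v)) (zero-infiltration _ (eq ∘ (b ∷_)) (a ∷ u) v))
      (trans (cong (𝟙 (a Finₚ.≟ b) *_) (zero-infiltration _ (eq ∘ (a ∷_)) u v)) (ℤₚ.*-zeroʳ (𝟙 (a Finₚ.≟ b))))
    mult : ∀ (u v : Word d) → oneS u * oneS v ≡ infiltration oneS u v
    mult []      v       = ℤₚ.*-identityˡ (oneS v)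
    mult (a ∷ u) []      = refl
    mult (a ∷ u) (b ∷ v) = sym (cong₂ _+_
      (cong₂ _+_ (zero-infiltration _ (λ _ → refl) u (b ∷ v)) (zero-infiltration _ (λ _ → refl) (a ∷ u) v))
      (trans (cong (𝟙 (a Finₚ.≟ b) *_) (zero-infiltration _ (λ _ → refl) u v)) (ℤₚ.*-zeroʳ (𝟙 (a Finₚ.≟ b)))))

  evalWord-Grouplike : ∀ (ω : List (Fin d × Bool)) → Grouplike (evalWord ω)
  evalWord-Grouplike []                = oneS-Grouplike
  evalWord-Grouplike ((i , true)  ∷ ω) = genMultiple-Grouplike (gen-genMultiple i (evalWord ω)) (evalWord-Grouplike ω)
  evalWord-Grouplike ((i , false) ∷ ω) = genMultiple-Grouplike⁻ (genInv-genMultiple i (evalWord ω)) (evalWord-Grouplike ω)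

  private
    ℕ-+-leftComm : ∀ a b c → a ℕ.+ (b ℕ.+ c) ≡ b ℕ.+ (a ℕ.+ c)
    ℕ-+-leftComm a b c = trans (sym (ℕₚ.+-assoc a b c)) (trans (cong (ℕ._+ c) (ℕₚ.+-comm a b)) (ℕₚ.+-assoc b a c))

  weight-shuffle : ∀ (τ : Fin d → ℕ) {u v z} → Shuffle u v z → weight τ z ≡ weight τ u ℕ.+ weight τ v
  weight-shuffle τ done = refl
  weight-shuffle τ {a ∷ u} {v} (left sh) = trans (cong (τ a ℕ.+_) (weight-shuffle τ sh)) (sym (ℕₚ.+-assoc (τ a) (weight τ u) (weight τ v)))
  weight-shuffle τ {u} {b ∷ v} (right sh) = trans (cong (τ b ℕ.+_) (weight-shuffle τ sh)) (ℕ-+-leftComm (τ b) (weight τ u) (weight τ v))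

  weight-1≡length : ∀ (w : Word d) → weight (λ _ → 1) w ≡ length w
  weight-1≡length []      = refl
  weight-1≡length (_ ∷ w) = cong suc (weight-1≡length w)

  module _ (p : ℕ) (τ : Fin d → ℕ) where
    open Congruence p

    private
      ≤-left : ∀ {a u v} z → weight τ z ≤ weight τ u ℕ.+ weight τ v → weight τ (a ∷ z) ≤ weight τ (a ∷ u) ℕ.+ weight τ v
      ≤-left {a} {u} {v} z z≤ = subst (weight τ (a ∷ z) ≤_) (sym (ℕₚ.+-assoc (τ a) (weight τ u) (weight τ v))) (ℕₚ.+-monoʳ-≤ (τ a) z≤)

      ≤-right : ∀ {b u v} z → weight τ z ≤ weight τ u ℕ.+ weight τ v → weight τ (b ∷ z) ≤ weight τ u ℕ.+ weight τ (b ∷ v)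
      ≤-right {b} {u} {v} z z≤ = subst (weight τ (b ∷ z) ≤_) (ℕ-+-leftComm (τ b) (weight τ u) (weight τ v)) (ℕₚ.+-monoʳ-≤ (τ b) z≤)

      <-left : ∀ {a u v} z → weight τ z < weight τ u ℕ.+ weight τ v → weight τ (a ∷ z) < weight τ (a ∷ u) ℕ.+ weight τ v
      <-left {a} {u} {v} z z< = subst (weight τ (a ∷ z) <_) (sym (ℕₚ.+-assoc (τ a) (weight τ u) (weight τ v))) (ℕₚ.+-monoʳ-< (τ a) z<)

      <-right : ∀ {b u v} z → weight τ z < weight τ u ℕ.+ weight τ v → weight τ (b ∷ z) < weight τ u ℕ.+ weight τ (b ∷ v)
      <-right {b} {u} {v} z z< = subst (weight τ (b ∷ z) <_) (ℕ-+-leftComm (τ b) (weight τ u) (weight τ v)) (ℕₚ.+-monoʳ-< (τ b) z<)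

    infiltration-≋ : ∀ (f g : Series d) u v → (∀ z → weight τ z ≤ weight τ u ℕ.+ weight τ v → f z ≋ g z) →
                     infiltration f u v ≋ infiltration g u v
    infiltration-≋ f g []      v       eq = eq v ℕₚ.≤-refl
    infiltration-≋ f g (a ∷ u) []      eq = eq (a ∷ u) (ℕₚ.m≤m+n _ 0)
    infiltration-≋ f g (a ∷ u) (b ∷ v) eq = +-≋
      (+-≋ (infiltration-≋ _ _ u (b ∷ v) λ z z≤ → eq (a ∷ z) (≤-left {a} {u} {b ∷ v} z z≤))
           (infiltration-≋ _ _ (a ∷ u) v λ z z≤ → eq (b ∷ z) (≤-right {b} {a ∷ u} {v} z z≤)))
      (*-≋ˡ (𝟙 (a Finₚ.≟ b)) (infiltration-≋ _ _ u v λ z z≤ → eq (a ∷ z) (≤-left {a} {u} {b ∷ v} z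
        (ℕₚ.≤-trans z≤ (ℕₚ.+-monoʳ-≤ (weight τ u) (ℕₚ.m≤n+m (weight τ v) (τ b)))))))

    infiltration-≋0 : ∀ (f : Series d) u v → (∀ z → weight τ z ≤ weight τ u ℕ.+ weight τ v → f z ≋ 0ℤ) →
                      infiltration f u v ≋ 0ℤ
    infiltration-≋0 f u v eq = ≋-trans (infiltration-≋ f zeroS u v eq) (≋-reflexive (zero-infiltration u v))
      where
      zero-infiltration : ∀ u v → infiltration zeroS u v ≡ 0ℤ
      zero-infiltration []      v       = refl
      zero-infiltration (a ∷ u) []      = refl
      zero-infiltration (a ∷ u) (b ∷ v) = cong₂ _+_ (cong₂ _+_ (zero-infiltration u (b ∷ v)) (zero-infiltration (a ∷ u) v))
        (trans (cong (𝟙 (a Finₚ.≟ b) *_) (zero-infiltration u v)) (ℤₚ.*-zeroʳ (𝟙 (a Finₚ.≟ b))))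

    module _ (τ-pos : ∀ i → 0 < τ i) where

      -- The diagonal term merges two letters into one, so the words it reaches fall short of the
      -- total weight by at least `τ b`, which is positive.
      infiltration-tail-≋0 : ∀ (f : Series d) a u b v →
        (∀ z → weight τ (a ∷ z) < weight τ (a ∷ u) ℕ.+ weight τ (b ∷ v) → f (a ∷ z) ≋ 0ℤ) →
        infiltration (f ∘ (a ∷_)) u v ≋ 0ℤ
      infiltration-tail-≋0 f a u b v f≋0 = infiltration-≋0 (f ∘ (a ∷_)) u v λ z z≤ → f≋0 z
        (subst (weight τ (a ∷ z) <_) (sym (ℕₚ.+-assoc (τ a) (weight τ u) (weight τ (b ∷ v))))
          (ℕₚ.+-monoʳ-< (τ a) (ℕₚ.≤-<-trans z≤ (ℕₚ.+-monoʳ-< (weight τ u) (ℕₚ.m<n+m (weight τ v) (τ-pos b))))))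

      -- The vanishing condition is imposed on nonempty words, because a grouplike series has
      -- constant term 1.
      infiltration-≋-shuffles : ∀ (f : Series d) u v →
        (∀ c z → weight τ (c ∷ z) < weight τ u ℕ.+ weight τ v → f (c ∷ z) ≋ 0ℤ) →
        infiltration f u v ≋ ∑ (shuffles u v) f
      infiltration-≋-shuffles f []      v       f≋0 = ≋-reflexive (sym (ℤₚ.+-identityʳ _))
      infiltration-≋-shuffles f (a ∷ u) []      f≋0 = ≋-reflexive (sym (ℤₚ.+-identityʳ _))
      infiltration-≋-shuffles f (a ∷ u) (b ∷ v) f≋0 =
        ≋-trans (+-≋ (+-≋ (infiltration-≋-shuffles (f ∘ (a ∷_)) u (b ∷ v) (λ c z z< → f≋0 a (c ∷ z) (<-left {a} {u} {b ∷ v} (c ∷ z) z<)))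
                          (infiltration-≋-shuffles (f ∘ (b ∷_)) (a ∷ u) v (λ c z z< → f≋0 b (c ∷ z) (<-right {b} {a ∷ u} {v} (c ∷ z) z<))))
                     (*-zero-≋ (𝟙 (a Finₚ.≟ b)) (infiltration-tail-≋0 f a u b v (f≋0 a))))
        (≋-trans (≋-reflexive (ℤₚ.+-identityʳ _)) (≋-reflexive (sym (∑-shuffles-∷ a u b v f))))

  module _ (p : ℕ) (τ : Fin d → ℕ) (τ-pos : ∀ i → 0 < τ i) where
    open Congruence p

    -- In total weight `n`, the product `r (a ∷ u) * r (b ∷ v)` vanishes, since its first factor has
    -- weight below `n`. By grouplikeness it also equals the infiltration, which in this weight is
    -- the shuffle sum of the initial form.
    InF⇒shuffle-≋0 : ∀ {r : Series d} n → InF p r → InFτ p τ n r → ∀ a u b v →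
                     ∑ (shuffles (a ∷ u) (b ∷ v)) (initForm τ n r) ≋ 0ℤ
    InF⇒shuffle-≋0 {r} n r∈F r∈Fn a u b v with (weight τ (a ∷ u) ℕ.+ weight τ (b ∷ v)) ℕₚ.≟ n
    ... | no  wt≢n = ≋-reflexive (∑-zero-All (All.map off-weight (shuffles-sound (a ∷ u) (b ∷ v))))
      where
      off-weight : ∀ {z} → Shuffle (a ∷ u) (b ∷ v) z → initForm τ n r z ≡ 0ℤ
      off-weight {z} sh with weight τ z ≡ᵇ n in eq
      ... | false = refl
      ... | true  = contradiction (trans (sym (weight-shuffle τ sh)) (ℕₚ.≡ᵇ⇒≡ (weight τ z) n (subst T (sym eq) _))) wt≢n
    ... | yes refl = ≋-trans (≋-reflexive (∑-cong-All (All.map on-weight (shuffles-sound (a ∷ u) (b ∷ v)))))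
        (≋-trans (≋-sym (infiltration-≋-shuffles p τ τ-pos r (a ∷ u) (b ∷ v) below))
        (≋-trans (≋-sym multiplicative)
          (*-≋ʳ (r (b ∷ v)) (below a u (ℕₚ.m<m+n _ (ℕₚ.<-≤-trans (τ-pos b) (ℕₚ.m≤m+n _ _)))))))
      where
      on-weight : ∀ {z} → Shuffle (a ∷ u) (b ∷ v) z → initForm τ n r z ≡ r z
      on-weight {[]} ()
      on-weight {c ∷ z} sh with weight τ (c ∷ z) ≡ᵇ n in eq
      ... | true  = ℤₚ.+-identityʳ _
      ... | false = contradiction (ℕₚ.≡⇒≡ᵇ (weight τ (c ∷ z)) n (weight-shuffle τ sh)) (subst (¬_ ∘ T) (sym eq) (λ ()))
      below : ∀ c z → weight τ (c ∷ z) < n → r (c ∷ z) ≋ 0ℤ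
      below c z z<n = ≋-trans (≋-reflexive (sym (ℤₚ.+-identityʳ _))) (from-≡[] (r∈Fn (c ∷ z) z<n))
      -- The infiltration involves words as long as both arguments together, and `InF` controls
      -- lengths strictly below its bound.
      N : ℕ
      N = suc (length (a ∷ u) ℕ.+ length (b ∷ v))
      ω : List (Fin d × Bool)
      ω = proj₁ (r∈F N)
      approx : ∀ z → length z < N → r z ≋ evalWord ω z
      approx z z<N = from-≡[] (proj₂ (r∈F N) z z<N)
      multiplicative : r (a ∷ u) * r (b ∷ v) ≋ infiltration r (a ∷ u) (b ∷ v)
      multiplicative =
        ≋-trans (*-≋ (approx (a ∷ u) (s≤s (ℕₚ.m≤m+n _ _))) (approx (b ∷ v) (s≤s (ℕₚ.m≤n+m _ (length (a ∷ u))))))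
        (≋-trans (≋-reflexive (proj₂ (evalWord-Grouplike ω) (a ∷ u) (b ∷ v)))
          (≋-sym (length-infiltration-≋ (λ z z≤ → approx z (s≤s z≤)))))
        where
        -- The group word approximates `r` by length and not by `τ`, hence the constant weight 1.
        length-infiltration-≋ : (∀ z → length z ≤ length (a ∷ u) ℕ.+ length (b ∷ v) → r z ≋ evalWord ω z) →
          infiltration r (a ∷ u) (b ∷ v) ≋ infiltration (evalWord ω) (a ∷ u) (b ∷ v)
        length-infiltration-≋ eq = infiltration-≋ p (λ _ → 1) r (evalWord ω) (a ∷ u) (b ∷ v) λ z z≤ → eq z
          (subst₂ _≤_ (weight-1≡length z) (cong₂ ℕ._+_ (weight-1≡length (a ∷ u)) (weight-1≡length (b ∷ v))) z≤)

-- Sums over words and ideals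

∑-𝟙 : ∀ {A : Set} (_≟_ : (x y : A) → Dec (x ≡ y)) {L : List A} {x : A} (g : A → ℤ) → Unique L → x ∈ L →
      ∑ L (λ y → 𝟙 (x ≟ y) * g y) ≡ g x
∑-𝟙 _≟_ {y ∷ L} {x} g (y≢L AllPairs.∷ unique) (here refl) = trans (cong₂ _+_ at-x rest) (ℤₚ.+-identityʳ (g x))
  where
  at-x : 𝟙 (x ≟ x) * g x ≡ g x
  at-x with x ≟ x
  ... | yes _  = ℤₚ.*-identityˡ (g x)
  ... | no x≢x = contradiction refl x≢x
  off-x : ∀ {z} → x ≢ z → 𝟙 (x ≟ z) * g z ≡ 0ℤ
  off-x {z} x≢z with x ≟ z
  ... | yes x≡z = contradiction x≡z x≢z
  ... | no _    = refl
  rest : ∑ L (λ y → 𝟙 (x ≟ y) * g y) ≡ 0ℤ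
  rest = ∑-zero-All (All.map off-x y≢L)
∑-𝟙 _≟_ {y ∷ L} {x} g (y≢L AllPairs.∷ unique) (there x∈L) with x ≟ y
... | yes refl = contradiction refl (All.lookup y≢L x∈L)
... | no _     = trans (ℤₚ.+-identityˡ _) (∑-𝟙 _≟_ g unique x∈L)

∑-𝟙-Fin : ∀ {k} (j : Fin k) g → ∑ (allFin k) (λ i → 𝟙 (j Finₚ.≟ i) * g i) ≡ g j
∑-𝟙-Fin {k} j g = ∑-𝟙 Finₚ._≟_ g (Uniqueₚ.allFin⁺ k) (∈ₚ.∈-allFin j)

𝟙-sym : ∀ {A : Set} (_≟_ : (x y : A) → Dec (x ≡ y)) x y → 𝟙 (x ≟ y) ≡ 𝟙 (y ≟ x)
𝟙-sym _≟_ x y with x ≟ y | y ≟ x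
... | yes _    | yes _    = refl
... | no _     | no _     = refl
... | yes refl | no y≢x   = contradiction refl y≢x
... | no x≢y   | yes refl = contradiction refl x≢y

length-filter≡∑ : ∀ {A : Set} {P : A → Set} (P? : ∀ x → Dec (P x)) L → + length (filter P? L) ≡ ∑ L (λ x → 𝟙 (P? x))
length-filter≡∑ P? [] = refl
length-filter≡∑ P? (x ∷ L) with P? x
... | yes _ = cong (λ s → 1ℤ + s) (length-filter≡∑ P? L)
... | no _  = trans (length-filter≡∑ P? L) (sym (ℤₚ.+-identityˡ _))

module _ {d : ℕ} where

  _≟ʷ_ : (u v : Word d) → Dec (u ≡ v)
  _≟ʷ_ = Listₚ.≡-dec Finₚ._≟_

  -- Finite stand-in for all words: with positive letter weights a word of weight `K` has length at
  -- most `K`, so sums over a weight can run over this list.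
  words : ℕ → List (Word d)
  words zero    = [] ∷ []
  words (suc K) = [] ∷ concatMap (λ i → map (i ∷_) (words K)) (allFin d)

  ∑-words-suc : ∀ K F → ∑ (words (suc K)) F ≡ F [] + ∑ (allFin d) (λ i → ∑ (words K) (F ∘ (i ∷_)))
  ∑-words-suc K F = cong (λ s → F [] + s) (trans (∑-concatMap (allFin d) (λ i → map (i ∷_) (words K)) F)
    (∑-cong (allFin d) (λ i → ∑-map (words K) (i ∷_) F)))

  ∈-words : ∀ {K} z → length z ≤ K → z ∈ words K
  ∈-words {zero}  []      _ = here refl
  ∈-words {suc K} []      _ = here refl
  ∈-words {suc K} (i ∷ z) (s≤s z≤K) = there (∈ₚ.∈-concatMap⁺ (λ i → map (i ∷_) (words K))
    (Any.map (λ { refl → ∈ₚ.∈-map⁺ (i ∷_) (∈-words z z≤K) }) (∈ₚ.∈-allFin i)))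

  words-Unique : ∀ K → Unique (words K)
  words-Unique zero    = [] AllPairs.∷ AllPairs.[]
  words-Unique (suc K) = Allₚ.concat⁺ (Allₚ.map⁺ (All.universal (λ i → Allₚ.map⁺ (All.universal (λ _ ()) (words K))) (allFin d)))
    AllPairs.∷ Uniqueₚ.concat⁺ (Allₚ.map⁺ (All.universal (λ i → Uniqueₚ.map⁺ Listₚ.∷-injectiveʳ (words-Unique K)) (allFin d)))
      (AllPairsₚ.map⁺ (AllPairs.map disjoint (Uniqueₚ.allFin⁺ d)))
    where
    disjoint : ∀ {i j} → i ≢ j → Disjoint (map (i ∷_) (words K)) (map (j ∷_) (words K))
    disjoint i≢j (z∈i , z∈j) with ∈ₚ.∈-map⁻ (_ ∷_) z∈i | ∈ₚ.∈-map⁻ (_ ∷_) z∈j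
    ... | _ , _ , refl | _ , _ , eq = i≢j (Listₚ.∷-injectiveˡ eq)

  ∑-words-extend : ∀ {K M F} → K ≤ M → (∀ z → K < length z → F z ≡ 0ℤ) → ∑ (words M) F ≡ ∑ (words K) F
  ∑-words-extend {zero}  {zero}  z≤n F≡0 = refl
  ∑-words-extend {zero}  {suc M} {F} z≤n F≡0 = trans (∑-words-suc M F) (cong (λ s → F [] + s)
    (∑-zeros (allFin d) (λ i → ∑-zeros (words M) (λ z → F≡0 (i ∷ z) (s≤s z≤n)))))
  ∑-words-extend {suc K} {suc M} {F} (s≤s K≤M) F≡0 = trans (∑-words-suc M F) (trans
    (cong (λ s → F [] + s) (∑-cong (allFin d) (λ i → ∑-words-extend K≤M (λ z K<z → F≡0 (i ∷ z) (s≤s K<z)))))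
    (sym (∑-words-suc K F)))

  δ : Word d → Series d
  δ u v = 𝟙 (u ≟ʷ v)

  δ-≢ : ∀ {u v} → u ≢ v → δ u v ≡ 0ℤ
  δ-≢ {u} {v} u≢v with u ≟ʷ v
  ... | yes u≡v = contradiction u≡v u≢v
  ... | no _    = refl

  δ-∷ : ∀ i u j v → δ (i ∷ u) (j ∷ v) ≡ 𝟙 (i Finₚ.≟ j) * δ u v
  δ-∷ i u j v with (i ∷ u) ≟ʷ (j ∷ v) | i Finₚ.≟ j | u ≟ʷ v
  ... | yes refl | yes _    | yes _    = refl
  ... | no  neq  | yes refl | yes refl = contradiction refl neq
  ... | no  _    | yes _    | no _     = refl
  ... | no  _    | no _     | yes _    = refl
  ... | no  _    | no _     | no _     = refl
  ... | yes refl | no i≢i   | _        = contradiction refl i≢i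
  ... | yes refl | yes _    | no u≢u   = contradiction refl u≢u

  ∑-words-δ : ∀ {K} u g → length u ≤ K → ∑ (words K) (λ z → δ u z * g z) ≡ g u
  ∑-words-δ {K} u g u≤K = ∑-𝟙 _≟ʷ_ g (words-Unique K) (∈-words u u≤K)

  δ-*S-∷ : ∀ i u (f : Series d) j z → (δ (i ∷ u) *S f) (j ∷ z) ≡ 𝟙 (i Finₚ.≟ j) * (δ u *S f) z
  δ-*S-∷ i u f j z = trans (*S-∷ (δ (i ∷ u)) f j z) (trans (ℤₚ.+-identityˡ (((δ (i ∷ u) ∘ (j ∷_)) *S f) z))
    (trans (*S-congˡ f (δ-∷ i u j) z) (*S-·ˡ (𝟙 (i Finₚ.≟ j)) (δ u) f z)))

  *S-δ : ∀ K (f : Series d) → (∀ z → K < length z → f z ≡ 0ℤ) → ∀ b z →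
         (f *S δ b) z ≡ ∑ (words K) (λ t → f t * δ (t ++ b) z)
  *S-δ zero f f≡0 b []      = refl
  *S-δ (suc K) f f≡0 b []   = sym (trans (∑-words-suc K (λ t → f t * δ (t ++ b) [])) (cong (λ s → f [] * δ b [] + s)
    (∑-zeros (allFin d) (λ i → ∑-zeros (words K) (λ t → ℤₚ.*-zeroʳ (f (i ∷ t)))))))
  *S-δ zero f f≡0 b (j ∷ z) = trans (*S-∷ f (δ b) j z) (cong (λ s → f [] * δ b (j ∷ z) + s)
    (*S-zeroˡ (δ b) (λ t → f≡0 (j ∷ t) (s≤s z≤n)) z))
  *S-δ (suc K) f f≡0 b (j ∷ z) = trans (*S-∷ f (δ b) j z) (trans (cong (λ s → f [] * δ b (j ∷ z) + s) (begin
    ((f ∘ (j ∷_)) *S δ b) z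
      ≡⟨ *S-δ K (f ∘ (j ∷_)) (λ t K<t → f≡0 (j ∷ t) (s≤s K<t)) b z ⟩
    ∑ (words K) (λ t → f (j ∷ t) * δ (t ++ b) z)
      ≡⟨ ∑-𝟙-Fin j (λ i → ∑ (words K) (λ t → f (i ∷ t) * δ (t ++ b) z)) ⟨
    ∑ (allFin d) (λ i → 𝟙 (j Finₚ.≟ i) * ∑ (words K) (λ t → f (i ∷ t) * δ (t ++ b) z))
      ≡⟨ ∑-cong (allFin d) (λ i → trans (cong (_* ∑ (words K) (λ t → f (i ∷ t) * δ (t ++ b) z)) (𝟙-sym Finₚ._≟_ j i))
           (sym (∑-*ˡ (words K) (𝟙 (i Finₚ.≟ j)) _))) ⟩
    ∑ (allFin d) (λ i → ∑ (words K) (λ t → 𝟙 (i Finₚ.≟ j) * (f (i ∷ t) * δ (t ++ b) z)))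
      ≡⟨ ∑-cong (allFin d) (λ i → ∑-cong (words K) (λ t → trans (swap (𝟙 (i Finₚ.≟ j)) (f (i ∷ t)) (δ (t ++ b) z))
           (cong (f (i ∷ t) *_) (sym (δ-∷ i (t ++ b) j z))))) ⟩
    ∑ (allFin d) (λ i → ∑ (words K) (λ t → f (i ∷ t) * δ (i ∷ t ++ b) (j ∷ z))) ∎))
    (sym (∑-words-suc K (λ t → f t * δ (t ++ b) (j ∷ z)))))
    where
    open ≡-Reasoning
    swap : ∀ x y z → x * (y * z) ≡ y * (x * z)
    swap = solve-∀

  -- Expands a generator of the ideal between two monomials into the words `a ++ t ++ b`, which
  -- makes it one application of the rewriting rule.
  δ-*S-*S-δ : ∀ K (f : Series d) → (∀ z → K < length z → f z ≡ 0ℤ) → ∀ a b z →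
              ((δ a *S f) *S δ b) z ≡ ∑ (words K) (λ t → f t * δ (a ++ t ++ b) z)
  δ-*S-*S-δ K f f≡0 [] b z = trans
    (*S-congˡ (δ b) (λ t → trans (*S-constantˡ (δ []) f (λ _ _ → refl) t) (ℤₚ.*-identityˡ (f t))) z)
    (*S-δ K f f≡0 b z)
  δ-*S-*S-δ K f f≡0 (i ∷ a) b []      = sym (∑-zeros (words K) (λ t → ℤₚ.*-zeroʳ (f t)))
  δ-*S-*S-δ K f f≡0 (i ∷ a) b (j ∷ z) = begin
    ((δ (i ∷ a) *S f) *S δ b) (j ∷ z)
      ≡⟨ trans (*S-∷ (δ (i ∷ a) *S f) (δ b) j z) (ℤₚ.+-identityˡ ((((δ (i ∷ a) *S f) ∘ (j ∷_)) *S δ b) z)) ⟩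
    (((δ (i ∷ a) *S f) ∘ (j ∷_)) *S δ b) z
      ≡⟨ *S-congˡ (δ b) (δ-*S-∷ i a f j) z ⟩
    ((ε ·S (δ a *S f)) *S δ b) z
      ≡⟨ *S-·ˡ ε (δ a *S f) (δ b) z ⟩
    ε * ((δ a *S f) *S δ b) z
      ≡⟨ cong (ε *_) (δ-*S-*S-δ K f f≡0 a b z) ⟩
    ε * ∑ (words K) (λ t → f t * δ (a ++ t ++ b) z)
      ≡⟨ ∑-*ˡ (words K) ε _ ⟨
    ∑ (words K) (λ t → ε * (f t * δ (a ++ t ++ b) z))
      ≡⟨ ∑-cong (words K) (λ t → trans (swap ε (f t) (δ (a ++ t ++ b) z)) (cong (f t *_) (sym (δ-∷ i (a ++ t ++ b) j z)))) ⟩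
    ∑ (words K) (λ t → f t * δ (i ∷ a ++ t ++ b) (j ∷ z)) ∎
    where
    open ≡-Reasoning
    ε : ℤ
    ε = 𝟙 (i Finₚ.≟ j)
    swap : ∀ x y z → x * (y * z) ≡ y * (x * z)
    swap = solve-∀

  ∑-words-splits : ∀ K (H : Word d → Word d → ℤ) →
    ∑ (words K) (λ z → ∑ (splits z) (λ xy → H (proj₁ xy) (proj₂ xy)))
      ≡ ∑ (words K) (λ x → ∑ (words (K ℕ.∸ length x)) (H x))
  ∑-words-splits zero    H = refl
  ∑-words-splits (suc K) H = begin
    ∑ (words (suc K)) (λ z → ∑ (splits z) H′)
      ≡⟨ ∑-words-suc K (λ z → ∑ (splits z) H′) ⟩
    (H [] [] + 0ℤ) + ∑ (allFin d) (λ i → ∑ (words K) (λ z → H [] (i ∷ z) + ∑ (map _ (splits z)) H′))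
      ≡⟨ cong₂ _+_ (ℤₚ.+-identityʳ (H [] [])) (∑-cong (allFin d) (λ i → trans (∑-+ (words K) (λ z → H [] (i ∷ z)) _)
           (cong (λ s → ∑ (words K) (λ z → H [] (i ∷ z)) + s)
             (trans (∑-cong (words K) (λ z → trans (∑-map (splits z) _ H′) (∑-cong (splits z) λ { (_ , _) → refl })))
               (∑-words-splits K (H ∘ (i ∷_))))))) ⟩
    H [] [] + ∑ (allFin d) (λ i → ∑ (words K) (λ z → H [] (i ∷ z)) + ∑ (words K) (λ x → ∑ (words (K ℕ.∸ length x)) (H (i ∷ x))))
      ≡⟨ cong (λ s → H [] [] + s) (∑-+ (allFin d) (λ i → ∑ (words K) (λ z → H [] (i ∷ z))) _) ⟩
    H [] [] + (∑ (allFin d) (λ i → ∑ (words K) (λ z → H [] (i ∷ z))) + R)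
      ≡⟨ ℤₚ.+-assoc (H [] []) _ R ⟨
    (H [] [] + ∑ (allFin d) (λ i → ∑ (words K) (λ z → H [] (i ∷ z)))) + R
      ≡⟨ cong (_+ R) (∑-words-suc K (H [])) ⟨
    ∑ (words (suc K)) (H []) + R
      ≡⟨ ∑-words-suc K (λ x → ∑ (words (suc K ℕ.∸ length x)) (H x)) ⟨
    ∑ (words (suc K)) (λ x → ∑ (words (suc K ℕ.∸ length x)) (H x)) ∎
    where
    open ≡-Reasoning
    H′ : Word d × Word d → ℤ
    H′ xy = H (proj₁ xy) (proj₂ xy)
    R : ℤ
    R = ∑ (allFin d) (λ i → ∑ (words K) (λ x → ∑ (words (K ℕ.∸ length x)) (H (i ∷ x))))

  splits-++ : ∀ (z : Word d) → All (λ xy → proj₁ xy ++ proj₂ xy ≡ z) (splits z)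
  splits-++ []      = refl ∷ []
  splits-++ (i ∷ z) = refl ∷ Allₚ.map⁺ (All.map (cong (i ∷_)) (splits-++ z))

  -- Moves a functional `φ` across a product. The inner range is what the factor `x` leaves of the
  -- length bound.
  ∑-*S : ∀ K (f g φ : Series d) → ∑ (words K) (λ z → (f *S g) z * φ z) ≡
         ∑ (words K) (λ x → ∑ (words (K ℕ.∸ length x)) (λ y → f x * (g y * φ (x ++ y))))
  ∑-*S K f g φ = trans (∑-cong (words K) at) (∑-words-splits K (λ x y → f x * (g y * φ (x ++ y))))
    where
    pairs : ∀ z → (f *S g) z ≡ ∑ (splits z) (λ xy → f (proj₁ xy) * g (proj₂ xy))
    pairs z = ∑-cong (splits z) λ { (_ , _) → refl }
    at : ∀ z → (f *S g) z * φ z ≡ ∑ (splits z) (λ xy → f (proj₁ xy) * (g (proj₂ xy) * φ (proj₁ xy ++ proj₂ xy)))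
    at z = trans (cong (_* φ z) (pairs z))
      (trans (sym (∑-*ʳ (splits z) (φ z) (λ xy → f (proj₁ xy) * g (proj₂ xy)))) (∑-cong-All (All.map
      (λ { {x , y} refl → ℤₚ.*-assoc (f x) (g y) (φ (x ++ y)) }) (splits-++ z))))

  lincomb≡∑ : ∀ k (c : Fin k → ℤ) (b : Fin k → Series d) z → lincomb k c b z ≡ ∑ (allFin k) (λ j → c j * b j z)
  lincomb≡∑ k c b z = trans (unfold {k} k c b) (sumFin≡∑ k (λ j → c j * b j z))
    where
    unfold : ∀ {e} k (c : Fin k → ℤ) (b : Fin k → Series d) → lincomb k c b z ≡ sumFin {e} k (λ j → c j * b j z)
    unfold     zero    c b = refl
    unfold {e} (suc k) c b = cong (λ s → c Fin.zero * b Fin.zero z + s) (unfold {e} k (c ∘ Fin.suc) (b ∘ Fin.suc))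

  δ-IsPoly : ∀ p u → IsPoly p (δ u)
  δ-IsPoly p u = suc (length u) , λ w u<w → Congruence.to-≡[] p (Congruence.≋-reflexive p
    (δ-≢ {u} {w} (λ { refl → ℕₚ.<-irrefl refl u<w })))

  -- The two-sided ideal of the relation

  module _ (p : ℕ) (ρ : Series d) where
    open Congruence p

    private
      term : Series d × Series d → Series d
      term ab = (proj₁ ab *S ρ) *S proj₂ ab

    sumS-terms : ∀ L w → sumS (map (λ { (a , b) → (a *S ρ) *S b }) L) w ≡ ∑ L (λ ab → term ab w)
    sumS-terms []      w = refl
    sumS-terms (ab ∷ L) w = cong (λ s → term ab w + s) (sumS-terms L w)

    record Ideal (f : Series d) : Set where
      constructor ideal
      field
        terms  : List (Series d × Series d)
        polys  : All (λ ab → IsPoly p (proj₁ ab) × IsPoly p (proj₂ ab)) terms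
        equals : ∀ w → f w ≋ ∑ terms (λ ab → term ab w)

    InIdeal⇒Ideal : ∀ {f} → InIdeal p ρ f → Ideal f
    InIdeal⇒Ideal (L , polys , f≈) = ideal L polys (λ w → ≋-trans (from-≡[] (f≈ w)) (≋-reflexive (sumS-terms L w)))

    Ideal⇒InIdeal : ∀ {f} → Ideal f → InIdeal p ρ f
    Ideal⇒InIdeal (ideal L polys f≋) = L , polys , (λ w → to-≡[] (≋-trans (f≋ w) (≋-reflexive (sym (sumS-terms L w)))))

    Ideal-resp : ∀ {f g : Series d} → (∀ w → f w ≋ g w) → Ideal f → Ideal g
    Ideal-resp f≋g (ideal L polys f≋) = ideal L polys (λ w → ≋-trans (≋-sym (f≋g w)) (f≋ w))

    Ideal-zero : Ideal zeroS
    Ideal-zero = ideal [] [] (λ _ → ≋-refl)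

    Ideal-+ : ∀ {f g : Series d} → Ideal f → Ideal g → Ideal (f +S g)
    Ideal-+ (ideal L polys f≋) (ideal M polys′ g≋) = ideal (L ++ M) (Allₚ.++⁺ polys polys′)
      (λ w → ≋-trans (+-≋ (f≋ w) (g≋ w)) (≋-reflexive (sym (∑-++ L M (λ ab → term ab w)))))

    Ideal-· : ∀ c {f : Series d} → Ideal f → Ideal (c ·S f)
    Ideal-· c {f} (ideal L polys f≋) = ideal (map scale L) (Allₚ.map⁺ (All.map (λ {ab} → poly {ab}) polys))
      (λ w → ≋-trans (*-≋ˡ c (f≋ w)) (≋-reflexive (scaled w)))
      where
      scale : Series d × Series d → Series d × Series d
      scale ab = c ·S proj₁ ab , proj₂ ab
      poly : ∀ {ab : Series d × Series d} → IsPoly p (proj₁ ab) × IsPoly p (proj₂ ab) → IsPoly p (c ·S proj₁ ab) × IsPoly p (proj₂ ab)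
      poly {a , _} ((N , zero-above) , polyʳ) = (N , λ w N≤w → to-≡[] (*-zero-≋ c (from-≡[] {a w} {0ℤ} (zero-above w N≤w)))) , polyʳ
      scaled : ∀ w → c * ∑ L (λ ab → term ab w) ≡ ∑ (map scale L) (λ ab → term ab w)
      scaled w = trans (sym (∑-*ˡ L c (λ ab → term ab w))) (trans
        (∑-cong L λ { (a , b) → sym (trans (*S-congˡ b (*S-·ˡ c a ρ) w) (*S-·ˡ c (a *S ρ) b w)) })
        (sym (∑-map L scale (λ ab → term ab w))))

    Ideal-generator : ∀ {a b : Series d} → IsPoly p a → IsPoly p b → Ideal ((a *S ρ) *S b)
    Ideal-generator {a} {b} poly-a poly-b = ideal ((a , b) ∷ []) ((poly-a , poly-b) ∷ [])
      (λ w → ≋-reflexive (sym (ℤₚ.+-identityʳ (term (a , b) w))))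

-- Unbordered words and rewriting

module _ {d : ℕ} where

  levi : ∀ (x u : Word d) {y v} → x ++ y ≡ u ++ v →
         (∃ λ e → u ≡ x ++ e × y ≡ e ++ v) ⊎ (∃₂ λ c e → x ≡ u ++ c ∷ e × v ≡ c ∷ e ++ y)
  levi []      u       eq = inj₁ (u , refl , eq)
  levi (c ∷ x) []      eq = inj₂ (c , x , refl , sym eq)
  levi (c ∷ x) (c′ ∷ u) eq with Listₚ.∷-injective eq
  ... | refl , eq′ with levi x u eq′
  ... | inj₁ (e , refl , y≡)       = inj₁ (e , refl , y≡)
  ... | inj₂ (c″ , e , refl , v≡) = inj₂ (c″ , e , refl , v≡)

  prefix? : ∀ (u z : Word d) → Dec (∃ λ b → z ≡ u ++ b)
  prefix? []      z       = yes (z , refl)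
  prefix? (a ∷ u) []      = no λ ()
  prefix? (a ∷ u) (b ∷ z) with a Finₚ.≟ b | prefix? u z
  ... | yes refl | yes (e , refl) = yes (e , refl)
  ... | yes refl | no ¬prefix     = no λ { (e , refl) → ¬prefix (e , refl) }
  ... | no a≢b   | _              = no λ { (_ , refl) → a≢b refl }

  Occurs : Word d → Word d → Set
  Occurs w z = ∃₂ λ a b → z ≡ a ++ w ++ b

  occurs? : ∀ w z → Dec (Occurs w z)
  occurs? w z with prefix? w z
  occurs? w z       | yes (b , z≡) = yes ([] , b , z≡)
  occurs? w []      | no ¬prefix   = no λ { ([] , b , z≡) → ¬prefix (b , z≡) ; (_ ∷ _ , _ , ()) }
  occurs? w (c ∷ z) | no ¬prefix with occurs? w z
  ... | yes (a , b , refl) = yes (c ∷ a , b , refl)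
  ... | no ¬occurs         = no λ
        { ([] , b , z≡)    → ¬prefix (b , z≡)
        ; (_ ∷ a , b , z≡) → ¬occurs (a , b , Listₚ.∷-injectiveʳ z≡) }

  -- If the second occurrence started inside the first, a second use of `levi` would make the common
  -- part a prefix as well as a suffix of `w`, or else longer than `w`. A border is all of `w`,
  -- which contradicts the shift by `c ∷ a`.
  Unbordered-overlap : ∀ {w c a b b′} → Unbordered w → w ++ b ≡ (c ∷ a) ++ w ++ b′ →
                       ∃ λ e → c ∷ a ≡ w ++ e × b ≡ e ++ w ++ b′
  Unbordered-overlap {w} {c} {a} unbordered eq with levi w (c ∷ a) eq
  ... | inj₁ found = found
  ... | inj₂ (c′ , s , w≡ , eq′) with levi (c′ ∷ s) w (sym eq′)
  ... | inj₂ (c″ , s′ , s≡ , _) = ⊥-elim (ℕₚ.<-irrefl (cong length w≡) (begin-strict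
        length w                                 <⟨ ℕₚ.m<m+n (length w) (s≤s z≤n) ⟩
        length w ℕ.+ length (c″ ∷ s′)            ≡⟨ trans (cong length s≡) (Listₚ.length-++ w) ⟨
        length (c′ ∷ s)                          ≤⟨ ℕₚ.m≤n+m (length (c′ ∷ s)) (length (c ∷ a)) ⟩
        length (c ∷ a) ℕ.+ length (c′ ∷ s)       ≡⟨ Listₚ.length-++ (c ∷ a) ⟨
        length ((c ∷ a) ++ c′ ∷ s)               ∎))
    where open ℕₚ.≤-Reasoning
  ... | inj₁ (f , w≡′ , _) with unbordered c′ s f (c ∷ a) w≡′ w≡
  ... | refl = ⊥-elim (++-self a (trans (sym (trans w≡′ (Listₚ.++-identityʳ (c′ ∷ s)))) w≡))

  Unbordered-positions : ∀ {w} → Unbordered w → ∀ a a′ {b b′} → a ++ w ++ b ≡ a′ ++ w ++ b′ →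
    (a ≡ a′ × b ≡ b′)
    ⊎ (∃ λ e → a′ ≡ a ++ w ++ e × b ≡ e ++ w ++ b′)
    ⊎ (∃ λ e → a ≡ a′ ++ w ++ e × b′ ≡ e ++ w ++ b)
  Unbordered-positions {w} unb []      []       eq = inj₁ (refl , Listₚ.++-cancelˡ w _ _ eq)
  Unbordered-positions {w} unb []      (c ∷ a′) eq = inj₂ (inj₁ (Unbordered-overlap {w} unb eq))
  Unbordered-positions {w} unb (c ∷ a) []       eq = inj₂ (inj₂ (Unbordered-overlap {w} unb (sym eq)))
  Unbordered-positions {w} unb (c ∷ a) (c′ ∷ a′) eq with Listₚ.∷-injective eq
  ... | refl , eq′ with Unbordered-positions unb a a′ eq′
  ... | inj₁ (refl , b≡)             = inj₁ (refl , b≡)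
  ... | inj₂ (inj₁ (e , refl , b≡)) = inj₂ (inj₁ (e , refl , b≡))
  ... | inj₂ (inj₂ (e , refl , b≡)) = inj₂ (inj₂ (e , refl , b≡))

  weight-++ : ∀ (τ : Fin d → ℕ) u v → weight τ (u ++ v) ≡ weight τ u ℕ.+ weight τ v
  weight-++ τ u v = weight-shuffle τ (++-shuffle u v)

module Rewriting {d : ℕ} (τ : Fin d → ℕ) (τ-pos : ∀ i → 0 < τ i) where

  length≤weight : ∀ z → length z ≤ weight τ z
  length≤weight []      = z≤n
  length≤weight (i ∷ z) = ℕₚ.+-mono-≤ (τ-pos i) (length≤weight z)

  infix 4 _⊏_

  -- Oriented from a rewritten word down to its results: these are lexicographically larger, since
  -- the rule removes the least word of a support. Equal weights bound the lengths and exclude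
  -- proper prefixes.
  _⊏_ : Word d → Word d → Set
  z′ ⊏ z = weight τ z′ ≡ weight τ z × z ≺ z′

  private
    Above : ℕ → Word d → Word d → Set
    Above K z′ z = length z′ ≤ K × z ≺ z′

    -- Lexicographic induction on the first letter, upward in `Fin d`, and then on the tail. Without
    -- the length bound, appending letters would ascend forever.
    above-acc : ∀ K z → length z ≤ K → Acc (Above K) z
    above-cons : ∀ K {i z} → Acc Fin._>_ i → Acc (Above K) z → Acc (Above (suc K)) (i ∷ z)
    above-step : ∀ K {i z} → Acc Fin._>_ i → Acc (Above K) z → ∀ {z′} → Above (suc K) z′ (i ∷ z) → Acc (Above (suc K)) z′

    above-acc zero    []      _         = acc λ { {[]} (_ , ()) ; {_ ∷ _} (() , _) }
    above-acc (suc K) []      _         = acc λ { {i ∷ z} (s≤s z≤K , []≺) → above-cons K (>-wellFounded i) (above-acc K z z≤K) }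
    above-acc (suc K) (i ∷ z) (s≤s z≤K) = above-cons K (>-wellFounded i) (above-acc K z z≤K)

    above-cons K i-acc z-acc = acc (above-step K i-acc z-acc)

    above-step K (acc rs) _        {_ ∷ z′} (s≤s z′≤K , head i<j)  = above-cons K (rs i<j) (above-acc K z′ z′≤K)
    above-step K i-acc    (acc rs) {_ ∷ _}  (s≤s z′≤K , tail z≺z′) = above-cons K i-acc (rs (z′≤K , z≺z′))

  ⊏-wellFounded : WellFounded _⊏_
  ⊏-wellFounded z = go z refl (above-acc (weight τ z) z (length≤weight z))
    where
    go : ∀ {m} z → weight τ z ≡ m → Acc (Above m) z → Acc _⊏_ z
    go z refl (acc rs) = acc λ { {z′} (wt≡ , z≺z′) →
      go z′ wt≡ (rs (subst (length z′ ≤_) wt≡ (length≤weight z′) , z≺z′)) }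

  -- The right context is harmless: it could only matter if `w` were a proper prefix of `t`, and
  -- then `t` would be heavier.
  ⊏-context : ∀ {t w} → t ⊏ w → ∀ a b → a ++ t ++ b ⊏ a ++ w ++ b
  ⊏-context {t} {w} (wt≡ , w≺t) a b = weights , ≺-++ˡ a stable
    where
    weights : weight τ (a ++ t ++ b) ≡ weight τ (a ++ w ++ b)
    weights = begin
      weight τ (a ++ t ++ b)                          ≡⟨ trans (weight-++ τ a (t ++ b)) (cong (weight τ a ℕ.+_) (weight-++ τ t b)) ⟩
      weight τ a ℕ.+ (weight τ t ℕ.+ weight τ b)      ≡⟨ cong (λ k → weight τ a ℕ.+ (k ℕ.+ weight τ b)) wt≡ ⟩
      weight τ a ℕ.+ (weight τ w ℕ.+ weight τ b)      ≡⟨ trans (weight-++ τ a (w ++ b)) (cong (weight τ a ℕ.+_) (weight-++ τ w b)) ⟨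
      weight τ (a ++ w ++ b)                          ∎
      where open ≡-Reasoning
    stable : w ++ b ≺ t ++ b
    stable with ≺-prefix-or-stable w≺t
    ... | inj₂ stable = stable b b
    ... | inj₁ (c , s , refl) = ⊥-elim (ℕₚ.<-irrefl (sym wt≡) (subst (weight τ w <_) (sym (weight-++ τ w (c ∷ s)))
            (ℕₚ.m<m+n (weight τ w) (ℕₚ.<-≤-trans (τ-pos c) (ℕₚ.m≤m+n (τ c) (weight τ s))))))

  -- The one-rule rewriting system w ↦ - Σ κ(t) t, where every t with κ(t) ≠ 0 is
  -- ≺-greater than w and of the same weight.
  module Reduction (x₀ : Fin d) (w₀ : Word d) (unbordered : Unbordered (x₀ ∷ w₀)) (κ : Series d)
                   (κ-support : ∀ t → κ t ≡ 0ℤ ⊎ t ⊏ x₀ ∷ w₀) where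

    w : Word d
    w = x₀ ∷ w₀

    n : ℕ
    n = weight τ w

    module _ (v : Word d) where

      private
        step : ∀ z → (∀ z′ → z′ ⊏ z → ℤ) → Dec (Occurs w z) → ℤ
        -- The sum runs over all of `words n`, but recursion is permitted only at `t ⊏ w`. The case
        -- of `κ-support` supplies the proof or drops the term.
        contribution : ∀ z a b → z ≡ a ++ w ++ b → (∀ z′ → z′ ⊏ z → ℤ) → ∀ t → κ t ≡ 0ℤ ⊎ t ⊏ w → ℤ

        step z rec (no _)             = δ v z
        step z rec (yes (a , b , z≡)) = - ∑ (words n) (λ t → contribution z a b z≡ rec t (κ-support t))

        contribution _ a b refl rec t (inj₁ _)   = 0ℤ
        contribution _ a b refl rec t (inj₂ t⊏w) = κ t * rec (a ++ t ++ b) (⊏-context t⊏w a b)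

        reduce : ∀ z → Acc _⊏_ z → ℤ
        reduce z (acc rs) = step z (λ z′ z′⊏z → reduce z′ (rs z′⊏z)) (occurs? w z)

        step-cong : ∀ z {rec rec′ : ∀ z′ → z′ ⊏ z → ℤ} → (∀ z′ z′⊏z → rec z′ z′⊏z ≡ rec′ z′ z′⊏z) →
                    ∀ o → step z rec o ≡ step z rec′ o
        step-cong z eq (no _)               = refl
        step-cong z eq (yes (a , b , refl)) = cong -_ (∑-cong (words n) (λ t → same t (κ-support t)))
          where
          same : ∀ t k → contribution z a b refl _ t k ≡ contribution z a b refl _ t k
          same t (inj₁ _)   = refl
          same t (inj₂ t⊏w) = cong (κ t *_) (eq (a ++ t ++ b) (⊏-context t⊏w a b))

        reduce-irrelevant : ∀ z (α β : Acc _⊏_ z) → reduce z α ≡ reduce z β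
        reduce-irrelevant z (acc rs) (acc rs′) = step-cong z (λ z′ z′⊏z → reduce-irrelevant z′ (rs z′⊏z) (rs′ z′⊏z)) (occurs? w z)

      -- The coefficient of the normal word v in the normal form of a word.
      ψ : Series d
      ψ z = reduce z (⊏-wellFounded z)

      ψ-unfold : ∀ z → (¬ Occurs w z × ψ z ≡ δ v z) ⊎
                 (∃₂ λ a b → z ≡ a ++ w ++ b × ψ z ≡ - ∑ (words n) (λ t → κ t * ψ (a ++ t ++ b)))
      ψ-unfold z with ⊏-wellFounded z
      ... | acc rs with occurs? w z
      ... | no ¬occurs           = inj₁ (¬occurs , refl)
      ... | yes (a , b , refl) = inj₂ (a , b , refl , cong -_ (∑-cong (words n) (λ t → same t (κ-support t))))
        where
        same : ∀ t (k : κ t ≡ 0ℤ ⊎ t ⊏ w) →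
               contribution (a ++ w ++ b) a b refl (λ z′ z′⊏z → reduce z′ (rs z′⊏z)) t k ≡ κ t * ψ (a ++ t ++ b)
        same t (inj₁ κt≡0) = sym (cong (_* ψ (a ++ t ++ b)) κt≡0)
        same t (inj₂ t⊏w)  = cong (κ t *_) (reduce-irrelevant (a ++ t ++ b) (rs (⊏-context t⊏w a b)) (⊏-wellFounded (a ++ t ++ b)))

      ψ-normal : ∀ z → ¬ Occurs w z → ψ z ≡ δ v z
      ψ-normal z normal with ψ-unfold z
      ... | inj₁ (_ , eq)         = eq
      ... | inj₂ (a , b , z≡ , _) = contradiction (a , b , z≡) normal

      ψ-homogeneous : ∀ z → weight τ z ≢ weight τ v → ψ z ≡ 0ℤ
      ψ-homogeneous z = go (⊏-wellFounded z)
        where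
        go : ∀ {z} → Acc _⊏_ z → weight τ z ≢ weight τ v → ψ z ≡ 0ℤ
        go {z} (acc rs) wt≢ with ψ-unfold z
        ... | inj₁ (_ , eq) = trans eq (δ-≢ (λ { refl → wt≢ refl }))
        ... | inj₂ (a , b , refl , eq) = trans eq (cong -_ (∑-zeros (words n) (λ t → zero-term t (κ-support t))))
          where
          zero-term : ∀ t → κ t ≡ 0ℤ ⊎ t ⊏ w → κ t * ψ (a ++ t ++ b) ≡ 0ℤ
          zero-term t (inj₁ κt≡0) = cong (_* ψ (a ++ t ++ b)) κt≡0
          zero-term t (inj₂ t⊏w)  = trans (cong (κ t *_) (go (rs (⊏-context t⊏w a b))
            (λ wt≡ → wt≢ (trans (sym (proj₁ (⊏-context t⊏w a b))) wt≡)))) (ℤₚ.*-zeroʳ (κ t))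

      private
        Relation : Word d → Word d → Set
        Relation a b = ψ (a ++ w ++ b) ≡ - ∑ (words n) (λ t → κ t * ψ (a ++ t ++ b))

        ++-regroup : ∀ (a x c y : Word d) → (a ++ x ++ c) ++ y ≡ a ++ x ++ c ++ y
        ++-regroup a x c y = trans (Listₚ.++-assoc a (x ++ c) y) (cong (a ++_) (Listₚ.++-assoc x c y))

        -- The heart of confluence: by the induction hypothesis, reducing either of two disjoint
        -- occurrences leads to the same double sum, in which both have been replaced.
        commute : ∀ a c b → (∀ a′ b′ → a′ ++ w ++ b′ ⊏ a ++ w ++ c ++ w ++ b → Relation a′ b′) →
                  ∑ (words n) (λ t → κ t * ψ (a ++ t ++ c ++ w ++ b)) ≡ ∑ (words n) (λ t → κ t * ψ ((a ++ w ++ c) ++ t ++ b))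
        commute a c b IH = begin
          ∑ (words n) (λ t → κ t * ψ (a ++ t ++ c ++ w ++ b))
            ≡⟨ ∑-cong (words n) (λ t → first t (κ-support t)) ⟩
          ∑ (words n) (λ t → ∑ (words n) (λ t′ → κ t * (- (κ t′ * ψ (a ++ t ++ c ++ t′ ++ b)))))
            ≡⟨ ∑-swap (words n) (words n) _ ⟩
          ∑ (words n) (λ t′ → ∑ (words n) (λ t → κ t * (- (κ t′ * ψ (a ++ t ++ c ++ t′ ++ b)))))
            ≡⟨ ∑-cong (words n) (λ t′ → second t′ (κ-support t′)) ⟨
          ∑ (words n) (λ t′ → κ t′ * ψ ((a ++ w ++ c) ++ t′ ++ b)) ∎
          where
          open ≡-Reasoning
          swap : ∀ k l x → k * (- (l * x)) ≡ l * (- (k * x))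
          swap = solve-∀
          distribute : ∀ k (f : Series d) → k * - ∑ (words n) f ≡ ∑ (words n) (λ t → k * - f t)
          distribute k f = trans (cong (k *_) (sym (∑-neg (words n) f))) (sym (∑-*ˡ (words n) k (λ t → - f t)))
          zeros : ∀ {k} x (f : Series d) → k ≡ 0ℤ → k * x ≡ ∑ (words n) (λ t → k * - f t)
          zeros x f refl = sym (∑-zeros (words n) (λ _ → refl))
          first : ∀ t → κ t ≡ 0ℤ ⊎ t ⊏ w →
                  κ t * ψ (a ++ t ++ c ++ w ++ b) ≡ ∑ (words n) (λ t′ → κ t * (- (κ t′ * ψ (a ++ t ++ c ++ t′ ++ b))))
          first t (inj₁ κt≡0) = zeros _ (λ t′ → κ t′ * ψ (a ++ t ++ c ++ t′ ++ b)) κt≡0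
          first t (inj₂ t⊏w)  = trans (cong (κ t *_) (begin
            ψ (a ++ t ++ c ++ w ++ b)
              ≡⟨ cong ψ (++-regroup a t c (w ++ b)) ⟨
            ψ ((a ++ t ++ c) ++ w ++ b)
              ≡⟨ IH (a ++ t ++ c) b (subst (_⊏ _) (sym (++-regroup a t c (w ++ b))) (⊏-context t⊏w a (c ++ w ++ b))) ⟩
            - ∑ (words n) (λ t′ → κ t′ * ψ ((a ++ t ++ c) ++ t′ ++ b))
              ≡⟨ cong -_ (∑-cong (words n) (λ t′ → cong (λ z → κ t′ * ψ z) (++-regroup a t c (t′ ++ b)))) ⟩
            - ∑ (words n) (λ t′ → κ t′ * ψ (a ++ t ++ c ++ t′ ++ b)) ∎)) (distribute (κ t) _)
          second : ∀ t′ → κ t′ ≡ 0ℤ ⊎ t′ ⊏ w →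
                   κ t′ * ψ ((a ++ w ++ c) ++ t′ ++ b) ≡ ∑ (words n) (λ t → κ t * (- (κ t′ * ψ (a ++ t ++ c ++ t′ ++ b))))
          second t′ (inj₁ κt′≡0) = trans (zeros _ (λ t → κ t * ψ (a ++ t ++ c ++ t′ ++ b)) κt′≡0)
            (∑-cong (words n) (λ t → swap (κ t′) (κ t) (ψ (a ++ t ++ c ++ t′ ++ b))))
          second t′ (inj₂ t′⊏w)  = trans (cong (κ t′ *_) (begin
            ψ ((a ++ w ++ c) ++ t′ ++ b)
              ≡⟨ cong ψ (++-regroup a w c (t′ ++ b)) ⟩
            ψ (a ++ w ++ c ++ t′ ++ b)
              ≡⟨ IH a (c ++ t′ ++ b) (subst₂ _⊏_ (++-regroup a w c (t′ ++ b)) (++-regroup a w c (w ++ b)) (⊏-context t′⊏w (a ++ w ++ c) b)) ⟩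
            - ∑ (words n) (λ t → κ t * ψ (a ++ t ++ c ++ t′ ++ b)) ∎))
            (trans (distribute (κ t′) _) (∑-cong (words n) (λ t → swap (κ t′) (κ t) (ψ (a ++ t ++ c ++ t′ ++ b)))))

      -- Occurrences of an unbordered word never overlap, so the system is confluent.
      ψ-relation : ∀ a b → ψ (a ++ w ++ b) ≡ - ∑ (words n) (λ t → κ t * ψ (a ++ t ++ b))
      ψ-relation a b = go a b (⊏-wellFounded (a ++ w ++ b))
        where
        go : ∀ a b → Acc _⊏_ (a ++ w ++ b) → Relation a b
        go a b (acc rs) with ψ-unfold (a ++ w ++ b)
        ... | inj₁ (normal , _) = contradiction (a , b , refl) normal
        ... | inj₂ (a′ , b′ , z≡ , eq) with Unbordered-positions {w = w} unbordered a a′ z≡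
        ... | inj₁ (refl , refl) = eq
        ... | inj₂ (inj₁ (e , refl , refl)) = trans eq (cong -_ (sym (commute a e b′ λ a″ b″ lt → go a″ b″ (rs lt))))
        ... | inj₂ (inj₂ (e , refl , refl)) = trans eq (cong -_ (commute a′ e b λ a″ b″ lt →
              go a″ b″ (rs (subst (a″ ++ w ++ b″ ⊏_) (sym z≡) lt))))

-- One-relator algebras

𝟙-yes : ∀ {P : Set} (P? : Dec P) → P → 𝟙 P? ≡ 1ℤ
𝟙-yes (yes _) _ = refl
𝟙-yes (no ¬P) P = contradiction P ¬P

𝟙-no : ∀ {P : Set} (P? : Dec P) → ¬ P → 𝟙 P? ≡ 0ℤ
𝟙-no (yes P) ¬P = contradiction P ¬P
𝟙-no (no _)  _  = refl

Unique-lookup-injective : ∀ {A : Set} {L : List A} → Unique L → ∀ i j → lookup L i ≡ lookup L j → i ≡ j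
Unique-lookup-injective (_ AllPairs.∷ _) Fin.zero    Fin.zero    _  = refl
Unique-lookup-injective (x≢ AllPairs.∷ _) Fin.zero    (Fin.suc j) eq = contradiction eq (All.lookup x≢ (∈ₚ.∈-lookup j))
Unique-lookup-injective (x≢ AllPairs.∷ _) (Fin.suc i) Fin.zero    eq = contradiction (sym eq) (All.lookup x≢ (∈ₚ.∈-lookup i))
Unique-lookup-injective (_ AllPairs.∷ u) (Fin.suc i) (Fin.suc j) eq = cong Fin.suc (Unique-lookup-injective u i j eq)

module OneRelator {d : ℕ} (τ : Fin d → ℕ) (τ-pos : ∀ i → 0 < τ i)
                  (x₀ : Fin d) (w₀ : Word d) (unbordered : Unbordered (x₀ ∷ w₀)) where

  open Rewriting τ τ-pos

  w : Word d
  w = x₀ ∷ w₀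

  n : ℕ
  n = weight τ w

  normal? : ∀ m z → Dec (weight τ z ≡ m × ¬ Occurs w z)
  normal? m z = (weight τ z ℕₚ.≟ m) ×-dec ¬? (occurs? w z)

  normalWords : ℕ → List (Word d)
  normalWords m = filter (normal? m) (words m)

  h : ℕ → ℕ
  h m = length (normalWords m)

  basis : ∀ m → Fin (h m) → Word d
  basis m = lookup (normalWords m)

  basis-normal : ∀ m j → weight τ (basis m j) ≡ m × ¬ Occurs w (basis m j)
  basis-normal m j = All.lookup (Allₚ.all-filter (normal? m) (words m)) (∈ₚ.∈-lookup j)

  -- Under the congruences assumed below, `c` is the leading coefficient of `ρ`, `u` its inverse
  -- modulo p, and `κ` the monic form of `ρ` without its leading word. The support of `κ` is exact,
  -- as the recursion demands, while its link to `ρ` is a congruence.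
  module _ (p : ℕ) (κ : Series d) (κ-support : ∀ t → κ t ≡ 0ℤ ⊎ t ⊏ w)
           (ρ : Series d) (ρ-homogeneous : ∀ t → weight τ t ≢ n → ρ t ≡ 0ℤ)
           (u c : ℤ) where
    open Congruence p
    open Reduction x₀ w₀ unbordered κ κ-support using (ψ; ψ-normal; ψ-homogeneous; ψ-relation)

    module _ (u*c≋1 : u * c ≋ 1ℤ) (ρ≋ : ∀ t → ρ t ≋ c * (δ w t + κ t)) where

      private
        ρ-short : ∀ t → n < length t → ρ t ≡ 0ℤ
        ρ-short t n<t = ρ-homogeneous t (λ wt≡n → ℕₚ.<-irrefl (sym wt≡n) (ℕₚ.<-≤-trans n<t (length≤weight t)))

      ψ-ρ : ∀ v x y → ∑ (words n) (λ t → ρ t * ψ v (x ++ t ++ y)) ≋ 0ℤ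
      ψ-ρ v x y = ≋-trans (∑-≋ p (words n) (λ t → *-≋ʳ (φ t) (ρ≋ t))) (≋-reflexive (begin
        ∑ (words n) (λ t → c * (δ w t + κ t) * φ t)
          ≡⟨ ∑-cong (words n) (λ t → expand c (δ w t) (κ t) (φ t)) ⟩
        ∑ (words n) (λ t → c * (δ w t * φ t + κ t * φ t))
          ≡⟨ ∑-*ˡ (words n) c (λ t → δ w t * φ t + κ t * φ t) ⟩
        c * ∑ (words n) (λ t → δ w t * φ t + κ t * φ t)
          ≡⟨ cong (c *_) (∑-+ (words n) (λ t → δ w t * φ t) (λ t → κ t * φ t)) ⟩
        c * (∑ (words n) (λ t → δ w t * φ t) + S)
          ≡⟨ cong (λ s → c * (s + S)) (trans (∑-words-δ w φ (length≤weight w)) (ψ-relation v x y)) ⟩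
        c * (- S + S)
          ≡⟨ trans (cong (c *_) (ℤₚ.+-inverseˡ S)) (ℤₚ.*-zeroʳ c) ⟩
        0ℤ ∎))
        where
        open ≡-Reasoning
        φ : Series d
        φ t = ψ v (x ++ t ++ y)
        S : ℤ
        S = ∑ (words n) (λ t → κ t * φ t)
        expand : ∀ c e k f → c * (e + k) * f ≡ c * (e * f + k * f)
        expand = solve-∀

      -- `ψ v` is concentrated in the weight of `v`, so a finite sum computes its pairing with any
      -- series. Freeing the inner ranges from the outer variables isolates the sums that `ψ-ρ`
      -- annihilates.
      ψ-generator : ∀ v (a b : Series d) → ∑ (words (weight τ v)) (λ z → ((a *S ρ) *S b) z * ψ v z) ≋ 0ℤ
      ψ-generator v a b = ≋-trans (≋-reflexive (begin
        ∑ (words K) (λ z → ((a *S ρ) *S b) z * ψ v z)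
          ≡⟨ ∑-*S K (a *S ρ) b (ψ v) ⟩
        ∑ (words K) (λ s → ∑ (words (K ℕ.∸ length s)) (λ y → (a *S ρ) s * (b y * ψ v (s ++ y))))
          ≡⟨ ∑-cong (words K) (λ s → ∑-words-extend (ℕₚ.m∸n≤m K (length s)) (λ y lt →
               trans (cong (λ e → (a *S ρ) s * (b y * e)) (ψ-long (s ++ y) (long-++ s y lt))) (zeros ((a *S ρ) s) (b y)))) ⟨
        ∑ (words K) (λ s → ∑ (words K) (λ y → (a *S ρ) s * (b y * ψ v (s ++ y))))
          ≡⟨ ∑-swap (words K) (words K) (λ s y → (a *S ρ) s * (b y * ψ v (s ++ y))) ⟩
        ∑ (words K) (λ y → ∑ (words K) (λ s → (a *S ρ) s * (b y * ψ v (s ++ y))))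
          ≡⟨ ∑-cong (words K) (λ y → trans (∑-cong (words K) (λ s → swap ((a *S ρ) s) (b y) (ψ v (s ++ y))))
               (trans (∑-*ˡ (words K) (b y) (λ s → (a *S ρ) s * ψ v (s ++ y)))
                 (cong (b y *_) (∑-*S K a ρ (λ s → ψ v (s ++ y)))))) ⟩
        ∑ (words K) (λ y → b y * ∑ (words K) (λ x → ∑ (words (K ℕ.∸ length x)) (λ t → a x * (ρ t * ψ v ((x ++ t) ++ y)))))
          ≡⟨ ∑-cong (words K) (λ y → cong (b y *_) (∑-cong (words K) (λ x → trans
               (∑-*ˡ (words (K ℕ.∸ length x)) (a x) (λ t → ρ t * ψ v ((x ++ t) ++ y))) (cong (a x *_) (range x y))))) ⟩
        ∑ (words K) (λ y → b y * ∑ (words K) (λ x → a x * ∑ (words n) (λ t → ρ t * ψ v (x ++ t ++ y)))) ∎))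
        (∑-≋0 p (words K) (λ y → *-zero-≋ (b y) (∑-≋0 p (words K) (λ x → *-zero-≋ (a x) (ψ-ρ v x y)))))
        where
        open ≡-Reasoning
        K : ℕ
        K = weight τ v
        ψ-long : ∀ z → K < length z → ψ v z ≡ 0ℤ
        ψ-long z K<z = ψ-homogeneous v z (λ wt≡ → ℕₚ.<-irrefl (sym wt≡) (ℕₚ.<-≤-trans K<z (length≤weight z)))
        long-++ : ∀ s y → K ℕ.∸ length s < length y → K < length (s ++ y)
        long-++ s y lt = subst (K <_) (sym (Listₚ.length-++ s))
          (ℕₚ.≤-<-trans (ℕₚ.m≤n+m∸n K (length s)) (ℕₚ.+-monoʳ-< (length s) lt))
        zeros : ∀ x y → x * (y * 0ℤ) ≡ 0ℤ
        zeros = solve-∀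
        swap : ∀ x y z → x * (y * z) ≡ y * (x * z)
        swap = solve-∀
        -- The two ranges are compared through `words (n ℕ.+ K)`: the extra terms vanish because of
        -- `ψ v` on one side and because of `ρ` on the other.
        range : ∀ x y → ∑ (words (K ℕ.∸ length x)) (λ t → ρ t * ψ v ((x ++ t) ++ y)) ≡ ∑ (words n) (λ t → ρ t * ψ v (x ++ t ++ y))
        range x y = trans (sym (∑-words-extend {M = n ℕ.+ K} (ℕₚ.≤-trans (ℕₚ.m∸n≤m K (length x)) (ℕₚ.m≤n+m K n))
            (λ t lt → trans (cong (ρ t *_) (ψ-long ((x ++ t) ++ y) (ℕₚ.<-≤-trans (long-++ x t lt)
              (subst (length (x ++ t) ≤_) (sym (Listₚ.length-++ (x ++ t))) (ℕₚ.m≤m+n _ _))))) (ℤₚ.*-zeroʳ (ρ t)))))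
          (trans (∑-words-extend (ℕₚ.m≤m+n n K) (λ t n<t → cong (_* ψ v ((x ++ t) ++ y)) (ρ-short t n<t)))
            (∑-cong (words n) (λ t → cong (λ z → ρ t * ψ v z) (Listₚ.++-assoc x t y))))

      -- The functionals `ψ v` for normal `v` kill the ideal and are dual to the normal words, so
      -- pairing with `ψ v` extracts one coefficient.
      basis-independent : ∀ m (e : Fin (h m) → ℤ) → Ideal p ρ (lincomb (h m) e (δ ∘ basis m)) → ∀ j → e j ≋ 0ℤ
      basis-independent m e (ideal L _ equals) j = ≋-trans (≋-reflexive (sym coefficient))
        (≋-trans (∑-≋ p (words K) (λ z → *-≋ʳ (ψ v z) (equals z)))
        (≋-trans (≋-reflexive (trans (∑-cong (words K) (λ z → sym (∑-*ʳ L (ψ v z) (λ ab → ((proj₁ ab *S ρ) *S proj₂ ab) z))))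
                                     (∑-swap (words K) L (λ z ab → ((proj₁ ab *S ρ) *S proj₂ ab) z * ψ v z))))
          (∑-≋0 p L (λ ab → ψ-generator v (proj₁ ab) (proj₂ ab)))))
        where
        open ≡-Reasoning
        v : Word d
        v = basis m j
        K : ℕ
        K = weight τ v
        K≡m : K ≡ m
        K≡m = proj₁ (basis-normal m j)
        basis≤K : ∀ i → length (basis m i) ≤ K
        basis≤K i = subst (length (basis m i) ≤_) (trans (proj₁ (basis-normal m i)) (sym K≡m)) (length≤weight (basis m i))
        dual : ∀ i → ψ v (basis m i) ≡ 𝟙 (j Finₚ.≟ i)
        dual i = trans (ψ-normal v (basis m i) (proj₂ (basis-normal m i))) same
          where
          same : δ v (basis m i) ≡ 𝟙 (j Finₚ.≟ i)
          same with j Finₚ.≟ i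
          ... | yes refl = 𝟙-yes (v ≟ʷ v) refl
          ... | no j≢i   = 𝟙-no (v ≟ʷ basis m i) (λ eq → j≢i (Unique-lookup-injective (Uniqueₚ.filter⁺ (normal? m) (words-Unique m)) j i eq))
        coefficient : ∑ (words K) (λ z → lincomb (h m) e (δ ∘ basis m) z * ψ v z) ≡ e j
        coefficient = begin
          ∑ (words K) (λ z → lincomb (h m) e (δ ∘ basis m) z * ψ v z)
            ≡⟨ ∑-cong (words K) (λ z → trans (cong (_* ψ v z) (lincomb≡∑ (h m) e (δ ∘ basis m) z))
                 (sym (∑-*ʳ (allFin (h m)) (ψ v z) (λ i → e i * δ (basis m i) z)))) ⟩
          ∑ (words K) (λ z → ∑ (allFin (h m)) (λ i → e i * δ (basis m i) z * ψ v z))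
            ≡⟨ ∑-swap (words K) (allFin (h m)) (λ z i → e i * δ (basis m i) z * ψ v z) ⟩
          ∑ (allFin (h m)) (λ i → ∑ (words K) (λ z → e i * δ (basis m i) z * ψ v z))
            ≡⟨ ∑-cong (allFin (h m)) (λ i → trans (∑-cong (words K) (λ z → ℤₚ.*-assoc (e i) (δ (basis m i) z) (ψ v z)))
                 (trans (∑-*ˡ (words K) (e i) (λ z → δ (basis m i) z * ψ v z))
                   (cong (e i *_) (trans (∑-words-δ (basis m i) (ψ v) (basis≤K i)) (dual i))))) ⟩
          ∑ (allFin (h m)) (λ i → e i * 𝟙 (j Finₚ.≟ i))
            ≡⟨ ∑-cong (allFin (h m)) (λ i → ℤₚ.*-comm (e i) (𝟙 (j Finₚ.≟ i))) ⟩
          ∑ (allFin (h m)) (λ i → 𝟙 (j Finₚ.≟ i) * e i)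
            ≡⟨ ∑-𝟙-Fin j e ⟩
          e j ∎

      -- Spanning by normal words

      record Spanned (m : ℕ) (f : Series d) : Set where
        constructor spannedBy
        field
          coefficients : Fin (h m) → ℤ
          remainder    : Ideal p ρ (f -S lincomb (h m) coefficients (δ ∘ basis m))

      Spanned-resp : ∀ {m f g} → (∀ z → f z ≋ g z) → Spanned m f → Spanned m g
      Spanned-resp f≋g (spannedBy e f-e) = spannedBy e (Ideal-resp p ρ (λ z → -‿≋ (f≋g z) ≋-refl) f-e)

      Spanned-ideal : ∀ {m f} → Ideal p ρ f → Spanned m f
      Spanned-ideal {m} {f} f∈I = spannedBy (λ _ → 0ℤ) (Ideal-resp p ρ (λ z → ≋-reflexive (sym (trans
        (cong (λ s → f z - s) (trans (lincomb≡∑ (h m) (λ _ → 0ℤ) (δ ∘ basis m) z) (∑-zeros (allFin (h m)) (λ _ → refl))))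
        (ℤₚ.+-identityʳ (f z))))) f∈I)

      Spanned-+ : ∀ {m f g} → Spanned m f → Spanned m g → Spanned m (f +S g)
      Spanned-+ {m} {f} {g} (spannedBy e f-e) (spannedBy e′ g-e′) = spannedBy (λ j → e j + e′ j)
        (Ideal-resp p ρ (λ z → ≋-reflexive (trans (regroup (f z) (g z) _ _) (cong (λ s → (f z + g z) - s) (sym (split z))))) (Ideal-+ p ρ f-e g-e′))
        where
        regroup : ∀ a b c d → (a - c) + (b - d) ≡ (a + b) - (c + d)
        regroup = solve-∀
        split : ∀ z → lincomb (h m) (λ j → e j + e′ j) (δ ∘ basis m) z ≡ lincomb (h m) e (δ ∘ basis m) z + lincomb (h m) e′ (δ ∘ basis m) z
        split z = trans (lincomb≡∑ (h m) _ _ z) (trans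
          (trans (∑-cong (allFin (h m)) (λ j → ℤₚ.*-distribʳ-+ (δ (basis m j) z) (e j) (e′ j))) (∑-+ (allFin (h m)) (λ j → e j * δ (basis m j) z) (λ j → e′ j * δ (basis m j) z)))
          (sym (cong₂ _+_ (lincomb≡∑ (h m) e (δ ∘ basis m) z) (lincomb≡∑ (h m) e′ (δ ∘ basis m) z))))

      Spanned-· : ∀ k {m f} → Spanned m f → Spanned m (k ·S f)
      Spanned-· k {m} {f} (spannedBy e f-e) = spannedBy (λ j → k * e j)
        (Ideal-resp p ρ (λ z → ≋-reflexive (trans (distribute k (f z) _) (cong (λ s → k * f z - s) (sym (scale z))))) (Ideal-· p ρ k f-e))
        where
        distribute : ∀ k a b → k * (a - b) ≡ k * a - k * b
        distribute = solve-∀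
        scale : ∀ z → lincomb (h m) (λ j → k * e j) (δ ∘ basis m) z ≡ k * lincomb (h m) e (δ ∘ basis m) z
        scale z = trans (lincomb≡∑ (h m) _ _ z) (trans
          (trans (∑-cong (allFin (h m)) (λ j → ℤₚ.*-assoc k (e j) (δ (basis m j) z))) (∑-*ˡ (allFin (h m)) k (λ j → e j * δ (basis m j) z)))
          (sym (cong (k *_) (lincomb≡∑ (h m) e (δ ∘ basis m) z))))

      Spanned-∑ : ∀ {m} L {F : Word d → Series d} → (∀ t → Spanned m (F t)) → Spanned m (λ z → ∑ L (λ t → F t z))
      Spanned-∑ []      F-spanned = Spanned-ideal (Ideal-zero p ρ)
      Spanned-∑ (t ∷ L) F-spanned = Spanned-+ (F-spanned t) (Spanned-∑ L F-spanned)

      Spanned-zero : ∀ {m f} → (∀ z → f z ≋ 0ℤ) → Spanned m f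
      Spanned-zero f≋0 = Spanned-resp (λ z → ≋-sym (f≋0 z)) (Spanned-ideal (Ideal-zero p ρ))

      word-Spanned : ∀ m z → weight τ z ≡ m → Spanned m (δ z)
      word-Spanned m z = go (⊏-wellFounded z)
        where
        go : ∀ {z} → Acc _⊏_ z → weight τ z ≡ m → Spanned m (δ z)
        go {z} (acc rs) wt≡m with occurs? w z
        ... | no normal = spannedBy (λ j → 𝟙 (i Finₚ.≟ j)) (Ideal-resp p ρ (λ z′ → ≋-reflexive (sym (difference z′))) (Ideal-zero p ρ))
          where
          z∈ : z ∈ normalWords m
          z∈ = ∈ₚ.∈-filter⁺ (normal? m) (∈-words z (subst (length z ≤_) wt≡m (length≤weight z))) (wt≡m , normal)
          i : Fin (h m)
          i = Any.index z∈
          difference : ∀ z′ → δ z z′ - lincomb (h m) (λ j → 𝟙 (i Finₚ.≟ j)) (δ ∘ basis m) z′ ≡ 0ℤ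
          difference z′ = trans (cong (λ s → δ z z′ - s) (trans (lincomb≡∑ (h m) _ _ z′)
            (trans (∑-𝟙-Fin i (λ j → δ (basis m j) z′)) (cong (λ y → δ y z′) (sym (Anyₚ.lookup-index z∈)))))) (ℤₚ.+-inverseʳ (δ z z′))
        -- One rewriting step: modulo p, the word `a ++ w ++ b` is `u` times the generator between
        -- `a` and `b`, minus the `κ`-combination of `⊏`-smaller words.
        ... | yes (a , b , refl) = Spanned-resp (λ z′ → rewritten z′) (Spanned-+
                (Spanned-ideal (Ideal-· p ρ u (Ideal-generator p ρ {δ a} {δ b} (δ-IsPoly p a) (δ-IsPoly p b))))
                (Spanned-· -1ℤ (Spanned-∑ (words n) (λ t → smaller t (κ-support t)))))
          where
          smaller : ∀ t → κ t ≡ 0ℤ ⊎ t ⊏ w → Spanned m (κ t ·S δ (a ++ t ++ b))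
          smaller t (inj₁ κt≡0) = Spanned-zero (λ z′ → ≋-reflexive (cong (_* δ (a ++ t ++ b) z′) κt≡0))
          smaller t (inj₂ t⊏w)  = Spanned-· (κ t) (go (rs (⊏-context t⊏w a b)) (trans (proj₁ (⊏-context t⊏w a b)) wt≡m))
          rewritten : ∀ z′ → u * ((δ a *S ρ) *S δ b) z′ + -1ℤ * ∑ (words n) (λ t → κ t * δ (a ++ t ++ b) z′) ≋ δ (a ++ w ++ b) z′
          rewritten z′ =
            ≋-trans (+-≋ (*-≋ˡ u (≋-trans (≋-reflexive (δ-*S-*S-δ n ρ ρ-short a b z′)) (∑-≋ p (words n) (λ t → *-≋ʳ (φ t) (ρ≋ t))))) ≋-refl)
            (≋-trans (≋-reflexive (trans (cong (λ s → u * s + -1ℤ * S) total) (factor u c (φ w) S)))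
            (≋-trans (+-≋ (*-≋ʳ (φ w + S) u*c≋1) ≋-refl) (≋-reflexive (cancel (φ w) S))))
            where
            φ : Series d
            φ t = δ (a ++ t ++ b) z′
            S : ℤ
            S = ∑ (words n) (λ t → κ t * φ t)
            expand : ∀ c e k f → c * (e + k) * f ≡ c * (e * f + k * f)
            expand = solve-∀
            factor : ∀ u c x s → u * (c * (x + s)) + -1ℤ * s ≡ u * c * (x + s) + -1ℤ * s
            factor = solve-∀
            cancel : ∀ x s → 1ℤ * (x + s) + -1ℤ * s ≡ x
            cancel = solve-∀
            total : ∑ (words n) (λ t → c * (δ w t + κ t) * φ t) ≡ c * (φ w + S)
            total = trans (∑-cong (words n) (λ t → expand c (δ w t) (κ t) (φ t)))
              (trans (∑-*ˡ (words n) c (λ t → δ w t * φ t + κ t * φ t))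
              (cong (c *_) (trans (∑-+ (words n) (λ t → δ w t * φ t) (λ t → κ t * φ t))
                (cong (_+ S) (∑-words-δ w φ (length≤weight w))))))

      -- Homogeneity holds modulo p, so the integer coefficients outside weight `m` may be nonzero;
      -- `f` is recovered from finitely many words only up to congruence.
      homogeneous-Spanned : ∀ m f → Homog p τ m f → Spanned m f
      homogeneous-Spanned m f f-homogeneous = Spanned-resp reconstruct (Spanned-∑ (words m) spanned)
        where
        spanned : ∀ z → Spanned m (f z ·S δ z)
        spanned z with weight τ z ℕₚ.≟ m
        ... | yes wt≡m = Spanned-· (f z) (word-Spanned m z wt≡m)
        ... | no wt≢m  = Spanned-zero (λ z′ → *-≋ʳ (δ z z′) (from-≡[] {f z} {0ℤ} (f-homogeneous z wt≢m)))
        reconstruct : ∀ z′ → ∑ (words m) (λ z → f z * δ z z′) ≋ f z′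
        reconstruct z′ with weight τ z′ ℕₚ.≟ m
        ... | yes wt≡m = ≋-reflexive (trans
              (∑-cong (words m) (λ z → trans (ℤₚ.*-comm (f z) (δ z z′)) (cong (_* f z) (𝟙-sym _≟ʷ_ z z′))))
              (∑-words-δ z′ f (subst (length z′ ≤_) wt≡m (length≤weight z′))))
        ... | no wt≢m = ≋-trans (∑-≋0 p (words m) vanish) (≋-sym fz′≋0)
          where
          fz′≋0 : f z′ ≋ 0ℤ
          fz′≋0 = from-≡[] {f z′} {0ℤ} (f-homogeneous z′ wt≢m)
          vanish : ∀ z → f z * δ z z′ ≋ 0ℤ
          vanish z with z ≟ʷ z′
          ... | yes refl = *-≋ʳ 1ℤ fz′≋0
          ... | no _     = ≋-reflexive (ℤₚ.*-zeroʳ (f z))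

      quotDim : ∀ m → QuotDim p τ ρ m (h m)
      quotDim m = δ ∘ basis m
        , (λ j z wt≢m → to-≡[] (≋-reflexive (δ-≢ {u = basis m j} {z} (λ eq → wt≢m (trans (cong (weight τ) (sym eq)) (proj₁ (basis-normal m j)))))))
        , (λ f f-homogeneous → let spannedBy e f-e = homogeneous-Spanned m f f-homogeneous in e , Ideal⇒InIdeal p ρ f-e)
        , (λ e e∈I j → to-≡[] (basis-independent m e (InIdeal⇒Ideal p ρ e∈I) j))

  -- Counting normal words

  matchPrefix : Word d → Series d → Series d
  matchPrefix u G z with prefix? u z
  ... | yes (b , _) = G b
  ... | no _        = 0ℤ

  matchPrefix-yes : ∀ u G b → matchPrefix u G (u ++ b) ≡ G b
  matchPrefix-yes u G b with prefix? u (u ++ b)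
  ... | yes (b′ , eq) = cong G (sym (Listₚ.++-cancelˡ u b b′ eq))
  ... | no ¬prefix    = contradiction (b , refl) ¬prefix

  matchPrefix-no : ∀ u G z → ¬ (∃ λ b → z ≡ u ++ b) → matchPrefix u G z ≡ 0ℤ
  matchPrefix-no u G z ¬prefix with prefix? u z
  ... | yes prefix = contradiction prefix ¬prefix
  ... | no _       = refl

  matchPrefix-∷ : ∀ x u G i z → matchPrefix (x ∷ u) G (i ∷ z) ≡ 𝟙 (x Finₚ.≟ i) * matchPrefix u G z
  matchPrefix-∷ x u G i z with x Finₚ.≟ i
  ... | no _ = refl
  ... | yes refl with prefix? u z
  ... | yes (b , refl) = sym (ℤₚ.*-identityˡ (G b))
  ... | no _           = refl

  ∑-matchPrefix : ∀ u G K → ∑ (words (length u ℕ.+ K)) (matchPrefix u G) ≡ ∑ (words K) G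
  ∑-matchPrefix []      G K = refl
  ∑-matchPrefix (x ∷ u) G K = begin
    ∑ (words (suc M)) (matchPrefix (x ∷ u) G)
      ≡⟨ trans (∑-words-suc M (matchPrefix (x ∷ u) G)) (ℤₚ.+-identityˡ _) ⟩
    ∑ (allFin d) (λ i → ∑ (words M) (λ z → matchPrefix (x ∷ u) G (i ∷ z)))
      ≡⟨ ∑-cong (allFin d) (λ i → trans (∑-cong (words M) (matchPrefix-∷ x u G i)) (∑-*ˡ (words M) (𝟙 (x Finₚ.≟ i)) (matchPrefix u G))) ⟩
    ∑ (allFin d) (λ i → 𝟙 (x Finₚ.≟ i) * ∑ (words M) (matchPrefix u G))
      ≡⟨ ∑-𝟙-Fin x (λ _ → ∑ (words M) (matchPrefix u G)) ⟩
    ∑ (words M) (matchPrefix u G)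
      ≡⟨ ∑-matchPrefix u G K ⟩
    ∑ (words K) G ∎
    where
    open ≡-Reasoning
    M : ℕ
    M = length u ℕ.+ K

  -- The additive form avoids truncated subtraction: for `k` above `m` no word qualifies, in
  -- agreement with the default 0 in `PoincareEq`.
  normalAfter? : ∀ k m z → Dec (k ℕ.+ weight τ z ≡ m × ¬ Occurs w z)
  normalAfter? k m z = (k ℕ.+ weight τ z ℕₚ.≟ m) ×-dec ¬? (occurs? w z)

  h≡∑ : ∀ m → + h m ≡ ∑ (words m) (λ z → 𝟙 (normal? m z))
  h≡∑ m = length-filter≡∑ (normal? m) (words m)

  ∑-normal : ∀ {K m} → m ≤ K → ∑ (words K) (λ z → 𝟙 (normal? m z)) ≡ + h m
  ∑-normal {K} {m} m≤K = trans (∑-words-extend m≤K (λ z m<z → 𝟙-no (normal? m z)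
    (λ { (wt≡m , _) → ℕₚ.<-irrefl (sym wt≡m) (ℕₚ.<-≤-trans m<z (length≤weight z)) }))) (sym (h≡∑ m))

  𝟙-cong : ∀ {P Q : Set} (P? : Dec P) (Q? : Dec Q) → (P → Q) → (Q → P) → 𝟙 P? ≡ 𝟙 Q?
  𝟙-cong (yes P) Q? to from = sym (𝟙-yes Q? (to P))
  𝟙-cong (no ¬P) Q? to from = sym (𝟙-no Q? (¬P ∘ from))

  ∑-normalAfter : ∀ {K m} k → m ≤ K → ∑ (words K) (λ z → 𝟙 (normalAfter? k m z)) ≡ (if k ≤ᵇ m then + h (m ℕ.∸ k) else 0ℤ)
  ∑-normalAfter {K} {m} k m≤K with k ≤ᵇ m in eq
  ... | true  = trans (∑-cong (words K) (λ z → 𝟙-cong (normalAfter? k m z) (normal? (m ℕ.∸ k) z)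
          (λ { (wt≡ , normal) → trans (sym (ℕₚ.m+n∸m≡n k (weight τ z))) (cong (ℕ._∸ k) wt≡) , normal })
          (λ { (wt≡ , normal) → trans (cong (k ℕ.+_) wt≡) (ℕₚ.m+[n∸m]≡n (ℕₚ.≤ᵇ⇒≤ k m (subst T (sym eq) _))) , normal })))
        (∑-normal (ℕₚ.≤-trans (ℕₚ.m∸n≤m m k) m≤K))
  ... | false = ∑-zeros (words K) (λ z → 𝟙-no (normalAfter? k m z)
          (λ { (wt≡ , _) → subst T eq (ℕₚ.≤⇒≤ᵇ (subst (k ≤_) wt≡ (ℕₚ.m≤m+n k (weight τ z)))) }))

  -- A letter in front of a normal word gives either a normal word or w followed by
  -- a normal word.
  normal-∷ : ∀ m i z → 𝟙 (normalAfter? (τ i) m z) ≡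
             𝟙 (normal? m (i ∷ z)) + matchPrefix w (λ b → 𝟙 (normalAfter? n m b)) (i ∷ z)
  normal-∷ m i z = cases (prefix? w (i ∷ z)) (occurs? w z)
    where
    G : Series d
    G b = 𝟙 (normalAfter? n m b)
    cases : Dec (∃ λ b → i ∷ z ≡ w ++ b) → Dec (Occurs w z) →
            𝟙 (normalAfter? (τ i) m z) ≡ 𝟙 (normal? m (i ∷ z)) + matchPrefix w G (i ∷ z)
    cases (yes (b , refl)) occurs = trans (𝟙-cong (normalAfter? (τ i) m z) (normalAfter? n m b) to from)
      (sym (trans (cong₂ _+_ (𝟙-no (normal? m (i ∷ z)) (λ { (_ , normal) → normal ([] , b , refl) })) (matchPrefix-yes w G b)) (ℤₚ.+-identityˡ _)))
      where
      to : τ i ℕ.+ weight τ z ≡ m × ¬ Occurs w z → n ℕ.+ weight τ b ≡ m × ¬ Occurs w b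
      to (wt≡ , normal) = trans (sym (weight-++ τ w b)) wt≡ ,
        λ { (a , e , refl) → normal (w₀ ++ a , e , sym (Listₚ.++-assoc w₀ a (w ++ e))) }
      from : n ℕ.+ weight τ b ≡ m × ¬ Occurs w b → τ i ℕ.+ weight τ z ≡ m × ¬ Occurs w z
      -- An occurrence of `w` in the tail `z` is a second one in `w ++ b`; unborderedness pushes it
      -- entirely into `b`.
      from (wt≡ , normal) = trans (weight-++ τ w b) wt≡ , λ { (a , e , z≡) → prepend a e (Unbordered-overlap {w = w} unbordered (cong (i ∷_) z≡)) }
        where
        prepend : ∀ a e → ¬ (∃ λ f → i ∷ a ≡ w ++ f × b ≡ f ++ w ++ e)
        prepend a e (f , _ , b≡) = normal (f , e , b≡)
    cases (no ¬prefix) (yes (a , b , z≡)) = trans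
      (𝟙-no (normalAfter? (τ i) m z) (λ { (_ , normal) → normal (a , b , z≡) }))
      (sym (cong₂ _+_ (𝟙-no (normal? m (i ∷ z)) (λ { (_ , normal) → normal (i ∷ a , b , cong (i ∷_) z≡) })) (matchPrefix-no w G (i ∷ z) ¬prefix)))
    cases (no ¬prefix) (no normal) = trans
      (𝟙-cong (normalAfter? (τ i) m z) (normal? m (i ∷ z))
        (λ { (wt≡ , _) → wt≡ , λ { ([] , b , iz≡) → ¬prefix (b , iz≡) ; (_ ∷ a , b , iz≡) → normal (a , b , Listₚ.∷-injectiveʳ iz≡) } })
        (λ { (wt≡ , _) → wt≡ , normal }))
      (sym (trans (cong (λ s → 𝟙 (normal? m (i ∷ z)) + s) (matchPrefix-no w G (i ∷ z) ¬prefix)) (ℤₚ.+-identityʳ _)))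

  -- Summing `normal-∷` over letters and tails gives the terms for `τ i` on the left, and on the
  -- right the nonempty normal words of weight `m` plus the term for `n`. What remains is the empty
  -- word, which accounts for the constant 1.
  poincareEq : PoincareEq τ n h
  poincareEq m = begin
    (+ h m - sumFin {d} d (λ i → after (τ i))) + after n
      ≡⟨ cong (λ s → (+ h m - s) + after n) (trans (sumFin≡∑ d (λ i → after (τ i))) (∑-cong (allFin d) (λ i → sym (∑-normalAfter (τ i) m≤M)))) ⟩
    (+ h m - ∑ (allFin d) (λ i → ∑ (words M) (λ z → 𝟙 (normalAfter? (τ i) m z)))) + after n
      ≡⟨ cong (λ s → (+ h m - s) + after n) (trans
           (∑-cong (allFin d) (λ i → trans (∑-cong (words M) (normal-∷ m i)) (∑-+ (words M) (λ z → 𝟙 (normal? m (i ∷ z))) (λ z → matchPrefix w G (i ∷ z)))))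
           (∑-+ (allFin d) (λ i → ∑ (words M) (λ z → 𝟙 (normal? m (i ∷ z)))) (λ i → ∑ (words M) (λ z → matchPrefix w G (i ∷ z))))) ⟩
    (+ h m - (P + Q)) + after n
      ≡⟨ cong₂ (λ s t → (s - (P + Q)) + t) total-normal total-prefixed ⟩
    ((𝟙 (normal? m []) + P) - (P + Q)) + Q
      ≡⟨ cancel (𝟙 (normal? m [])) P Q ⟩
    𝟙 (normal? m [])
      ≡⟨ empty m ⟩
    (if m ≡ᵇ 0 then 1ℤ else 0ℤ) ∎
    where
    open ≡-Reasoning
    after : ℕ → ℤ
    after k = if k ≤ᵇ m then + h (m ℕ.∸ k) else 0ℤ
    -- Chosen so that `suc M` is `length w ℕ.+ m`, the range required by `∑-matchPrefix`.
    M : ℕ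
    M = length w₀ ℕ.+ m
    m≤M : m ≤ M
    m≤M = ℕₚ.m≤n+m m (length w₀)
    G : Series d
    G b = 𝟙 (normalAfter? n m b)
    P Q : ℤ
    P = ∑ (allFin d) (λ i → ∑ (words M) (λ z → 𝟙 (normal? m (i ∷ z))))
    Q = ∑ (allFin d) (λ i → ∑ (words M) (λ z → matchPrefix w G (i ∷ z)))
    total-normal : + h m ≡ 𝟙 (normal? m []) + P
    total-normal = trans (sym (∑-normal (ℕₚ.m≤n⇒m≤1+n m≤M))) (∑-words-suc M (λ z → 𝟙 (normal? m z)))
    total-prefixed : after n ≡ Q
    total-prefixed = trans (sym (∑-normalAfter n ℕₚ.≤-refl)) (trans (sym (∑-matchPrefix w G m))
      (trans (∑-words-suc M (matchPrefix w G)) (ℤₚ.+-identityˡ Q)))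
    cancel : ∀ e x y → ((e + x) - (x + y)) + y ≡ e
    cancel = solve-∀
    []-normal : ¬ Occurs w []
    []-normal ([] , _ , ())
    []-normal (_ ∷ _ , _ , ())
    empty : ∀ m → 𝟙 (normal? m []) ≡ (if m ≡ᵇ 0 then 1ℤ else 0ℤ)
    empty zero    = 𝟙-yes (normal? 0 []) (refl , []-normal)
    empty (suc m) = 𝟙-no (normal? (suc m) []) (λ ())

-- Initial forms

firstSuch : ∀ {k} {A B : Fin k → Set} → (∀ i → A i ⊎ B i) → (∀ i → A i) ⊎ (∃ λ i → B i × (∀ j → j Fin.< i → A j))
firstSuch {zero}  A⊎B = inj₁ λ ()
firstSuch {suc k} A⊎B with A⊎B Fin.zero | firstSuch (A⊎B ∘ Fin.suc)
... | inj₂ b | _                      = inj₂ (Fin.zero , b , λ _ ())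
... | inj₁ a | inj₁ as                = inj₁ λ { Fin.zero → a ; (Fin.suc i) → as i }
... | inj₁ a | inj₂ (i , b , before) = inj₂ (Fin.suc i , b , λ { Fin.zero _ → a ; (Fin.suc j) (s≤s j<i) → before j j<i })

module _ {d : ℕ} where

  leastWord : ∀ K {P : Word d → Set} → (∀ z → Dec (P z)) →
    (∀ z → length z ≤ K → ¬ P z) ⊎ (∃ λ z → P z × (∀ z′ → length z′ ≤ K → P z′ → z ≼ z′))
  leastWord K P? with P? []
  leastWord K       P? | yes P[] = inj₂ ([] , P[] , λ _ _ _ → []≼)
  leastWord zero    P? | no ¬P[] = inj₁ λ { [] _ → ¬P[] ; (_ ∷ _) () }
  leastWord (suc K) P? | no ¬P[] with firstSuch (λ i → leastWord K (P? ∘ (i ∷_)))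
  ... | inj₁ none = inj₁ λ { [] _ → ¬P[] ; (i ∷ z) (s≤s z≤K) → none i z z≤K }
  ... | inj₂ (i , (z , Piz , z-least) , before) = inj₂ (i ∷ z , Piz , λ
        { [] _ P[] → contradiction P[] ¬P[]
        ; (j ∷ z′) (s≤s z′≤K) Pjz′ → least j z′ z′≤K Pjz′ })
    where
    least : ∀ j z′ → length z′ ≤ K → _ → i ∷ z ≼ j ∷ z′
    least j z′ z′≤K Pjz′ with Finₚ.<-cmp i j
    ... | tri< i<j _ _  = head i<j
    ... | tri≈ _ refl _ = tail (z-least z′ z′≤K Pjz′)
    ... | tri> _ _ j<i  = contradiction Pjz′ (before j j<i z′ z′≤K)

  weight-power : ∀ (τ : Fin d → ℕ) l m → weight τ (power l m) ≡ m ℕ.* weight τ l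
  weight-power τ l zero    = refl
  weight-power τ l (suc m) = trans (weight-++ τ l (power l m)) (cong (weight τ l ℕ.+_) (weight-power τ l m))

  -- The multiple by `2 ℕ.+ m` is a sum of proper shuffle sums and so zero in ℤ, where the factor
  -- cancels whether or not p divides it.
  primitive-dividedPower : ∀ {g : Series d} → Primitive g → ∀ x l m → ∑ (dividedPower x l (2 ℕ.+ m)) g ≡ 0ℤ
  primitive-dividedPower {g} prim x l m with ℤₚ.i*j≡0⇒i≡0∨j≡0 (+ (2 ℕ.+ m))
    (trans (sym (∑-shuffles-dividedPower x l (suc m) g))
           (∑-zero-All (All.map (λ { (b , v , refl) → Primitive.shuffle-zero prim x l b v }) (dividedPower-nonempty x l m))))
  ... | inj₂ eq = eq

  initForm-homogeneous : ∀ τ n (r : Series d) t → weight τ t ≢ n → initForm τ n r t ≡ 0ℤ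
  initForm-homogeneous τ n r t wt≢n with weight τ t ≡ᵇ n in eq
  ... | true  = contradiction (ℕₚ.≡ᵇ⇒≡ (weight τ t) n (subst T (sym eq) _)) wt≢n
  ... | false = refl

  initForm-weight : ∀ τ n (r : Series d) t → weight τ t ≡ n → initForm τ n r t ≡ (r -S oneS) t
  initForm-weight τ n r t wt≡n with weight τ t ≡ᵇ n in eq
  ... | true  = refl
  ... | false = contradiction (ℕₚ.≡⇒≡ᵇ (weight τ t) n wt≡n) (subst (¬_ ∘ T) (sym eq) (λ ()))

  InFτ-mono : ∀ {p τ m n} {r : Series d} → m ≤ n → InFτ p τ n r → InFτ p τ m r
  InFτ-mono m≤n r∈Fn w w<m = r∈Fn w (ℕₚ.<-≤-trans w<m m≤n)

  -- `Mild` quantifies over every degree in which an initial form may live; this identifies that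
  -- degree with the one given in (ii).
  InFτ-degree-unique : ∀ {p τ m n} {r : Series d} → InFτ p τ m r → ¬ InFτ p τ (suc m) r →
                       InFτ p τ n r → ¬ InFτ p τ (suc n) r → m ≡ n
  InFτ-degree-unique {p} {τ} {m} {n} {r} r∈m r∉m r∈n r∉n with ℕₚ.<-cmp m n
  ... | tri≈ _ m≡n _ = m≡n
  ... | tri< m<n _ _ = contradiction (InFτ-mono {p} {τ} {r = r} m<n r∈n) r∉m
  ... | tri> _ _ n<m = contradiction (InFτ-mono {p} {τ} {r = r} n<m r∈m) r∉n

  module _ (p : ℕ) (τ : Fin d → ℕ) (τ-pos : ∀ i → 0 < τ i) where
    open Congruence p
    open Rewriting τ τ-pos

    initForm-≢0 : ∀ {n} {r : Series d} → InFτ p τ n r → ¬ InFτ p τ (suc n) r → ¬ (∀ z → initForm τ n r z ≋ 0ℤ)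
    initForm-≢0 {n} {r} r∈Fn r∉Fn+1 ρ≋0 = r∉Fn+1 in-next
      where
      in-next : InFτ p τ (suc n) r
      in-next z z<1+n with ℕₚ.m≤n⇒m<n∨m≡n (ℕₚ.≤-pred z<1+n)
      ... | inj₁ z<n = r∈Fn z z<n
      ... | inj₂ z≡n = to-≡[] (subst (_≋ 0ℤ) (initForm-weight τ n r z z≡n) (ρ≋0 z))

    initForm-[] : ∀ {n} {r : Series d} → InF2 p r → initForm τ n r [] ≋ 0ℤ
    initForm-[] {n} {r} r∈F2 with 0 ≡ᵇ n
    ... | true  = from-≡[] (r∈F2 [] (s≤s z≤n))
    ... | false = ≋-refl

    unbordered-StronglyFree : Prime p → ∀ (ρ : Series d) x₀ w₀ → Unbordered (x₀ ∷ w₀) →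
      (∀ t → weight τ t ≢ weight τ (x₀ ∷ w₀) → ρ t ≡ 0ℤ) →
      ¬ ρ (x₀ ∷ w₀) ≋ 0ℤ → (∀ z → z ≺ x₀ ∷ w₀ → ρ z ≋ 0ℤ) →
      StronglyFree p τ (weight τ (x₀ ∷ w₀)) ρ
    unbordered-StronglyFree p-prime ρ x₀ w₀ unbordered homogeneous ρw≢0 below =
      OneRelator.h τ τ-pos x₀ w₀ unbordered ,
      OneRelator.quotDim τ τ-pos x₀ w₀ unbordered p κ κ-support ρ homogeneous u (ρ w) u*ρw≋1 ρ≋ ,
      OneRelator.poincareEq τ τ-pos x₀ w₀ unbordered
      where
      w : Word d
      w = x₀ ∷ w₀
      u : ℤ
      u = proj₁ (prime⇒invertible p-prime (ρ w) ρw≢0)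
      u*ρw≋1 : u * ρ w ≋ 1ℤ
      u*ρw≋1 = proj₂ (prime⇒invertible p-prime (ρ w) ρw≢0)
      -- Below `w` the integer `ρ t` is a multiple of p but possibly nonzero. Setting it to an exact
      -- 0 keeps the rule oriented.
      κ : Series d
      κ t with ≼-or-≻ t w
      ... | inj₁ _ = 0ℤ
      ... | inj₂ _ = u * ρ t
      κ-support : ∀ t → κ t ≡ 0ℤ ⊎ t ⊏ w
      κ-support t with ≼-or-≻ t w
      ... | inj₁ _ = inj₁ refl
      ... | inj₂ w≺t with weight τ t ℕₚ.≟ weight τ w
      ... | yes wt≡ = inj₂ (wt≡ , w≺t)
      ... | no wt≢  = inj₁ (trans (cong (u *_) (homogeneous t wt≢)) (ℤₚ.*-zeroʳ u))
      ρ≋ : ∀ t → ρ t ≋ ρ w * (δ w t + κ t)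
      ρ≋ t with ≼-or-≻ t w
      ... | inj₂ w≺t = ≋-sym (≋-trans (≋-reflexive (trans (cong (λ e → ρ w * (e + u * ρ t)) (δ-≢ {u = w} {t} (λ { refl → ≺-irrefl w≺t })))
                                              (rearrange (ρ w) u (ρ t))))
                             (≋-trans (*-≋ʳ (ρ t) u*ρw≋1) (≋-reflexive (ℤₚ.*-identityˡ (ρ t)))))
        where
        rearrange : ∀ c u x → c * (0ℤ + u * x) ≡ u * c * x
        rearrange = solve-∀
      ... | inj₁ t≼w with ≼⇒≡⊎≺ t≼w
      ... | inj₁ refl = ≋-reflexive (sym (trans (cong (λ e → ρ w * (e + 0ℤ)) (𝟙-yes (w ≟ʷ w) refl)) (ℤₚ.*-identityʳ (ρ w))))
      ... | inj₂ t≺w  = ≋-trans (below t t≺w)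
            (≋-reflexive (sym (trans (cong (λ e → ρ w * (e + 0ℤ)) (δ-≢ {u = w} {t} (λ { refl → ≺-irrefl t≺w }))) (ℤₚ.*-zeroʳ (ρ w)))))

    -- The common core of both parts, which differ in how they supply the shuffle and divided power
    -- relations.
    shuffleZero-StronglyFree : Prime p → ∀ (ρ : Series d) n →
      (∀ t → weight τ t ≢ n → ρ t ≡ 0ℤ) → ¬ (∀ z → ρ z ≋ 0ℤ) → ρ [] ≋ 0ℤ →
      (∀ a u b v → ∑ (shuffles (a ∷ u) (b ∷ v)) ρ ≋ 0ℤ) →
      (∀ x l m → weight τ (power (x ∷ l) (2 ℕ.+ m)) ≡ n → ∑ (dividedPower x l (2 ℕ.+ m)) ρ ≋ 0ℤ) →
      StronglyFree p τ n ρ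
    shuffleZero-StronglyFree p-prime ρ n homogeneous ρ≢0 ρ[]≋0 ρ-shuffle ρ-divided
      -- The bound `n` loses nothing: words of weight `n` have length at most `n`, and in other
      -- weights `ρ` is exactly zero.
      with leastWord n (λ z → ¬? (ρ z ≡[]? 0ℤ))
    ... | inj₁ none = contradiction everywhere ρ≢0
      where
      everywhere : ∀ z → ρ z ≋ 0ℤ
      everywhere z with ρ z ≡[]? 0ℤ | weight τ z ℕₚ.≟ n
      ... | yes ρz≋0 | _        = ρz≋0
      ... | no ρz≢0  | yes refl = contradiction ρz≢0 (none z (length≤weight z))
      ... | no _     | no wt≢n  = ≋-reflexive (homogeneous z wt≢n)
    ... | inj₂ ([] , ρ[]≢0 , _) = contradiction ρ[]≋0 ρ[]≢0
    ... | inj₂ (x₀ ∷ w₀ , ρw≢0 , least) = conclude weight-w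
      where
      weight-w : weight τ (x₀ ∷ w₀) ≡ n
      weight-w with weight τ (x₀ ∷ w₀) ℕₚ.≟ n
      ... | yes wt≡n = wt≡n
      ... | no wt≢n  = contradiction (≋-reflexive (homogeneous (x₀ ∷ w₀) wt≢n)) ρw≢0
      below : ∀ z → z ≺ x₀ ∷ w₀ → ρ z ≋ 0ℤ
      below z z≺w with ρ z ≡[]? 0ℤ | weight τ z ℕₚ.≟ n
      ... | yes ρz≋0 | _        = ρz≋0
      ... | no ρz≢0  | yes refl = ⊥-elim (≺-irrefl (≼-≺-trans (least z (length≤weight z) ρz≢0) z≺w))
      ... | no _     | no wt≢n  = ≋-reflexive (homogeneous z wt≢n)
      unbordered : Unbordered (x₀ ∷ w₀)
      unbordered = leadingWord-Unbordered p ρ x₀ w₀ ρ-shuffle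
        (λ x l m eq → ρ-divided x l m (trans (cong (weight τ) eq) weight-w)) below ρw≢0
      conclude : weight τ (x₀ ∷ w₀) ≡ n → StronglyFree p τ n ρ
      conclude refl = unbordered-StronglyFree p-prime ρ x₀ w₀ unbordered homogeneous ρw≢0 below

    Lie-Mild : Prime p → ∀ (r : Series d) → InF2 p r →
      (∀ n → InFτ p τ n r → ¬ InFτ p τ (suc n) r → IsLie p (initForm τ n r)) → Mild p τ r
    Lie-Mild p-prime r r∈F2 ρ-Lie n r∈Fn r∉Fn+1 with Lie⇒primitive p (ρ-Lie n r∈Fn r∉Fn+1)
    ... | g , prim , ρ≋g = shuffleZero-StronglyFree p-prime (initForm τ n r) n
      (initForm-homogeneous τ n r) (initForm-≢0 {n} {r} r∈Fn r∉Fn+1) (initForm-[] {n} {r} r∈F2)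
      (λ a u b v → ≋-trans (∑-≋ p (shuffles (a ∷ u) (b ∷ v)) ρ≋g) (≋-reflexive (Primitive.shuffle-zero prim a u b v)))
      (λ x l m _ → ≋-trans (∑-≋ p (dividedPower x l (2 ℕ.+ m)) ρ≋g) (≋-reflexive (primitive-dividedPower prim x l m)))

    coprime-Mild : Prime p → ∀ n → Coprime n p → ∀ (r : Series d) → InF p r → InF2 p r →
      InFτ p τ n r → ¬ InFτ p τ (suc n) r → Mild p τ r
    coprime-Mild p-prime n n⊥p r r∈F r∈F2 r∈Fn r∉Fn+1 n′ r∈Fn′ r∉Fn′+1
      with InFτ-degree-unique {p} {τ} {n′} {n} {r} r∈Fn′ r∉Fn′+1 r∈Fn r∉Fn+1
    ... | refl = shuffleZero-StronglyFree p-prime ρ n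
      (initForm-homogeneous τ n r) (initForm-≢0 {n} {r} r∈Fn r∉Fn+1) (initForm-[] {n} {r} r∈F2) ρ-shuffle ρ-divided
      where
      ρ : Series d
      ρ = initForm τ n r
      ρ-shuffle : ∀ a u b v → ∑ (shuffles (a ∷ u) (b ∷ v)) ρ ≋ 0ℤ
      ρ-shuffle = InF⇒shuffle-≋0 p τ τ-pos {r} n r∈F r∈Fn
      ρ-divided : ∀ x l m → weight τ (power (x ∷ l) (2 ℕ.+ m)) ≡ n → ∑ (dividedPower x l (2 ℕ.+ m)) ρ ≋ 0ℤ
      ρ-divided x l m wt≡n = invertible⇒nonZeroDivisor {u = proj₁ (coprime⇒invertible multiplicity⊥p)} {a = + (2 ℕ.+ m)} (proj₂ (coprime⇒invertible multiplicity⊥p))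
        (≋-trans (≋-reflexive (sym (∑-shuffles-dividedPower x l (suc m) ρ)))
        (≋-trans (∑-≋-All p (All.map (λ { (b , v , refl) → ρ-shuffle x l b v }) (dividedPower-nonempty x l m)))
                 (≋-reflexive (∑-zero (dividedPower x l (suc m))))))
        where
        multiplicity⊥p : Coprime (2 ℕ.+ m) p
        multiplicity⊥p (k∣m , k∣p) = n⊥p (ℕ∣.∣-trans k∣m (subst (2 ℕ.+ m ℕ∣.∣_) (trans (sym (weight-power τ (x ∷ l) (2 ℕ.+ m))) wt≡n)
          (ℕ∣.m∣m*n (weight τ (x ∷ l)))) , k∣p)

theorem5p9 : (d p : ℕ) → Prime p →
    ((τ : Fin d → ℕ) → (∀ i → 0 < τ i) → (r : Series d) →
      InF p r → InF2 p r → ¬ (r ≈S[ p ] oneS) →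
      (∀ n → InFτ p τ n r → ¬ InFτ p τ (suc n) r → IsLie p (initForm τ n r)) →
      Mild p τ r)
    ×
    ((τ : Fin d → ℕ) → (∀ i → 0 < τ i) → (n : ℕ) → Coprime n p → (r : Series d) →
      InF p r → InF2 p r → InFτ p τ n r → ¬ InFτ p τ (suc n) r →
      Mild p τ r)
theorem5p9 d p p-prime =
  (λ τ τ-pos r _ r∈F2 _ ρ-Lie → Lie-Mild p τ τ-pos p-prime r r∈F2 ρ-Lie) ,
  (λ τ τ-pos n n⊥p r → coprime-Mild p τ τ-pos p-prime n n⊥p r)
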